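{- Let $p\ge 5$ be a prime, $q=p^l$, $n\ge 2$ and $k\ge1$ integers, and $d=\gcd(k,q-1)$. Suppose $q>d^2$, $p\nmid k$, and $\gcd\big((q-1)/d,\,p-1\big)\ge 2$ (equivalently, the cyclic group $\mathbb F_p^\times\cap\{x^d\mid x\in\mathbb F_q\}$ has at least 2 elements). Then for $n>\max\left\{\frac{p^2-3p+9}{2},\frac{4\ln(k-1)}{\ln q}\right\}$ every matrix in $M_n(\mathbb F_q)$ is of the form $A^k+B^k$ with $A,B\in M_n(\mathbb F_q)$.
   Context: Convention: $\ln(0)=-\infty$ (relevant when $k=1$). -}

module Defs where

open import Level using (Level; _⊔_)
open import Data.Nat using (ℕ; zero; suc)
open import Data.Fin using (Fin; zero; suc; _≟_)
open import Data.Product using (∃; _×_)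
open import Relation.Nullary using (¬_; yes; no)
open import Algebra.Bundles using (CommutativeRing)

record Field (c ℓ : Level) : Set (Level.suc (c ⊔ ℓ)) where
  field
    commutativeRing : CommutativeRing c ℓ
  open CommutativeRing commutativeRing public
  field
    1≉0     : ¬ (1# ≈ 0#)
    inverse : ∀ x → ¬ (x ≈ 0#) → ∃ λ y → (x * y) ≈ 1#

module Matrices {c ℓ : Level} (F : Field c ℓ) where
  open Field F using (Carrier; _≈_; _+_; _*_; 0#; 1#)

  Mat : ℕ → Set c
  Mat n = Fin n → Fin n → Carrier

  _≈ᴹ_ : ∀ {n} → Mat n → Mat n → Set ℓ
  A ≈ᴹ B = ∀ i j → A i j ≈ B i j

  Σᶠ : ∀ {m} → (Fin m → Carrier) → Carrier
  Σᶠ {zero}  f = 0#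
  Σᶠ {suc m} f = f zero + Σᶠ (λ i → f (suc i))

  _+ᴹ_ : ∀ {n} → Mat n → Mat n → Mat n
  (A +ᴹ B) i j = A i j + B i j

  _*ᴹ_ : ∀ {n} → Mat n → Mat n → Mat n
  (A *ᴹ B) i j = Σᶠ (λ t → A i t * B t j)

  Iᴹ : ∀ {n} → Mat n
  Iᴹ i j with i ≟ j
  ... | yes _ = 1#
  ... | no  _ = 0#

  _^ᴹ_ : ∀ {n} → Mat n → ℕ → Mat n
  A ^ᴹ zero    = Iᴹ
  A ^ᴹ (suc k) = A *ᴹ (A ^ᴹ k)

{-# OPTIONS --safe #-}
-- Let H be the set of nonzero k-th powers of F = F_q, so that |H| d ≥ q − 1.
--
-- Non-scalar M.  A triangular matrix whose diagonal entries lie in H is a k-th power: a root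
-- is built entry by entry, the coefficient of each new unknown being (μᵏ − αᵏ)/(μ − α) or
-- k μᵏ⁻¹ with μ, α among fixed representatives of the roots, hence nonzero.  A non-scalar M is
-- similar to a matrix with any prescribed diagonal of sum tr M, and then splits as a lower plus
-- an upper triangular matrix, so it is enough to write tr M as a sum of exactly 2n elements of H.
-- Put A = H ∪ {0}; then |A| |H| > q.  A second moment count gives ξ for which A + ξ H has more
-- than q/2 elements, and the pigeonhole principle gives a + ξ b = a′ + ξ b′ with b ≠ b′ in H.
-- Multiplying A + ξ H by b′ − b, every t is a sum of at most four and a difference of at most
-- four elements of H; since −h = (p − 1) h, it is a sum of exactly s elements for all s ≥ 4p,
-- and 4p ≤ 2n.
--
-- Scalar M = c ≠ 0.  In a field of Q elements with g = gcd(k, Q − 1) and g⁴ + 4 < Q, counting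
-- incidences of the points H × cH with the lines of slope and intercept in H shows that c is a
-- sum of two k-th powers; so M is one too as soon as F_Q acts on Fⁿ.  If gcd(k, qⁿ − 1) ≤ k/2,
-- take Q = qⁿ.  Otherwise k divides qⁿ − 1; write n = a + b with a, b ≥ 3 prime to n and use
-- F_{qᵃ} × F_{qᵇ}, where the gcd drops to a divisor of d.
--
-- The field F_{qᵐ} is cut out of F[x]/(x^(qᵐ−1) − 1), where y^(qᵐ) = y for all y, by
-- multiplying with idempotents, starting from the product of the x^(qʳ) − x with 0 < r < m:
-- where that product is nonzero, x has degree m over F.
module Submission where

open import Defs
open import Level using (Level; _⊔_)
open import Algebra.Bundles using (CommutativeRing; RawRing)
open import Data.Nat as ℕ using (ℕ; zero; suc; _≤_; _<_; z≤n; s≤s)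
import Data.Nat
import Data.Nat.Properties as ℕₚ
import Data.Nat.DivMod as DivMod
open import Data.Nat.GCD using (gcd; module Bézout; gcd-GCD; gcd[m,n]≢0)
open import Data.Nat.Tactic.RingSolver using (solve-∀)
open import Data.Fin as Fin using (Fin; zero; suc)
import Data.Fin.Properties as Finₚ
import Data.Fin.Relation.Unary.Top as Top
open import Data.Fin.Permutation using (Permutation; permutation)
open import Data.List using (List; []; _∷_; length; replicate; map; tabulate)
import Data.List.Properties as Listₚ
open import Data.Nat.Divisibility using (_∣_; divides; _∣?_)
import Data.Nat.Divisibility as Div
open import Data.Nat.Primality using (Prime; euclidsLemma; prime⇒nonZero)
open import Data.Product using (∃; ∃₂; _×_; _,_; proj₁; proj₂)
open import Data.Sum using (_⊎_; inj₁; inj₂)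
open import Data.Empty using (⊥-elim)
open import Data.Maybe using (Maybe; just; nothing)
open import Relation.Nullary using (¬_; Dec; yes; no)
open import Relation.Binary.Definitions using (tri<; tri≈; tri>)
open import Relation.Nullary.Decidable using (map′; ¬?; _×-dec_)
open import Relation.Binary.PropositionalEquality as ≡ using (_≡_; _≢_)
open import Function using (_∘_)
open import Function.Bundles using (Inverse)
open import Algebra.Properties.Semiring.Sum ℕₚ.+-*-semiring using (sum; sum-cong-≗; ∑-distrib-+; ∑-comm; sum-permute; *-distribˡ-sum; *-distribʳ-sum)

-- Zero is barred from the diagonal because, for k ≥ 2, the linear equations for a root degenerate
-- as soon as the eigenvalue 0 occurs twice. Hence each of the 2n diagonal places needs an element
-- of H, and a shorter sum is padded with 1. The bound on n is used as 2n ≥ p² - 3p + 10 ≥ 4p, which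
-- is (p - 2)(p - 5) ≥ 0.
--
-- Conjugation cannot alter a scalar matrix, and c need not be a sum of two powers in F: the
-- incidence count wants Q of size g⁴, while only q > d² is known. The bound (k - 1)⁴ < qⁿ just
-- misses this for g = k, so that divisor is treated apart. Blocks of degree 3 or more suffice
-- because d⁴ + 4 < q³, and degrees prime to n because a common divisor of qᵃ - 1 and qⁿ - 1 then
-- divides q - 1. For n = 6 there is no such splitting; here n ≥ 10.
--
-- No irreducible polynomial is exhibited. Identifying polynomials by their effect on one sequence,
-- or after multiplication by one w, changes only the equality and keeps the carrier, so neither
-- quotients nor division with remainder occur, and equality stays decidable by finitely many
-- comparisons.

-- A ring solver whose coefficients are formal differences (m , n) standing for m − n;
-- unlike coefficients in the ring itself they compute, so that x − x cancels.
module RingSolver {c ℓ} (R : CommutativeRing c ℓ) where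
  open CommutativeRing R
  open import Algebra.Properties.Semiring.Mult semiring using (×-homo-+; ×1-homo-*; ×-congˡ) renaming (_×_ to _×ᴿ_)
  open import Algebra.Properties.Ring ring using (-‿distribˡ-*; -‿distribʳ-*; -‿involutive; -0#≈0#; -‿+-comm)
  open import Algebra.Solver.Ring.AlmostCommutativeRing using (fromCommutativeRing; _-Raw-AlmostCommutative⟶_)
  open import Algebra.Properties.CommutativeSemigroup +-commutativeSemigroup using (interchange)
  open import Relation.Binary.Reasoning.Setoid setoid

  private
    reduce : ℕ × ℕ → ℕ × ℕ
    reduce (a , b) = a ℕ.∸ b , b ℕ.∸ a

    Coefficient : RawRing _ _
    Coefficient = record
      { Carrier = ℕ × ℕ
      ; _≈_ = _≡_
      ; _+_ = λ { (a , b) (c , d) → reduce (a ℕ.+ c , b ℕ.+ d) }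
      ; _*_ = λ { (a , b) (c , d) → reduce (a ℕ.* c ℕ.+ b ℕ.* d , a ℕ.* d ℕ.+ b ℕ.* c) }
      ; -_ = λ { (a , b) → b , a }
      ; 0# = 0 , 0
      ; 1# = 1 , 0
      }

    ι : ℕ → Carrier
    ι n = n ×ᴿ 1#

    value : ℕ × ℕ → Carrier
    value (a , b) = ι a - ι b

    -‿interchange : ∀ a b c d → (a + c) - (b + d) ≈ (a - b) + (c - d)
    -‿interchange a b c d = trans (+-congˡ (sym (-‿+-comm b d))) (interchange a c (- b) (- d))

    ι-homo : ∀ a b c d → ι (a ℕ.* c ℕ.+ b ℕ.* d) ≈ ι a * ι c + ι b * ι d
    ι-homo a b c d = trans (×-homo-+ 1# (a ℕ.* c) (b ℕ.* d)) (+-cong (×1-homo-* a c) (×1-homo-* b d))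

    *-expand : ∀ a b c d → (a * c + b * d) - (a * d + b * c) ≈ (a - b) * (c - d)
    *-expand a b c d = begin
      (a * c + b * d) - (a * d + b * c)             ≈⟨ +-congˡ (-‿cong (+-comm _ _)) ⟩
      (a * c + b * d) - (b * c + a * d)             ≈⟨ -‿interchange _ _ _ _ ⟩
      (a * c - b * c) + (b * d - a * d)             ≈⟨ +-cong (+-congˡ (-‿distribˡ-* b c)) (+-cong (trans (sym (-‿involutive _)) (trans (-‿cong (-‿distribˡ-* b d)) (-‿distribʳ-* (- b) d))) (-‿distribʳ-* a d)) ⟩
      (a * c + - b * c) + (- b * - d + a * - d)     ≈⟨ +-cong (sym (distribʳ c a (- b))) (trans (+-comm _ _) (sym (distribʳ (- d) a (- b)))) ⟩
      (a - b) * c + (a - b) * - d                   ≈⟨ distribˡ _ _ _ ⟨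
      (a - b) * (c - d)                             ∎

    value-cong : ∀ a b c d → a ℕ.+ d ≡ c ℕ.+ b → value (a , b) ≈ value (c , d)
    value-cong a b c d e = begin
      ι a - ι b                     ≈⟨ +-identityʳ _ ⟨
      ι a - ι b + 0#                ≈⟨ +-congˡ (-‿inverseʳ (ι d)) ⟨
      ι a - ι b + (ι d - ι d)       ≈⟨ -‿interchange _ _ _ _ ⟨
      (ι a + ι d) - (ι b + ι d)     ≈⟨ +-congʳ (trans (sym (×-homo-+ 1# a d)) (trans (×-congˡ e) (×-homo-+ 1# c b))) ⟩
      (ι c + ι b) - (ι b + ι d)     ≈⟨ +-congˡ (-‿cong (+-comm _ _)) ⟩
      (ι c + ι b) - (ι d + ι b)     ≈⟨ -‿interchange _ _ _ _ ⟩
      ι c - ι d + (ι b - ι b)       ≈⟨ +-congˡ (-‿inverseʳ (ι b)) ⟩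
      ι c - ι d + 0#                ≈⟨ +-identityʳ _ ⟩
      ι c - ι d                     ∎

    value-reduce : ∀ x → value (reduce x) ≈ value x
    value-reduce (a , b) with ℕₚ.≤-total a b
    ... | inj₁ a≤b = value-cong (a ℕ.∸ b) (b ℕ.∸ a) a b (≡.trans (≡.cong (ℕ._+ b) (ℕₚ.m≤n⇒m∸n≡0 a≤b)) (≡.sym (ℕₚ.m+[n∸m]≡n a≤b)))
    ... | inj₂ b≤a = value-cong (a ℕ.∸ b) (b ℕ.∸ a) a b (≡.trans (ℕₚ.m∸n+n≡m b≤a) (≡.sym (≡.trans (≡.cong (a ℕ.+_) (ℕₚ.m≤n⇒m∸n≡0 b≤a)) (ℕₚ.+-identityʳ a))))

    morphism : Coefficient -Raw-AlmostCommutative⟶ fromCommutativeRing R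
    morphism = record
      { ⟦_⟧ = value
      ; +-homo = λ { (a , b) (c , d) → trans (value-reduce (a ℕ.+ c , b ℕ.+ d)) (trans (+-cong (×-homo-+ 1# a c) (-‿cong (×-homo-+ 1# b d))) (-‿interchange _ _ _ _)) }
      ; *-homo = λ { (a , b) (c , d) → trans (value-reduce (a ℕ.* c ℕ.+ b ℕ.* d , a ℕ.* d ℕ.+ b ℕ.* c)) (trans (+-cong (ι-homo a b c d) (-‿cong (ι-homo a b d c))) (*-expand _ _ _ _)) }
      ; -‿homo = λ { (a , b) → trans (+-comm _ _) (trans (+-congˡ (sym (-‿involutive _))) (-‿+-comm _ _)) }
      ; 0-homo = -‿inverseʳ _
      ; 1-homo = trans (+-cong (+-identityʳ _) -0#≈0#) (+-identityʳ _)
      }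

    _≟ᶜ_ : ∀ x y → Maybe (value x ≈ value y)
    (a , b) ≟ᶜ (c , d) with a ℕ.+ d ℕ.≟ c ℕ.+ b
    ... | yes e = just (value-cong a b c d e)
    ... | no  _ = nothing

  open import Algebra.Solver.Ring Coefficient (fromCommutativeRing R) morphism _≟ᶜ_ public
    using (solve; _:=_; _:+_; _:*_; _:-_; :-_)

-- Indicator functions and finite sums of natural numbers.

𝟙 : ∀ {a} {P : Set a} → Dec P → ℕ
𝟙 (yes _) = 1
𝟙 (no  _) = 0

𝟙-true : ∀ {a} {P : Set a} → (d : Dec P) → P → 𝟙 d ≡ 1
𝟙-true (yes _) _  = ≡.refl
𝟙-true (no ¬p) p  = ⊥-elim (¬p p)

𝟙-false : ∀ {a} {P : Set a} → (d : Dec P) → ¬ P → 𝟙 d ≡ 0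
𝟙-false (yes p) ¬p = ⊥-elim (¬p p)
𝟙-false (no _)  _  = ≡.refl

𝟙-cong : ∀ {a b} {A : Set a} {B : Set b} (d : Dec A) (d′ : Dec B) → (A → B) → (B → A) → 𝟙 d ≡ 𝟙 d′
𝟙-cong (yes a) d′ f g = ≡.sym (𝟙-true d′ (f a))
𝟙-cong (no ¬a) d′ f g = ≡.sym (𝟙-false d′ (¬a ∘ g))

𝟙-idem : ∀ {a} {P : Set a} → (d : Dec P) → 𝟙 d ℕ.* 𝟙 d ≡ 𝟙 d
𝟙-idem (yes _) = ≡.refl
𝟙-idem (no _)  = ≡.refl

𝟙≤1 : ∀ {a} {P : Set a} → (d : Dec P) → 𝟙 d ≤ 1
𝟙≤1 (yes _) = s≤s z≤n
𝟙≤1 (no _)  = z≤n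

sum-const : ∀ n x → sum {n} (λ _ → x) ≡ n ℕ.* x
sum-const zero    x = ≡.refl
sum-const (suc n) x = ≡.cong (x ℕ.+_) (sum-const n x)

sum-mono : ∀ {n} {f g : Fin n → ℕ} → (∀ i → f i ≤ g i) → sum f ≤ sum g
sum-mono {zero}  f≤g = z≤n
sum-mono {suc n} f≤g = ℕₚ.+-mono-≤ (f≤g zero) (sum-mono (f≤g ∘ suc))

sum-δ : ∀ {n} (j : Fin n) (f : Fin n → ℕ) → sum (λ i → 𝟙 (j Fin.≟ i) ℕ.* f i) ≡ f j
sum-δ {suc n} zero f = begin
  f zero ℕ.+ 0 ℕ.+ sum {n} (λ i → 0) ≡⟨ ≡.cong (f zero ℕ.+ 0 ℕ.+_) (≡.trans (sum-const n 0) (ℕₚ.*-zeroʳ n)) ⟩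
  f zero ℕ.+ 0 ℕ.+ 0                   ≡⟨ ≡.trans (ℕₚ.+-identityʳ _) (ℕₚ.+-identityʳ _) ⟩
  f zero                               ∎
  where open ≡.≡-Reasoning
sum-δ {suc n} (suc j) f = ≡.trans (sum-cong-≗ (λ i → ≡.cong (ℕ._* f (suc i)) (𝟙-cong (suc j Fin.≟ suc i) (j Fin.≟ i) Finₚ.suc-injective (≡.cong suc)))) (sum-δ j (f ∘ suc))

-- If the larger number exceeds the smaller one by r, the slack is r²; expanding (a - b)² is not an
-- option with truncated subtraction.
2ab≤a²+b² : ∀ a b → 2 ℕ.* (a ℕ.* b) ≤ a ℕ.* a ℕ.+ b ℕ.* b
2ab≤a²+b² a b with ℕₚ.≤-total a b
... | inj₁ a≤b rewrite ≡.sym (ℕₚ.m+[n∸m]≡n a≤b) = ℕₚ.≤-trans (ℕₚ.m≤m+n _ _) (ℕₚ.≤-reflexive (lem a (b ℕ.∸ a)))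
  where
  lem : ∀ a d → 2 ℕ.* (a ℕ.* (a ℕ.+ d)) ℕ.+ d ℕ.* d ≡ a ℕ.* a ℕ.+ (a ℕ.+ d) ℕ.* (a ℕ.+ d)
  lem = solve-∀
... | inj₂ b≤a rewrite ≡.sym (ℕₚ.m+[n∸m]≡n b≤a) = ℕₚ.≤-trans (ℕₚ.m≤m+n _ _) (ℕₚ.≤-reflexive (lem b (a ℕ.∸ b)))
  where
  lem : ∀ b d → 2 ℕ.* ((b ℕ.+ d) ℕ.* b) ℕ.+ d ℕ.* d ≡ (b ℕ.+ d) ℕ.* (b ℕ.+ d) ℕ.+ b ℕ.* b
  lem = solve-∀

-- Counting over a finite field; incidences of points and lines.

module FiniteField {c ℓ} (K : Field c ℓ) {Q : ℕ} (enum : Inverse (≡.setoid (Fin Q)) (Field.setoid K)) where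
  open Field K hiding (zero) renaming (_*_ to _·_)
  open Data.Nat using (_*_)
  open RingSolver commutativeRing

  elt : Fin Q → Carrier
  elt = Inverse.to enum

  idx : Carrier → Fin Q
  idx = Inverse.from enum

  idx-cong : ∀ {x y} → x ≈ y → idx x ≡ idx y
  idx-cong = Inverse.from-cong enum

  elt-idx : ∀ x → elt (idx x) ≈ x
  elt-idx x = Inverse.strictlyInverseˡ enum x

  idx-elt : ∀ i → idx (elt i) ≡ i
  idx-elt i = Inverse.strictlyInverseʳ enum i

  idx-injective : ∀ {x y} → idx x ≡ idx y → x ≈ y
  idx-injective {x} {y} e = trans (sym (elt-idx x)) (trans (reflexive (≡.cong elt e)) (elt-idx y))

  infix 4 _≟_
  _≟_ : ∀ x y → Dec (x ≈ y)
  x ≟ y = map′ idx-injective idx-cong (idx x Fin.≟ idx y)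

  some? : ∀ {a} {P : Carrier → Set a} → (∀ {x y} → x ≈ y → P x → P y) → (∀ x → Dec (P x)) → Dec (∃ P)
  some? resp P? = map′ (λ (i , h) → elt i , h) (λ (x , h) → idx x , resp (sym (elt-idx x)) h) (Finₚ.any? (P? ∘ elt))

  Congruent : (Carrier → ℕ) → Set _
  Congruent f = ∀ {x y} → x ≈ y → f x ≡ f y

  abstract
    ∑ : (Carrier → ℕ) → ℕ
    ∑ f = sum (f ∘ elt)

    ∑-cong : ∀ {f g} → (∀ x → f x ≡ g x) → ∑ f ≡ ∑ g
    ∑-cong h = sum-cong-≗ (h ∘ elt)

    ∑-mono : ∀ {f g} → (∀ x → f x ≤ g x) → ∑ f ≤ ∑ g
    ∑-mono h = sum-mono (h ∘ elt)

    ∑-+ : ∀ f g → ∑ (λ x → f x ℕ.+ g x) ≡ ∑ f ℕ.+ ∑ g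
    ∑-+ f g = ∑-distrib-+ (f ∘ elt) (g ∘ elt)

    ∑-swap : ∀ (f : Carrier → Carrier → ℕ) → ∑ (λ x → ∑ (f x)) ≡ ∑ (λ y → ∑ (λ x → f x y))
    ∑-swap f = ∑-comm (λ i j → f (elt i) (elt j))

    ∑-*ˡ : ∀ a f → ∑ (λ x → a ℕ.* f x) ≡ a ℕ.* ∑ f
    ∑-*ˡ a f = ≡.sym (*-distribˡ-sum a (f ∘ elt))

    ∑-*ʳ : ∀ a f → ∑ (λ x → f x ℕ.* a) ≡ ∑ f ℕ.* a
    ∑-*ʳ a f = ≡.sym (*-distribʳ-sum a (f ∘ elt))

    ∑-const : ∀ a → ∑ (λ _ → a) ≡ Q ℕ.* a
    ∑-const = sum-const Q

    ∑-δ : ∀ x {f} → Congruent f → ∑ (λ y → 𝟙 (x ≟ y) ℕ.* f y) ≡ f x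
    ∑-δ x {f} f-cong = ≡.trans (sum-cong-≗ (λ i → ≡.cong (ℕ._* f (elt i)) (𝟙-cong (x ≟ elt i) (idx x Fin.≟ i) (λ e → ≡.trans (idx-cong e) (idx-elt i)) (λ e → trans (sym (elt-idx x)) (reflexive (≡.cong elt e)))))) (≡.trans (sum-δ (idx x) (f ∘ elt)) (f-cong (elt-idx x)))

    ∑-< : ∀ {f g} → ∑ f < ∑ g → ∃ λ x → f x < g x
    ∑-< {f} {g} ∑f<∑g with Finₚ.any? (λ i → f (elt i) ℕ.<? g (elt i))
    ... | yes (i , h) = elt i , h
    ... | no ∄ = ⊥-elim (ℕₚ.<⇒≱ ∑f<∑g (sum-mono (λ i → ℕₚ.≮⇒≥ (λ h → ∄ (i , h)))))

  ∑-zero : ∑ (λ _ → 0) ≡ 0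
  ∑-zero = ≡.trans (∑-const 0) (ℕₚ.*-zeroʳ Q)

  ∑-positive : ∀ {f} → 0 < ∑ f → ∃ λ x → 0 < f x
  ∑-positive {f} h = ∑-< (≡.subst (_< ∑ f) (≡.sym ∑-zero) h)

  module _ {f : Carrier → ℕ} (f-cong : Congruent f)
           (g g⁻¹ : Carrier → Carrier) (g-cong : ∀ {x y} → x ≈ y → g x ≈ g y) (g⁻¹-cong : ∀ {x y} → x ≈ y → g⁻¹ x ≈ g⁻¹ y)
           (g-g⁻¹ : ∀ x → g (g⁻¹ x) ≈ x) (g⁻¹-g : ∀ x → g⁻¹ (g x) ≈ x) where

    permuteBy : Permutation Q Q
    permuteBy = permutation (idx ∘ g ∘ elt) (idx ∘ g⁻¹ ∘ elt)
      (λ i → ≡.trans (idx-cong (trans (g-cong (elt-idx _)) (g-g⁻¹ _))) (idx-elt i))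
      (λ i → ≡.trans (idx-cong (trans (g⁻¹-cong (elt-idx _)) (g⁻¹-g _))) (idx-elt i))

    abstract
      ∑-reindex : ∑ (f ∘ g) ≡ ∑ f
      ∑-reindex = ≡.sym (≡.trans (sum-permute (f ∘ elt) permuteBy) (sum-cong-≗ (λ i → f-cong (elt-idx (g (elt i))))))

  ∑-translate : ∀ {f} → Congruent f → ∀ t → ∑ (λ y → f (y - t)) ≡ ∑ f
  ∑-translate f-cong t = ∑-reindex f-cong (_- t) (_+ t) +-congʳ +-congʳ
    (λ x → solve 2 (λ x t → (x :+ t) :- t := x) refl x t) (λ x → solve 2 (λ x t → (x :- t) :+ t := x) refl x t)

  ∑-affine : ∀ {f} → Congruent f → ∀ y d → ¬ (d ≈ 0#) → ∑ (λ x → f (y + x · d)) ≡ ∑ f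
  ∑-affine f-cong y d d≉0 with inverse d d≉0
  ... | d⁻¹ , dd⁻¹≈1 = ∑-reindex f-cong (λ x → y + x · d) (λ z → (z - y) · d⁻¹)
    (λ e → +-congˡ (*-congʳ e)) (λ e → *-congʳ (+-congʳ e))
    (λ z → trans (+-congˡ (trans (*-assoc _ _ _) (trans (*-congˡ (trans (*-comm _ _) dd⁻¹≈1)) (*-identityʳ _)))) (solve 2 (λ y z → y :+ (z :- y) := z) refl y z))
    (λ x → trans (*-congʳ (solve 2 (λ y z → (y :+ z) :- y := z) refl y (x · d))) (trans (*-assoc _ _ _) (trans (*-congˡ dd⁻¹≈1) (*-identityʳ _))))

  -- The solutions of y = a + x b with a and b in given sets, counted by indicator functions:
  -- incidences of the point (x , y) with the lines of slope b and intercept a.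
  module Incidence {α β : Carrier → ℕ} (α-cong : Congruent α) (β-cong : Congruent β)
                   (α-idem : ∀ x → α x ℕ.* α x ≡ α x) (β-idem : ∀ x → β x ℕ.* β x ≡ β x) where

    #α #β : ℕ
    #α = ∑ α
    #β = ∑ β

    incidences : Carrier → Carrier → ℕ
    incidences x y = ∑ (λ b → β b * α (y - x · b))

    incidences-cong : ∀ {x x′ y y′} → x ≈ x′ → y ≈ y′ → incidences x y ≡ incidences x′ y′
    incidences-cong ex ey = ∑-cong (λ b → ≡.cong (β b *_) (α-cong (+-cong ey (-‿cong (*-congʳ ex)))))

    ∑-incidences : ∀ x → ∑ (incidences x) ≡ #α * #β
    ∑-incidences x = begin
      ∑ (λ y → ∑ (λ b → β b * α (y - x · b)))   ≡⟨ ∑-swap _ ⟩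
      ∑ (λ b → ∑ (λ y → β b * α (y - x · b)))   ≡⟨ ∑-cong (λ b → ≡.trans (∑-*ˡ (β b) _) (≡.cong (β b *_) (∑-translate α-cong (x · b)))) ⟩
      ∑ (λ b → β b * #α)                        ≡⟨ ∑-*ʳ #α β ⟩
      #β * #α                                   ≡⟨ ℕₚ.*-comm #β #α ⟩
      #α * #β                                   ∎
      where open ≡.≡-Reasoning

    pairIncidences : Carrier → Carrier → ℕ
    pairIncidences b b′ = ∑ (λ x → ∑ (λ y → α (y - x · b) * α (y - x · b′)))

    -- Two lines of equal slope share a point only if they coincide, which leaves #α lines of Q
    -- points each.
    parallel : ∀ {b b′} → b ≈ b′ → pairIncidences b b′ ≡ Q * #α
    parallel {b} {b′} b≈b′ = begin
      ∑ (λ x → ∑ (λ y → α (y - x · b) * α (y - x · b′))) ≡⟨ ∑-cong (λ x → ∑-cong (λ y → ≡.trans (≡.cong (α (y - x · b) *_) (α-cong (+-congˡ (-‿cong (*-congˡ (sym b≈b′)))))) (α-idem _))) ⟩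
      ∑ (λ x → ∑ (λ y → α (y - x · b)))                   ≡⟨ ∑-cong (λ x → ∑-translate α-cong (x · b)) ⟩
      ∑ (λ x → #α)                                        ≡⟨ ∑-const #α ⟩
      Q * #α                                              ∎
      where open ≡.≡-Reasoning

    -- Lines of different slopes meet exactly once, so every pair of intercepts counts once. With
    -- the first intercept as new variable y, the second becomes y + x (b - b′), a bijective
    -- function of x.
    transversal : ∀ {b b′} → ¬ (b ≈ b′) → pairIncidences b b′ ≡ #α * #α
    transversal {b} {b′} b≉b′ = begin
      ∑ (λ x → ∑ (λ y → α (y - x · b) * α (y - x · b′)))
        ≡⟨ ∑-cong (λ x → ∑-cong (λ y → ≡.cong (α (y - x · b) *_) (α-cong (solve 4 (λ x y b b′ → y :- x :* b′ := (y :- x :* b) :+ x :* (b :- b′)) refl x y b b′)))) ⟩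
      ∑ (λ x → ∑ (λ y → α (y - x · b) * α ((y - x · b) + x · (b - b′))))
        ≡⟨ ∑-cong (λ x → ∑-translate {λ y → α y * α (y + x · (b - b′))} (λ e → ≡.cong₂ _*_ (α-cong e) (α-cong (+-congʳ e))) (x · b)) ⟩
      ∑ (λ x → ∑ (λ y → α y * α (y + x · (b - b′))))       ≡⟨ ∑-swap _ ⟩
      ∑ (λ y → ∑ (λ x → α y * α (y + x · (b - b′))))       ≡⟨ ∑-cong (λ y → ≡.trans (∑-*ˡ (α y) _) (≡.cong (α y *_) (∑-affine α-cong y (b - b′) (λ e → b≉b′ (b-b′≈0⇒b≈b′ e))))) ⟩
      ∑ (λ y → α y * #α)                                   ≡⟨ ∑-*ʳ #α α ⟩
      #α * #α                                              ∎
      where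
      open ≡.≡-Reasoning
      b-b′≈0⇒b≈b′ : b - b′ ≈ 0# → b ≈ b′
      b-b′≈0⇒b≈b′ e = trans (solve 2 (λ b b′ → b := (b :- b′) :+ b′) refl b b′) (trans (+-congʳ e) (+-identityˡ b′))

    pairIncidences≤ : ∀ b b′ → pairIncidences b b′ ≤ #α * #α ℕ.+ 𝟙 (b ≟ b′) * (Q * #α)
    pairIncidences≤ b b′ with b ≟ b′
    ... | yes e = ℕₚ.≤-trans (ℕₚ.≤-reflexive (≡.trans (parallel e) (≡.sym (ℕₚ.*-identityˡ _)))) (ℕₚ.m≤n+m _ (#α * #α))
    ... | no ne = ℕₚ.≤-reflexive (≡.trans (transversal ne) (≡.sym (ℕₚ.+-identityʳ _)))

    ∑-swap₃ : ∀ (f : Carrier → Carrier → Carrier → ℕ) → ∑ (λ x → ∑ (λ y → ∑ (f x y))) ≡ ∑ (λ z → ∑ (λ x → ∑ (λ y → f x y z)))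
    ∑-swap₃ f = ≡.trans (∑-cong (λ x → ∑-swap (f x))) (∑-swap (λ x z → ∑ (λ y → f x y z)))

    incidences² : ∀ x y → incidences x y * incidences x y ≡ ∑ (λ b → ∑ (λ b′ → β b * β b′ * (α (y - x · b) * α (y - x · b′))))
    incidences² x y = begin
      incidences x y * incidences x y                                        ≡⟨ ∑-*ʳ (incidences x y) _ ⟨
      ∑ (λ b → β b * α (y - x · b) * incidences x y)                         ≡⟨ ∑-cong (λ b → ≡.sym (∑-*ˡ (β b * α (y - x · b)) _)) ⟩
      ∑ (λ b → ∑ (λ b′ → β b * α (y - x · b) * (β b′ * α (y - x · b′))))     ≡⟨ ∑-cong (λ b → ∑-cong (λ b′ → lem (β b) (α (y - x · b)) (β b′) (α (y - x · b′)))) ⟩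
      ∑ (λ b → ∑ (λ b′ → β b * β b′ * (α (y - x · b) * α (y - x · b′))))     ∎
      where
      open ≡.≡-Reasoning
      lem : ∀ p q r s → p * q * (r * s) ≡ p * r * (q * s)
      lem = solve-∀

    -- The square counts pairs of lines through a point. Bounding every pair of slopes by (#α)², and
    -- adding Q #α on the diagonal, avoids splitting the double sum.
    secondMoment : ∑ (λ x → ∑ (λ y → incidences x y * incidences x y)) ≤ Q * (#α * #β) ℕ.+ (#α * #β) * (#α * #β)
    secondMoment = begin
      ∑ (λ x → ∑ (λ y → incidences x y * incidences x y))
        ≡⟨ ∑-cong (λ x → ∑-cong (incidences² x)) ⟩
      ∑ (λ x → ∑ (λ y → ∑ (λ b → ∑ (λ b′ → t x y b b′))))
        ≡⟨ ≡.trans (∑-swap₃ (λ x y b → ∑ (t x y b))) (∑-cong (λ b → ∑-swap₃ (λ x y → t x y b))) ⟩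
      ∑ (λ b → ∑ (λ b′ → ∑ (λ x → ∑ (λ y → t x y b b′))))
        ≡⟨ ∑-cong (λ b → ∑-cong (λ b′ → ≡.trans (∑-cong (λ x → ∑-*ˡ (β b * β b′) _)) (∑-*ˡ (β b * β b′) _))) ⟩
      ∑ (λ b → ∑ (λ b′ → β b * β b′ * pairIncidences b b′))
        ≤⟨ ∑-mono (λ b → ∑-mono (λ b′ → ℕₚ.*-monoʳ-≤ (β b * β b′) (pairIncidences≤ b b′))) ⟩
      ∑ (λ b → ∑ (λ b′ → β b * β b′ * (#α * #α ℕ.+ 𝟙 (b ≟ b′) * (Q * #α))))
        ≡⟨ ∑-cong (λ b → row b) ⟩
      ∑ (λ b → β b * (#β * (#α * #α)) ℕ.+ β b * (Q * #α))
        ≡⟨ ∑-+ _ _ ⟩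
      ∑ (λ b → β b * (#β * (#α * #α))) ℕ.+ ∑ (λ b → β b * (Q * #α))
        ≡⟨ ≡.cong₂ ℕ._+_ (∑-*ʳ _ β) (∑-*ʳ _ β) ⟩
      #β * (#β * (#α * #α)) ℕ.+ #β * (Q * #α)
        ≡⟨ lem₂ Q #α #β ⟩
      Q * (#α * #β) ℕ.+ (#α * #β) * (#α * #β) ∎
      where
      open ℕₚ.≤-Reasoning
      t : Carrier → Carrier → Carrier → Carrier → ℕ
      t x y b b′ = β b * β b′ * (α (y - x · b) * α (y - x · b′))
      lem₁ : ∀ p q a δ → p * q * (a ℕ.+ δ) ≡ p * (q * a) ℕ.+ p * (q * δ)
      lem₁ = solve-∀
      lem₂ : ∀ q a b → b * (b * (a * a)) ℕ.+ b * (q * a) ≡ q * (a * b) ℕ.+ (a * b) * (a * b)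
      lem₂ = solve-∀
      lem₃ : ∀ p q a → p * (q * a) ≡ q * (p * a)
      lem₃ = solve-∀
      row : ∀ b → ∑ (λ b′ → β b * β b′ * (#α * #α ℕ.+ 𝟙 (b ≟ b′) * (Q * #α))) ≡ β b * (#β * (#α * #α)) ℕ.+ β b * (Q * #α)
      row b = let module E = ≡.≡-Reasoning in E.begin
        ∑ (λ b′ → β b * β b′ * (#α * #α ℕ.+ 𝟙 (b ≟ b′) * (Q * #α)))
          E.≡⟨ ∑-cong (λ b′ → lem₁ (β b) (β b′) (#α * #α) (𝟙 (b ≟ b′) * (Q * #α))) ⟩
        ∑ (λ b′ → β b * (β b′ * (#α * #α)) ℕ.+ β b * (β b′ * (𝟙 (b ≟ b′) * (Q * #α))))
          E.≡⟨ ∑-+ _ _ ⟩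
        ∑ (λ b′ → β b * (β b′ * (#α * #α))) ℕ.+ ∑ (λ b′ → β b * (β b′ * (𝟙 (b ≟ b′) * (Q * #α))))
          E.≡⟨ ≡.cong₂ ℕ._+_ (≡.trans (∑-*ˡ (β b) _) (≡.cong (β b *_) (∑-*ʳ _ β))) (≡.trans (∑-*ˡ (β b) _) (≡.cong (β b *_) (≡.trans (∑-cong (λ b′ → lem₃ (β b′) (𝟙 (b ≟ b′)) (Q * #α))) (∑-δ b (λ e → ≡.cong (_* (Q * #α)) (β-cong e)))))) ⟩
        β b * (#β * (#α * #α)) ℕ.+ β b * (β b * (Q * #α))
          E.≡⟨ ≡.cong (β b * (#β * (#α * #α)) ℕ.+_) (≡.trans (≡.sym (ℕₚ.*-assoc (β b) (β b) _)) (≡.cong (_* (Q * #α)) (β-idem b))) ⟩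
        β b * (#β * (#α * #α)) ℕ.+ β b * (Q * #α) E.∎

    ∑∑-+ : ∀ (f g : Carrier → Carrier → ℕ) → ∑ (λ x → ∑ (λ y → f x y ℕ.+ g x y)) ≡ ∑ (λ x → ∑ (f x)) ℕ.+ ∑ (λ x → ∑ (g x))
    ∑∑-+ f g = ≡.trans (∑-cong (λ x → ∑-+ (f x) (g x))) (∑-+ _ _)

    ∑∑-* : ∀ a (f : Carrier → Carrier → ℕ) → ∑ (λ x → ∑ (λ y → a * f x y)) ≡ a * ∑ (λ x → ∑ (f x))
    ∑∑-* a f = ≡.trans (∑-cong (λ x → ∑-*ˡ a (f x))) (∑-*ˡ a _)

    -- Chebyshev: a set of points on none of the lines is small, as the mean number of
    -- incidences #α #β / Q exceeds by far their standard deviation.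
    module _ {π : Carrier → Carrier → ℕ} (π-bit : ∀ x y → π x y ≡ 0 ⊎ π x y ≡ 1) where
      private
        P #π : ℕ
        P = #α * #β
        #π = ∑ (λ x → ∑ (π x))

        hits : ℕ
        hits = ∑ (λ x → ∑ (λ y → π x y * incidences x y))

        -- Rearranged, this is p² b ≤ (q i - p)² + 2 q p b i, free of subtraction. Here q i - p is
        -- the scaled deviation from the mean p / q, and a point of the set (b = 1) on no line
        -- deviates by the full p.
        deviation : ∀ q p i b → b ≡ 0 ⊎ b ≡ 1 →
          2 * (q * p) * i ℕ.+ p * p * b ≤ q * q * (i * i) ℕ.+ p * p ℕ.+ 2 * (q * p) * (b * i)
        deviation q p i b (inj₁ ≡.refl) = begin
          2 * (q * p) * i ℕ.+ p * p * 0                ≡⟨ lem₁ q p i ⟩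
          2 * ((q * i) * p)                            ≤⟨ 2ab≤a²+b² (q * i) p ⟩
          (q * i) * (q * i) ℕ.+ p * p                  ≡⟨ lem₂ q p i ⟩
          q * q * (i * i) ℕ.+ p * p ℕ.+ 2 * (q * p) * 0 ∎
          where
          open ℕₚ.≤-Reasoning
          lem₁ : ∀ q p i → 2 * (q * p) * i ℕ.+ p * p * 0 ≡ 2 * ((q * i) * p)
          lem₁ = solve-∀
          lem₂ : ∀ q p i → (q * i) * (q * i) ℕ.+ p * p ≡ q * q * (i * i) ℕ.+ p * p ℕ.+ 2 * (q * p) * 0
          lem₂ = solve-∀
        deviation q p i b (inj₂ ≡.refl) = ℕₚ.≤-trans (ℕₚ.m≤n+m _ (q * q * (i * i))) (ℕₚ.≤-reflexive (lem q p i))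
          where
          lem : ∀ q p i → q * q * (i * i) ℕ.+ (2 * (q * p) * i ℕ.+ p * p * 1) ≡ q * q * (i * i) ℕ.+ p * p ℕ.+ 2 * (q * p) * (1 * i)
          lem = solve-∀

        totals : 2 * (Q * P) * (Q * P) ℕ.+ P * P * #π ≤ Q * Q * (Q * P ℕ.+ P * P) ℕ.+ Q * (Q * (P * P)) ℕ.+ 2 * (Q * P) * hits
        totals = begin
          2 * (Q * P) * (Q * P) ℕ.+ P * P * #π
            ≡⟨ ≡.cong (ℕ._+ P * P * #π) (≡.cong (2 * (Q * P) *_) (≡.trans (≡.sym (∑-const P)) (∑-cong (λ x → ≡.sym (∑-incidences x))))) ⟩
          2 * (Q * P) * ∑ (λ x → ∑ (incidences x)) ℕ.+ P * P * #π
            ≡⟨ ≡.cong₂ ℕ._+_ (∑∑-* (2 * (Q * P)) incidences) (∑∑-* (P * P) π) ⟨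
          ∑ (λ x → ∑ (λ y → 2 * (Q * P) * incidences x y)) ℕ.+ ∑ (λ x → ∑ (λ y → P * P * π x y))
            ≡⟨ ∑∑-+ _ _ ⟨
          ∑ (λ x → ∑ (λ y → 2 * (Q * P) * incidences x y ℕ.+ P * P * π x y))
            ≤⟨ ∑-mono (λ x → ∑-mono (λ y → deviation Q P (incidences x y) (π x y) (π-bit x y))) ⟩
          ∑ (λ x → ∑ (λ y → Q * Q * (incidences x y * incidences x y) ℕ.+ P * P ℕ.+ 2 * (Q * P) * (π x y * incidences x y)))
            ≡⟨ ≡.trans (∑∑-+ (λ x y → Q * Q * (incidences x y * incidences x y) ℕ.+ P * P) (λ x y → 2 * (Q * P) * (π x y * incidences x y))) (≡.cong₂ ℕ._+_ (∑∑-+ (λ x y → Q * Q * (incidences x y * incidences x y)) (λ x y → P * P)) (∑∑-* (2 * (Q * P)) (λ x y → π x y * incidences x y))) ⟩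
          ∑ (λ x → ∑ (λ y → Q * Q * (incidences x y * incidences x y))) ℕ.+ ∑ (λ x → ∑ (λ y → P * P)) ℕ.+ 2 * (Q * P) * hits
            ≡⟨ ≡.cong (ℕ._+ 2 * (Q * P) * hits) (≡.cong₂ ℕ._+_ (∑∑-* (Q * Q) (λ x y → incidences x y * incidences x y)) (≡.trans (∑-cong (λ x → ∑-const (P * P))) (∑-const (Q * (P * P))))) ⟩
          Q * Q * ∑ (λ x → ∑ (λ y → incidences x y * incidences x y)) ℕ.+ Q * (Q * (P * P)) ℕ.+ 2 * (Q * P) * hits
            ≤⟨ ℕₚ.+-monoˡ-≤ _ (ℕₚ.+-monoˡ-≤ _ (ℕₚ.*-monoʳ-≤ (Q * Q) secondMoment)) ⟩
          Q * Q * (Q * P ℕ.+ P * P) ℕ.+ Q * (Q * (P * P)) ℕ.+ 2 * (Q * P) * hits ∎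
          where open ℕₚ.≤-Reasoning

        -- The mean contributes 2 Q² P² to both sides of `totals`; after cancellation only the
        -- variance Q³ P and the term with `hits` survive.
        rearranged : P * (P * #π) ≤ P * (Q * (Q * Q) ℕ.+ 2 * Q * hits)
        rearranged = ℕₚ.+-cancelˡ-≤ (2 * (Q * P) * (Q * P)) _ _ (ℕₚ.≤-trans (ℕₚ.≤-reflexive (≡.cong (2 * (Q * P) * (Q * P) ℕ.+_) (≡.sym (ℕₚ.*-assoc P P #π)))) (ℕₚ.≤-trans totals (ℕₚ.≤-reflexive (lem Q P hits))))
          where
          lem : ∀ q p z → q * q * (q * p ℕ.+ p * p) ℕ.+ q * (q * (p * p)) ℕ.+ 2 * (q * p) * z ≡ 2 * (q * p) * (q * p) ℕ.+ p * (q * (q * q) ℕ.+ 2 * q * z)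
          lem = solve-∀

      -- If no point of the set lay on a line, `hits` would vanish and `rearranged` would leave P #π
      -- ≤ Q³.
      incidence-exists : Q * (Q * Q) < #α * #β * ∑ (λ x → ∑ (π x)) → ∃₂ λ x y → 0 < π x y * incidences x y
      incidence-exists Q³<P#π = let x , 0<∑ = ∑-positive hits-positive
                                    y , 0<term = ∑-positive 0<∑
                                in x , y , 0<term
        where
        lem : ∀ q → q * (q * q) ℕ.+ 2 * q * 0 ≡ q * (q * q)
        lem = solve-∀
        P≢0 : ℕ.NonZero P
        P≢0 = ℕ.≢-nonZero (λ e → ℕₚ.<⇒≱ Q³<P#π (ℕₚ.≤-trans (ℕₚ.≤-reflexive (≡.cong (_* #π) e)) z≤n))
        hits-positive : 0 < hits
        hits-positive = ℕₚ.n≢0⇒n>0 (λ hits≡0 → ℕₚ.<⇒≱ Q³<P#π (ℕₚ.*-cancelˡ-≤ P {{P≢0}} (ℕₚ.≤-trans rearranged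
          (ℕₚ.≤-reflexive (≡.cong (P *_) (≡.trans (≡.cong (λ z → Q * (Q * Q) ℕ.+ 2 * Q * z) hits≡0) (lem Q)))))))

-- Field identities, monic polynomials and their roots.

module FieldProperties {c ℓ} (K : Field c ℓ) where
  open Field K hiding (zero)
  open RingSolver commutativeRing
  open import Algebra.Properties.CommutativeSemiring.Exp commutativeSemiring
    using (_^_; ^-congˡ; ^-congʳ; ^-homo-*; ^-assocʳ; ^-distrib-*) public
  open import Algebra.Properties.Semiring.Mult semiring
    using (×-congʳ; ×-congˡ; ×-homo-+; ×1-homo-*; ×-assocˡ) renaming (_×_ to _×ᴷ_) public
  open import Relation.Binary.Reasoning.Setoid setoid

  x-y≈0⇒x≈y : ∀ {x y} → x - y ≈ 0# → x ≈ y
  x-y≈0⇒x≈y {x} {y} e = trans (solve 2 (λ x y → x := (x :- y) :+ y) refl x y) (trans (+-congʳ e) (+-identityˡ y))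

  x≈y⇒x-y≈0 : ∀ {x y} → x ≈ y → x - y ≈ 0#
  x≈y⇒x-y≈0 e = trans (+-congʳ e) (-‿inverseʳ _)

  xy≈0⇒y≈0 : ∀ {x y} → ¬ (x ≈ 0#) → x * y ≈ 0# → y ≈ 0#
  xy≈0⇒y≈0 {x} {y} x≉0 e with inverse x x≉0
  ... | x⁻¹ , xx⁻¹≈1 = begin
    y               ≈⟨ *-identityˡ y ⟨
    1# * y          ≈⟨ *-congʳ xx⁻¹≈1 ⟨
    x * x⁻¹ * y     ≈⟨ solve 3 (λ x z y → x :* z :* y := z :* (x :* y)) refl x x⁻¹ y ⟩
    x⁻¹ * (x * y)   ≈⟨ *-congˡ e ⟩
    x⁻¹ * 0#        ≈⟨ zeroʳ _ ⟩
    0#              ∎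

  cancelˡ : ∀ {x y z} → ¬ (x ≈ 0#) → x * y ≈ x * z → y ≈ z
  cancelˡ {x} {y} {z} x≉0 e = x-y≈0⇒x≈y (xy≈0⇒y≈0 x≉0 (trans (solve 3 (λ x y z → x :* (y :- z) := x :* y :- x :* z) refl x y z) (x≈y⇒x-y≈0 e)))

  cancelʳ : ∀ {x y z} → ¬ (x ≈ 0#) → y * x ≈ z * x → y ≈ z
  cancelʳ x≉0 e = cancelˡ x≉0 (trans (*-comm _ _) (trans e (*-comm _ _)))

  xy≉0 : ∀ {x y} → ¬ (x ≈ 0#) → ¬ (y ≈ 0#) → ¬ (x * y ≈ 0#)
  xy≉0 x≉0 y≉0 e = y≉0 (xy≈0⇒y≈0 x≉0 e)

  x^n≉0 : ∀ {x} n → ¬ (x ≈ 0#) → ¬ (x ^ n ≈ 0#)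
  x^n≉0 zero    x≉0 = 1≉0
  x^n≉0 (suc n) x≉0 = xy≉0 x≉0 (x^n≉0 n x≉0)

  1^n≈1 : ∀ n → 1# ^ n ≈ 1#
  1^n≈1 zero    = refl
  1^n≈1 (suc n) = trans (*-identityˡ _) (1^n≈1 n)

  -- The monic polynomial with the given lower coefficients, constant term first.
  monic : List Carrier → Carrier → Carrier
  monic []       y = 1#
  monic (a ∷ as) y = a + y * monic as y

  monic-cong : ∀ as {x y} → x ≈ y → monic as x ≈ monic as y
  monic-cong []       e = refl
  monic-cong (a ∷ as) e = +-congˡ (*-cong e (monic-cong as e))

  monic-^ : ∀ n y → monic (replicate n 0#) y ≈ y ^ n
  monic-^ zero    y = refl
  monic-^ (suc n) y = trans (+-identityˡ _) (*-congˡ (monic-^ n y))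

  -- Horner's scheme: the coefficients of (f(y) - f(r)) / (y - r) are the values at r of the proper
  -- tails of f. To divide f, it is therefore applied to f without its constant coefficient.
  quotient : Carrier → List Carrier → List Carrier
  quotient r []       = []
  quotient r (a ∷ as) = monic (a ∷ as) r ∷ quotient r as

  length-quotient : ∀ r as → length (quotient r as) ≡ length as
  length-quotient r []       = ≡.refl
  length-quotient r (a ∷ as) = ≡.cong suc (length-quotient r as)

  factor : ∀ r a as y → monic (a ∷ as) y - monic (a ∷ as) r ≈ (y - r) * monic (quotient r as) y
  factor r a [] y = trans (solve 4 (λ a y r o → (a :+ y :* o) :- (a :+ r :* o) := (y :- r) :* o) refl a y r 1#) refl
  factor r a (b ∷ bs) y = begin
    (a + y * m y) - (a + r * m r)         ≈⟨ solve 5 (λ a y r my mr → (a :+ y :* my) :- (a :+ r :* mr) := (y :- r) :* mr :+ y :* (my :- mr)) refl a y r (m y) (m r) ⟩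
    (y - r) * m r + y * (m y - m r)       ≈⟨ +-congˡ (*-congˡ (factor r b bs y)) ⟩
    (y - r) * m r + y * ((y - r) * q)     ≈⟨ solve 4 (λ y r mr q → (y :- r) :* mr :+ y :* ((y :- r) :* q) := (y :- r) :* (mr :+ y :* q)) refl y r (m r) q ⟩
    (y - r) * (m r + y * q)               ∎
    where
    m = monic (b ∷ bs)
    q = monic (quotient r bs) y

  root-of-quotient : ∀ {r y} a as → monic (a ∷ as) r ≈ 0# → monic (a ∷ as) y ≈ 0# → ¬ (y ≈ r) → monic (quotient r as) y ≈ 0#
  root-of-quotient {r} {y} a as er ey y≉r = xy≈0⇒y≈0 (λ e → y≉r (x-y≈0⇒x≈y e))
    (trans (sym (factor r a as y)) (trans (+-cong ey (-‿cong er)) (-‿inverseʳ 0#)))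

  root-bound : ∀ n as → length as ≡ n → (f : Fin (suc n) → Carrier) → (∀ {i j} → f i ≈ f j → i ≡ j) → ¬ (∀ i → monic as (f i) ≈ 0#)
  root-bound zero    []       _ f f-inj f-root = 1≉0 (f-root zero)
  root-bound (suc n) (a ∷ as) e f f-inj f-root =
    root-bound n (quotient (f zero) as) (≡.trans (length-quotient _ as) (ℕₚ.suc-injective e)) (f ∘ suc) (λ h → Finₚ.suc-injective (f-inj h))
      (λ i → root-of-quotient a as (f-root zero) (f-root (suc i)) (λ h → Finₚ.0≢1+n (≡.sym (f-inj h))))

  characteristic : ∀ p l → (p ℕ.^ l) ×ᴷ 1# ≈ 0# → (∀ x → Dec (x ≈ 0#)) → p ×ᴷ 1# ≈ 0#
  characteristic p zero    e _   = ⊥-elim (1≉0 (trans (sym (+-identityʳ 1#)) e))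
  characteristic p (suc l) e ≈0? with ≈0? (p ×ᴷ 1#)
  ... | yes p≈0 = p≈0
  ... | no  p≉0 = characteristic p l (xy≈0⇒y≈0 p≉0 (trans (sym (×1-homo-* p (p ℕ.^ l))) e)) ≈0?

-- Fermat's theorem and the number of k-th powers.

module FiniteFieldProperties {c ℓ} (K : Field c ℓ) {Q : ℕ} (enum : Inverse (≡.setoid (Fin Q)) (Field.setoid K)) where
  open Field K hiding (zero)
  open FieldProperties K
  open FiniteField K enum hiding (module Incidence)
  open import Relation.Binary.Reasoning.Setoid setoid
  import Algebra.Properties.CommutativeMonoid.Sum *-commutativeMonoid as Prod
  import Algebra.Properties.CommutativeMonoid.Sum +-commutativeMonoid as Sum

  ∑-roots : ∀ n as → length as ≡ n → ∑ (λ y → 𝟙 (monic as y ≟ 0#)) ≤ n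
  ∑-roots zero [] _ = ℕₚ.≤-reflexive (≡.trans (∑-cong (λ y → 𝟙-false (1# ≟ 0#) 1≉0)) ∑-zero)
  ∑-roots (suc n) (a ∷ as) e with some? (λ x≈y h → trans (monic-cong (a ∷ as) (sym x≈y)) h) (λ y → monic (a ∷ as) y ≟ 0#)
  ... | no ∄root = ℕₚ.≤-trans (ℕₚ.≤-reflexive (≡.trans (∑-cong (λ y → 𝟙-false (monic (a ∷ as) y ≟ 0#) (λ h → ∄root (y , h)))) ∑-zero)) z≤n
  ... | yes (r , r-root) = ℕₚ.≤-trans (∑-mono pointwise) (ℕₚ.≤-trans (ℕₚ.≤-reflexive (∑-+ _ _))
      (ℕₚ.+-mono-≤ (ℕₚ.≤-reflexive (∑-δ r (λ _ → ≡.refl))) (∑-roots n (quotient r as) (≡.trans (length-quotient r as) (ℕₚ.suc-injective e)))))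
    where
    pointwise : ∀ y → 𝟙 (monic (a ∷ as) y ≟ 0#) ≤ 𝟙 (r ≟ y) ℕ.* 1 ℕ.+ 𝟙 (monic (quotient r as) y ≟ 0#)
    pointwise y with monic (a ∷ as) y ≟ 0# | r ≟ y
    ... | no _       | _      = z≤n
    ... | yes _      | yes _  = s≤s z≤n
    ... | yes y-root | no r≉y = ℕₚ.≤-reflexive (≡.sym (𝟙-true _ (root-of-quotient a as r-root y-root (r≉y ∘ sym))))

  Q≡1+[Q∸1] : Q ≡ suc (Q ℕ.∸ 1)
  Q≡1+[Q∸1] = inhabited (idx 0#)
    where
    inhabited : ∀ {n} → Fin n → n ≡ suc (n ℕ.∸ 1)
    inhabited {suc n} _ = ≡.refl

  -- Translation by 1 permutes the field, so the sum s of all elements equals s plus Q times 1.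
  Q×1≈0 : Q ×ᴷ 1# ≈ 0#
  Q×1≈0 = begin
    Q ×ᴷ 1#                            ≈⟨ solve 2 (λ x s → x := (x :+ s) :- s) refl (Q ×ᴷ 1#) s ⟩
    (Q ×ᴷ 1# + s) - s                  ≈⟨ +-congʳ (+-congʳ (Sum.sum-replicate Q)) ⟨
    (Sum.sum {Q} (λ _ → 1#) + s) - s   ≈⟨ +-congʳ (Sum.∑-distrib-+ {Q} (λ _ → 1#) elt) ⟨
    Sum.sum (λ i → 1# + elt i) - s     ≈⟨ +-congʳ (Sum.sum-cong-≋ (λ i → elt-idx (1# + elt i))) ⟨
    Sum.sum (λ i → elt (idx (1# + elt i))) - s ≈⟨ +-congʳ (Sum.sum-permute elt shift) ⟨
    s - s                              ≈⟨ -‿inverseʳ s ⟩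
    0#                                 ∎
    where
    open RingSolver commutativeRing
    s = Sum.sum elt
    shift : Permutation Q Q
    shift = permuteBy {λ _ → 0} (λ _ → ≡.refl) (1# +_) (λ x → x - 1#) +-congˡ +-congʳ
      (λ x → solve 2 (λ o x → o :+ (x :- o) := x) refl 1# x) (λ x → solve 2 (λ o x → (o :+ x) :- o := x) refl 1# x)

  private
    -- The extra factor x fills the place of the index j, so that no index has to be deleted; with j
    -- the index of zero this leads straight to x^Q = x.
    product-all-but-one : ∀ {n x} (j : Fin n) (t : Fin n → Carrier) → t j ≈ 1# → (∀ i → i ≢ j → t i ≈ x) → x * Prod.sum t ≈ x ^ n
    product-all-but-one {suc n} {x} zero t tj≈1 t≈x = *-congˡ (trans (*-congʳ tj≈1) (trans (*-identityˡ _)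
      (trans (Prod.sum-cong-≋ (λ i → t≈x (suc i) (λ ()))) (Prod.sum-replicate n))))
    product-all-but-one {suc n} {x} (suc j) t tj≈1 t≈x = trans (*-congˡ (*-congʳ (t≈x zero (λ ()))))
      (*-congˡ (product-all-but-one j (t ∘ suc) tj≈1 (λ i i≢j → t≈x (suc i) (λ e → i≢j (Finₚ.suc-injective e)))))

    product≉0 : ∀ {n} (t : Fin n → Carrier) → (∀ i → ¬ (t i ≈ 0#)) → ¬ (Prod.sum t ≈ 0#)
    product≉0 {zero}  t t≉0 = 1≉0
    product≉0 {suc n} t t≉0 = xy≉0 (t≉0 zero) (product≉0 (t ∘ suc) (t≉0 ∘ suc))

    -- With 1 in place of the factor at zero, a product over the units becomes a product over all
    -- indices.
    unit-part : Carrier → Carrier → Carrier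
    unit-part y x with y ≟ 0#
    ... | yes _ = 1#
    ... | no  _ = x

    unit-part-≈0 : ∀ {y} x → y ≈ 0# → unit-part y x ≈ 1#
    unit-part-≈0 {y} x e with y ≟ 0#
    ... | yes _ = refl
    ... | no ne = ⊥-elim (ne e)

    unit-part-≉0 : ∀ {y} x → ¬ (y ≈ 0#) → unit-part y x ≈ x
    unit-part-≉0 {y} x ne with y ≟ 0#
    ... | yes e = ⊥-elim (ne e)
    ... | no  _ = refl

    -- Multiplication by x permutes the units and hence preserves their product; that product is
    -- nonzero and can be cancelled.
    product-of-units : ∀ {x} → ¬ (x ≈ 0#) → Prod.sum (λ i → unit-part (elt i) x) ≈ 1#
    product-of-units {x} x≉0 with inverse x x≉0
    ... | x⁻¹ , xx⁻¹≈1 = cancelʳ (product≉0 φ φ≉0) (begin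
      Prod.sum (λ i → unit-part (elt i) x) * Prod.sum φ    ≈⟨ Prod.∑-distrib-+ (λ i → unit-part (elt i) x) φ ⟨
      Prod.sum (λ i → unit-part (elt i) x * φ i)           ≈⟨ Prod.sum-cong-≋ scaled ⟨
      Prod.sum (λ i → φ (idx (x * elt i)))                 ≈⟨ Prod.sum-permute φ scale ⟨
      Prod.sum φ                                           ≈⟨ *-identityˡ _ ⟨
      1# * Prod.sum φ                                      ∎)
      where
      φ : Fin Q → Carrier
      φ i = unit-part (elt i) (elt i)
      φ≉0 : ∀ i → ¬ (φ i ≈ 0#)
      φ≉0 i with elt i ≟ 0#
      ... | yes _ = 1≉0
      ... | no ne = ne
      scale : Permutation Q Q
      scale = permuteBy {λ _ → 0} (λ _ → ≡.refl) (x *_) (x⁻¹ *_) *-congˡ *-congˡ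
        (λ y → trans (sym (*-assoc _ _ _)) (trans (*-congʳ xx⁻¹≈1) (*-identityˡ y)))
        (λ y → trans (sym (*-assoc _ _ _)) (trans (*-congʳ (trans (*-comm _ _) xx⁻¹≈1)) (*-identityˡ y)))
      scaled : ∀ i → φ (idx (x * elt i)) ≈ unit-part (elt i) x * φ i
      scaled i with elt i ≟ 0#
      ... | yes e = trans (unit-part-≈0 _ (trans (elt-idx _) (trans (*-congˡ e) (zeroʳ x)))) (sym (*-identityˡ 1#))
      ... | no ne = trans (unit-part-≉0 _ (λ h → xy≉0 x≉0 ne (trans (sym (elt-idx _)) h))) (elt-idx _)

  fermat : ∀ x → x ^ Q ≈ x
  fermat x with x ≟ 0#
  ... | yes e = trans (^-congˡ Q e) (trans (^-congʳ 0# Q≡1+[Q∸1]) (trans (zeroˡ _) (sym e)))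
  ... | no ne = trans (sym (product-all-but-one (idx 0#) (λ i → unit-part (elt i) x) (unit-part-≈0 x (elt-idx 0#))
      (λ i i≢0 → unit-part-≉0 x (λ e → i≢0 (≡.trans (≡.sym (idx-elt i)) (idx-cong e))))))
    (trans (*-congˡ (product-of-units ne)) (*-identityʳ x))

  fermat′ : ∀ {x} → ¬ (x ≈ 0#) → x ^ (Q ℕ.∸ 1) ≈ 1#
  fermat′ {x} x≉0 = cancelˡ x≉0 (trans (^-congʳ x (≡.sym Q≡1+[Q∸1])) (trans (fermat x) (sym (*-identityʳ x))))

  module Powers (k : ℕ) (1≤k : 1 ≤ k) where

    Power : Carrier → Set _
    Power v = ∃ λ y → ¬ (y ≈ 0#) × y ^ k ≈ v

    Power-resp : ∀ {u v} → u ≈ v → Power u → Power v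
    Power-resp e (y , y≉0 , h) = y , y≉0 , trans h e

    Power≉0 : ∀ {v} → Power v → ¬ (v ≈ 0#)
    Power≉0 (y , y≉0 , h) e = x^n≉0 k y≉0 (trans h e)

    Power-* : ∀ {u v} → Power u → Power v → Power (u * v)
    Power-* (y , y≉0 , h) (z , z≉0 , h′) = y * z , xy≉0 y≉0 z≉0 , trans (^-distrib-* y z k) (*-cong h h′)

    Power-1 : Power 1#
    Power-1 = 1# , 1≉0 , 1^n≈1 k

    power? : ∀ v → Dec (Power v)
    power? v = some? (λ e (y≉0 , h) → (λ y≈0 → y≉0 (trans e y≈0)) , trans (^-congˡ k (sym e)) h) (λ y → ¬? (y ≟ 0#) ×-dec (y ^ k ≟ v))

    abstract
      η : Carrier → ℕ
      η v = 𝟙 (power? v)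

      η-cong : Congruent η
      η-cong e = 𝟙-cong (power? _) (power? _) (Power-resp e) (Power-resp (sym e))

      η-idem : ∀ v → η v ℕ.* η v ≡ η v
      η-idem v = 𝟙-idem (power? v)

      η-true : ∀ {v} → Power v → η v ≡ 1
      η-true {v} = 𝟙-true (power? v)

      η-false : ∀ {v} → ¬ Power v → η v ≡ 0
      η-false {v} = 𝟙-false (power? v)

    η-bit : ∀ v → η v ≡ 0 ⊎ η v ≡ 1
    η-bit v with power? v
    ... | yes h = inj₂ (η-true h)
    ... | no ¬h = inj₁ (η-false ¬h)

    η-positive : ∀ {v} → 0 < η v → Power v
    η-positive {v} 0<η with power? v
    ... | yes h = h
    ... | no ¬h = ⊥-elim (ℕₚ.<⇒≢ 0<η (≡.sym (η-false ¬h)))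

    e : ℕ
    e = gcd k (Q ℕ.∸ 1)

    1≤e : 1 ≤ e
    1≤e = ℕₚ.n≢0⇒n>0 (gcd[m,n]≢0 k (Q ℕ.∸ 1) (inj₁ (ℕₚ.>⇒≢ 1≤k)))

    -- Bézout writes e as a difference of multiples of k and Q - 1. Since y^(Q - 1) = 1, either y^e
    -- or its inverse is a power of y^k, and so y^k determines y^e.
    power-e : ∀ {y z} → ¬ (y ≈ 0#) → ¬ (z ≈ 0#) → y ^ k ≈ z ^ k → y ^ e ≈ z ^ e
    power-e {y} {z} y≉0 z≉0 h with Bézout.identity (gcd-GCD k (Q ℕ.∸ 1))
    ... | Bézout.+- a b eq = trans (determined y≉0) (trans (^-congˡ a h) (sym (determined z≉0)))
      where
      determined : ∀ {y} → ¬ (y ≈ 0#) → y ^ e ≈ (y ^ k) ^ a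
      determined {y} y≉0 = begin
        y ^ e                                 ≈⟨ *-identityʳ _ ⟨
        y ^ e * 1#                            ≈⟨ *-congˡ (trans (^-congˡ b (fermat′ y≉0)) (1^n≈1 b)) ⟨
        y ^ e * (y ^ (Q ℕ.∸ 1)) ^ b           ≈⟨ *-congˡ (^-assocʳ y (Q ℕ.∸ 1) b) ⟩
        y ^ e * y ^ ((Q ℕ.∸ 1) ℕ.* b)         ≈⟨ ^-homo-* y e _ ⟨
        y ^ (e ℕ.+ (Q ℕ.∸ 1) ℕ.* b)           ≈⟨ ^-congʳ y (≡.trans (≡.cong (e ℕ.+_) (ℕₚ.*-comm (Q ℕ.∸ 1) b)) (≡.trans eq (ℕₚ.*-comm a k))) ⟩
        y ^ (k ℕ.* a)                         ≈⟨ ^-assocʳ y k a ⟨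
        (y ^ k) ^ a                           ∎
    ... | Bézout.-+ a b eq = cancelʳ (x^n≉0 a (x^n≉0 k y≉0)) (trans (determined y≉0) (trans (sym (determined z≉0)) (*-congˡ (^-congˡ a (sym h)))))
      where
      determined : ∀ {y} → ¬ (y ≈ 0#) → y ^ e * (y ^ k) ^ a ≈ 1#
      determined {y} y≉0 = begin
        y ^ e * (y ^ k) ^ a                   ≈⟨ *-congˡ (^-assocʳ y k a) ⟩
        y ^ e * y ^ (k ℕ.* a)                 ≈⟨ ^-homo-* y e _ ⟨
        y ^ (e ℕ.+ k ℕ.* a)                   ≈⟨ ^-congʳ y (≡.trans (≡.cong (e ℕ.+_) (ℕₚ.*-comm k a)) (≡.trans eq (ℕₚ.*-comm b _))) ⟩
        y ^ ((Q ℕ.∸ 1) ℕ.* b)                 ≈⟨ ^-assocʳ y (Q ℕ.∸ 1) b ⟨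
        (y ^ (Q ℕ.∸ 1)) ^ b                   ≈⟨ trans (^-congˡ b (fermat′ y≉0)) (1^n≈1 b) ⟩
        1#                                    ∎

    private
      nz : Carrier → ℕ
      nz y = 𝟙 (¬? (y ≟ 0#))

      -- Once one root z of v is known, every other root satisfies y^e = z^e by `power-e`, and so is
      -- one of at most e roots of x^e - z^e.
      fibre : ∀ v → ∑ (λ y → 𝟙 (y ^ k ≟ v) ℕ.* nz y) ≤ η v ℕ.* e
      fibre v with power? v
      ... | no ¬power = ℕₚ.≤-trans (ℕₚ.≤-reflexive (≡.trans (∑-cong pointwise) ∑-zero)) z≤n
        where
        pointwise : ∀ y → 𝟙 (y ^ k ≟ v) ℕ.* nz y ≡ 0
        pointwise y with y ^ k ≟ v | y ≟ 0#
        ... | no _  | _      = ≡.refl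
        ... | yes _ | yes _  = ≡.refl
        ... | yes h | no y≉0 = ⊥-elim (¬power (y , y≉0 , h))
      ... | yes (z , z≉0 , z^k≈v) = ℕₚ.≤-trans (∑-mono pointwise) (ℕₚ.≤-trans (∑-roots e (- (z ^ e) ∷ replicate (e ℕ.∸ 1) 0#) (≡.trans (≡.cong suc (Listₚ.length-replicate (e ℕ.∸ 1))) e≡)) (ℕₚ.≤-reflexive (≡.sym (≡.trans (≡.cong (ℕ._* e) (η-true (z , z≉0 , z^k≈v))) (ℕₚ.*-identityˡ e)))))
        where
        e≡ : suc (e ℕ.∸ 1) ≡ e
        e≡ = ℕₚ.m+[n∸m]≡n 1≤e
        root : ∀ {y} → y ^ e ≈ z ^ e → monic (- (z ^ e) ∷ replicate (e ℕ.∸ 1) 0#) y ≈ 0#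
        root {y} h = trans (+-congˡ (trans (*-congˡ (monic-^ (e ℕ.∸ 1) y)) (trans (^-congʳ y e≡) h))) (-‿inverseˡ _)
        pointwise : ∀ y → 𝟙 (y ^ k ≟ v) ℕ.* nz y ≤ 𝟙 (monic (- (z ^ e) ∷ replicate (e ℕ.∸ 1) 0#) y ≟ 0#)
        pointwise y with y ^ k ≟ v | y ≟ 0#
        ... | no _  | _      = z≤n
        ... | yes _ | yes _  = z≤n
        ... | yes h | no y≉0 = ℕₚ.≤-reflexive (≡.sym (𝟙-true (_ ≟ 0#) (root (power-e y≉0 z≉0 (trans h (sym z^k≈v))))))

    ∑-nonzero : suc (∑ nz) ≡ Q
    ∑-nonzero = ≡.trans (≡.cong (ℕ._+ ∑ nz) (≡.sym (∑-δ 0# (λ _ → ≡.refl)))) (≡.trans (≡.sym (∑-+ _ nz)) (≡.trans (∑-cong pointwise) (≡.trans (∑-const 1) (ℕₚ.*-identityʳ Q))))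
      where
      pointwise : ∀ y → 𝟙 (0# ≟ y) ℕ.* 1 ℕ.+ nz y ≡ 1
      pointwise y with 0# ≟ y | y ≟ 0#
      ... | yes h  | no ne = ⊥-elim (ne (sym h))
      ... | yes _  | yes _ = ≡.refl
      ... | no _   | no _  = ≡.refl
      ... | no ne  | yes h = ⊥-elim (ne (sym h))

    powers-bound : Q ℕ.∸ 1 ≤ ∑ η ℕ.* e
    powers-bound = R.begin
      Q ℕ.∸ 1                                        R.≡⟨ ≡.cong (ℕ._∸ 1) ∑-nonzero ⟨
      ∑ nz                                           R.≡⟨ ∑-cong (λ y → ∑-δ (y ^ k) {λ _ → nz y} (λ _ → ≡.refl)) ⟨
      ∑ (λ y → ∑ (λ v → 𝟙 (y ^ k ≟ v) ℕ.* nz y))     R.≡⟨ ∑-swap _ ⟩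
      ∑ (λ v → ∑ (λ y → 𝟙 (y ^ k ≟ v) ℕ.* nz y))     R.≤⟨ ∑-mono fibre ⟩
      ∑ (λ v → η v ℕ.* e)                            R.≡⟨ ∑-*ʳ e η ⟩
      ∑ η ℕ.* e                                      R.∎
      where module R = ℕₚ.≤-Reasoning

-- Sums of two k-th powers in a large field.

module _ where
  open Data.Nat using (_+_; _*_; _^_)

  -- From (Q - 1)⁴ ≥ Q³ (Q - 4) and Q - 4 > e⁴ one gets Q³ e⁴ < (Q - 1)⁴ ≤ h⁴ e⁴. This is the origin
  -- of the constant 4.
  many-powers : ∀ Q h e s → Q ≡ suc s → s ≤ h * e → e ^ 4 + 4 < Q → Q * (Q * Q) < h * h * (h * h)
  many-powers .(suc s) h e s ≡.refl s≤he e⁴+4<Q = ℕₚ.*-cancelˡ-< (e ^ 4) _ _ (begin-strict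
    e ^ 4 * cube                           <⟨ ℕₚ.+-cancelˡ-< (4 * cube) _ _ main ⟩
    s * s * (s * s)                        ≤⟨ ℕₚ.*-mono-≤ (ℕₚ.*-mono-≤ s≤he s≤he) (ℕₚ.*-mono-≤ s≤he s≤he) ⟩
    h * e * (h * e) * (h * e * (h * e))    ≡⟨ lem₃ h e ⟩
    e ^ 4 * (h * h * (h * h))              ∎)
    where
    open ℕₚ.≤-Reasoning
    cube : ℕ
    cube = suc s * (suc s * suc s)
    lem₁ : ∀ e c → 4 * c + e * c ≡ (e + 4) * c
    lem₁ = solve-∀
    lem₂ : ∀ s → suc s * (suc s * (suc s * suc s)) + (6 * (s * s) + 8 * s + 3) ≡ 4 * (suc s * (suc s * suc s)) + s * s * (s * s)
    lem₂ = solve-∀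
    lem₃ : ∀ h e → h * e * (h * e) * (h * e * (h * e)) ≡ (e * (e * (e * (e * 1)))) * (h * h * (h * h))
    lem₃ = solve-∀
    main : 4 * cube + e ^ 4 * cube < 4 * cube + s * s * (s * s)
    main = begin-strict
      4 * cube + e ^ 4 * cube                        ≡⟨ lem₁ (e ^ 4) cube ⟩
      (e ^ 4 + 4) * cube                             <⟨ ℕₚ.*-monoˡ-< cube e⁴+4<Q ⟩
      suc s * cube                                   ≤⟨ ℕₚ.m≤m+n _ _ ⟩
      suc s * cube + (6 * (s * s) + 8 * s + 3)       ≡⟨ lem₂ s ⟩
      4 * cube + s * s * (s * s)                     ∎

module SumOfTwoPowers {c ℓ} (K : Field c ℓ) {Q : ℕ} (enum : Inverse (≡.setoid (Fin Q)) (Field.setoid K)) (k : ℕ) (1≤k : 1 ≤ k) where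
  open Field K hiding (zero) renaming (_*_ to _·_)
  open FieldProperties K
  open FiniteField K enum
  open FiniteFieldProperties K enum
  open Powers k 1≤k
  open Incidence η-cong η-cong η-idem η-idem using (incidence-exists)
  open RingSolver commutativeRing
  open Data.Nat using (_*_)

  private
    h P : ℕ
    h = ∑ η
    P = h * h

  module _ (c : Carrier) (c≉0 : ¬ (c ≈ 0#)) where

    private
      c⁻¹ : Carrier
      c⁻¹ = proj₁ (inverse c c≉0)

      cc⁻¹≈1 : c · c⁻¹ ≈ 1#
      cc⁻¹≈1 = proj₂ (inverse c c≉0)

      -- The indicator function of H × cH; the summand `0#` gives the argument the shape expected by
      -- `∑-affine`.
      point : Carrier → Carrier → ℕ
      point x y = η x * η (0# + y · c⁻¹)

      ∑-point : ∑ (λ x → ∑ (point x)) ≡ P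
      ∑-point = ≡.trans (∑-cong (λ x → ≡.trans (∑-*ˡ (η x) _) (≡.cong (η x *_) (∑-affine η-cong 0# c⁻¹ c⁻¹≉0)))) (∑-*ʳ h η)
        where
        c⁻¹≉0 : ¬ (c⁻¹ ≈ 0#)
        c⁻¹≉0 e = 1≉0 (trans (sym cc⁻¹≈1) (trans (*-congˡ e) (zeroʳ c)))

      point-bit : ∀ x y → point x y ≡ 0 ⊎ point x y ≡ 1
      point-bit x y = bit-* (η-bit x) (η-bit _)
        where
        bit-* : ∀ {a b} → a ≡ 0 ⊎ a ≡ 1 → b ≡ 0 ⊎ b ≡ 1 → a * b ≡ 0 ⊎ a * b ≡ 1
        bit-* (inj₁ ≡.refl) _             = inj₁ ≡.refl
        bit-* (inj₂ ≡.refl) (inj₁ ≡.refl) = inj₁ ≡.refl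
        bit-* (inj₂ ≡.refl) (inj₂ ≡.refl) = inj₂ ≡.refl

      factors : ∀ {m n} → 0 < m * n → 0 < m × 0 < n
      factors {suc m} {suc n} _ = s≤s z≤n , s≤s z≤n
      factors {suc m} {zero}  h = ⊥-elim (ℕₚ.<⇒≱ h (ℕₚ.≤-reflexive (ℕₚ.*-zeroʳ m)))

    -- An incidence reads c wᵏ = y = x b + a, where x b is a power because H is closed under
    -- products; dividing by wᵏ leaves c.
    divide : ∀ {x y b} → Power (x · b) → Power (y - x · b) → Power (0# + y · c⁻¹) → ∃₂ λ x y → x ^ k + y ^ k ≈ c
    divide {x} {y} {b} (u , _ , u^k≈xb) (v , _ , v^k≈a) (w , w≉0 , w^k≈h) = u · w⁻¹ , v · w⁻¹ , cancelʳ (x^n≉0 k w≉0) (begin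
      ((u · w⁻¹) ^ k + (v · w⁻¹) ^ k) · w ^ k                    ≈⟨ distribʳ _ _ _ ⟩
      (u · w⁻¹) ^ k · w ^ k + (v · w⁻¹) ^ k · w ^ k              ≈⟨ +-cong (clear u) (clear v) ⟩
      u ^ k + v ^ k                                              ≈⟨ +-cong u^k≈xb v^k≈a ⟩
      x · b + (y - x · b)                                        ≈⟨ solve 2 (λ t y → t :+ (y :- t) := y) refl (x · b) y ⟩
      y                                                          ≈⟨ *-identityʳ y ⟨
      y · 1#                                                     ≈⟨ *-congˡ cc⁻¹≈1 ⟨
      y · (c · c⁻¹)                                              ≈⟨ solve 3 (λ y c d → y :* (c :* d) := c :* (y :* d)) refl y c c⁻¹ ⟩
      c · (y · c⁻¹)                                              ≈⟨ *-congˡ (trans w^k≈h (+-identityˡ _)) ⟨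
      c · w ^ k                                                  ∎)
      where
      w⁻¹ : Carrier
      w⁻¹ = proj₁ (inverse w w≉0)
      ww⁻¹≈1 : w · w⁻¹ ≈ 1#
      ww⁻¹≈1 = proj₂ (inverse w w≉0)
      open import Relation.Binary.Reasoning.Setoid setoid
      clear : ∀ u → (u · w⁻¹) ^ k · w ^ k ≈ u ^ k
      clear u = trans (sym (^-distrib-* (u · w⁻¹) w k)) (^-congˡ k (trans (*-assoc _ _ _) (trans (*-congˡ (trans (*-comm _ _) ww⁻¹≈1)) (*-identityʳ u))))

    enough-powers : Q * (Q * Q) < P * P → ∃₂ λ x y → x ^ k + y ^ k ≈ c
    enough-powers Q³<P² =
      let x , y , 0<term = incidence-exists point-bit (≡.subst (λ z → Q * (Q * Q) < P * z) (≡.sym ∑-point) Q³<P²)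
          0<point , 0<incidences = factors {point x y} 0<term
          0<ηx , 0<ηy = factors {η x} 0<point
          b , 0<line = ∑-positive 0<incidences
          0<ηb , 0<ηa = factors {η b} 0<line
      in divide (Power-* (η-positive 0<ηx) (η-positive 0<ηb)) (η-positive 0<ηa) (η-positive 0<ηy)

    sum-of-two-powers : ∀ g → g ≡ gcd k (Q ℕ.∸ 1) → g ℕ.^ 4 ℕ.+ 4 < Q → ∃₂ λ x y → x ^ k + y ^ k ≈ c
    sum-of-two-powers g g≡ g⁴+4<Q = enough-powers (many-powers Q h g (Q ℕ.∸ 1) Q≡1+[Q∸1] (≡.subst (λ g → Q ℕ.∸ 1 ≤ h * g) (≡.sym g≡) powers-bound) g⁴+4<Q)

-- Every element as a sum of a prescribed number of k-th powers.

module SumsOfPowers {c ℓ} (K : Field c ℓ) {Q : ℕ} (enum : Inverse (≡.setoid (Fin Q)) (Field.setoid K)) (k : ℕ) (1≤k : 1 ≤ k) where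
  open Field K hiding (zero) renaming (_*_ to _·_)
  open FieldProperties K
  open FiniteField K enum
  open FiniteFieldProperties K enum
  open Powers k 1≤k
  open RingSolver commutativeRing
  open Data.Nat using (_*_)

  private
    support : (Carrier → ℕ) → Carrier → ℕ
    support f y = 𝟙 (1 ℕ.≤? f y)

    support-cong : ∀ {f} → Congruent f → Congruent (support f)
    support-cong f-cong e = ≡.cong (λ n → 𝟙 (1 ℕ.≤? n)) (f-cong e)

    -- On the support, 2 (E) (S f(y)) ≤ E² + S² f(y)². The weights are chosen so that summation
    -- gives 2 E S² ≤ E² N + S² E, where S² E and then a factor E > 0 cancel.
    cauchy-schwarz : ∀ f → 0 < ∑ f → ∑ f * ∑ f ≤ ∑ (λ y → f y * f y) * ∑ (support f)
    cauchy-schwarz f 0<S = ℕₚ.*-cancelˡ-≤ E {{ℕ.>-nonZero (ℕₚ.≤-trans 0<S (∑-mono (λ y → n≤n² (f y))))}}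
      (ℕₚ.+-cancelʳ-≤ (S * S * E) _ _ (begin
        E * (S * S) ℕ.+ S * S * E                                    ≡⟨ lem₁ E S ⟩
        2 * (E * S) * S                                              ≡⟨ ∑-*ˡ (2 * (E * S)) f ⟨
        ∑ (λ y → 2 * (E * S) * f y)                                  ≤⟨ ∑-mono (λ y → pointwise (f y)) ⟩
        ∑ (λ y → E * E * support f y ℕ.+ S * S * (f y * f y))        ≡⟨ ∑-+ _ _ ⟩
        ∑ (λ y → E * E * support f y) ℕ.+ ∑ (λ y → S * S * (f y * f y)) ≡⟨ ≡.cong₂ ℕ._+_ (∑-*ˡ (E * E) _) (∑-*ˡ (S * S) _) ⟩
        E * E * N ℕ.+ S * S * E                                      ≡⟨ ≡.cong (ℕ._+ S * S * E) (ℕₚ.*-assoc E E N) ⟩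
        E * (E * N) ℕ.+ S * S * E                                    ∎))
      where
      open ℕₚ.≤-Reasoning
      S E N : ℕ
      S = ∑ f
      E = ∑ (λ y → f y * f y)
      N = ∑ (support f)
      n≤n² : ∀ n → n ≤ n * n
      n≤n² zero    = z≤n
      n≤n² (suc n) = ℕₚ.m≤m*n (suc n) (suc n)
      lem₁ : ∀ e s → e * (s * s) ℕ.+ s * s * e ≡ 2 * (e * s) * s
      lem₁ = solve-∀
      lem₂ : ∀ e s n → 2 * (e * s) * n ≡ 2 * (e * (s * n))
      lem₂ = solve-∀
      lem₃ : ∀ e s n → e * e ℕ.+ s * n * (s * n) ≡ e * e * 1 ℕ.+ s * s * (n * n)
      lem₃ = solve-∀
      pointwise : ∀ n → 2 * (E * S) * n ≤ E * E * 𝟙 (1 ℕ.≤? n) ℕ.+ S * S * (n * n)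
      pointwise zero = ℕₚ.≤-trans (ℕₚ.≤-reflexive (ℕₚ.*-zeroʳ (2 * (E * S)))) z≤n
      pointwise n@(suc _) = begin
        2 * (E * S) * n                  ≡⟨ lem₂ E S n ⟩
        2 * (E * (S * n))                ≤⟨ 2ab≤a²+b² E (S * n) ⟩
        E * E ℕ.+ S * n * (S * n)        ≡⟨ lem₃ E S n ⟩
        E * E * 1 ℕ.+ S * S * (n * n)    ∎

    two-distinct : ∀ {f} → (∀ x → f x ≤ 1) → 1 < ∑ f → ∃₂ λ x y → ¬ (x ≈ y) × 0 < f x × 0 < f y
    two-distinct {f} f≤1 1<∑ =
      let x , 0<fx = ∑-positive (ℕₚ.<⇒≤ 1<∑)
          y , δ<fy = ∑-< {λ y → 𝟙 (x ≟ y) * 1} (≡.subst (_< ∑ f) (≡.sym (∑-δ x (λ _ → ≡.refl))) 1<∑)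
      in x , y , (λ x≈y → ℕₚ.<⇒≱ δ<fy (ℕₚ.≤-trans (f≤1 y) (ℕₚ.≤-reflexive (≡.sym (≡.trans (ℕₚ.*-identityʳ _) (𝟙-true (x ≟ y) x≈y)))))) , 0<fx , ℕₚ.≤-<-trans z≤n δ<fy

    bit-*≤1 : ∀ {a b} → a ≡ 0 ⊎ a ≡ 1 → b ≡ 0 ⊎ b ≡ 1 → a * b ≤ 1
    bit-*≤1 (inj₁ ≡.refl) _             = z≤n
    bit-*≤1 (inj₂ ≡.refl) (inj₁ ≡.refl) = z≤n
    bit-*≤1 (inj₂ ≡.refl) (inj₂ ≡.refl) = s≤s z≤n

    factors : ∀ m n → 0 < m * n → 0 < m × 0 < n
    factors (suc m) (suc n) _ = s≤s z≤n , s≤s z≤n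
    factors (suc m) zero    h = ⊥-elim (ℕₚ.<⇒≱ h (ℕₚ.≤-reflexive (ℕₚ.*-zeroʳ m)))

    abstract
      α : Carrier → ℕ
      α v = 𝟙 (0# ≟ v) * 1 ℕ.+ η v

      α-cong : Congruent α
      α-cong e = ≡.cong₂ ℕ._+_ (≡.cong (_* 1) (𝟙-cong (0# ≟ _) (0# ≟ _) (λ h → trans h e) (λ h → trans h (sym e)))) (η-cong e)

      α-values : ∀ v → α v ≡ 0 ⊎ (α v ≡ 1 × (v ≈ 0# ⊎ Power v))
      α-values v with 0# ≟ v | power? v
      ... | yes 0≈v | yes h = ⊥-elim (Power≉0 h (sym 0≈v))
      ... | yes 0≈v | no ¬h = inj₂ (≡.cong suc (η-false ¬h) , inj₁ (sym 0≈v))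
      ... | no _    | yes h = inj₂ (η-true h , inj₂ h)
      ... | no _    | no ¬h = inj₁ (η-false ¬h)

      ∑-α : ∑ α ≡ suc (∑ η)
      ∑-α = ≡.trans (∑-+ _ η) (≡.cong (ℕ._+ ∑ η) (∑-δ 0# (λ _ → ≡.refl)))

    α-bit : ∀ v → α v ≡ 0 ⊎ α v ≡ 1
    α-bit v with α-values v
    ... | inj₁ h       = inj₁ h
    ... | inj₂ (h , _) = inj₂ h

    α-idem : ∀ v → α v * α v ≡ α v
    α-idem v with α-bit v
    ... | inj₁ h = ≡.trans (≡.cong₂ _*_ h h) (≡.sym h)
    ... | inj₂ h = ≡.trans (≡.cong₂ _*_ h h) (≡.sym h)

    α-positive : ∀ {v} → 0 < α v → v ≈ 0# ⊎ Power v
    α-positive {v} 0<α with α-values v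
    ... | inj₁ h       = ⊥-elim (ℕₚ.<⇒≢ 0<α (≡.sym h))
    ... | inj₂ (_ , h) = h

  open Incidence α-cong η-cong α-idem η-idem using (incidences; incidences-cong; ∑-incidences; secondMoment)

  -- The count is exact and not an upper bound, because each summand is to occupy one diagonal place
  -- of the two triangular matrices.
  data SumOfPowers : ℕ → Carrier → Set (c ⊔ ℓ) where
    nil  : ∀ {t} → t ≈ 0# → SumOfPowers 0 t
    cons : ∀ {s h u t} → Power h → SumOfPowers s u → t ≈ h + u → SumOfPowers (suc s) t

  sop-resp : ∀ {s t u} → t ≈ u → SumOfPowers s t → SumOfPowers s u
  sop-resp e (nil h)       = nil (trans (sym e) h)
  sop-resp e (cons h s h′) = cons h s (trans (sym e) h′)

  sop-+ : ∀ {s t s′ t′} → SumOfPowers s t → SumOfPowers s′ t′ → SumOfPowers (s ℕ.+ s′) (t + t′)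
  sop-+ (nil e) r       = sop-resp (trans (sym (+-identityˡ _)) (+-congʳ (sym e))) r
  sop-+ (cons h s e) r  = cons h (sop-+ s r) (trans (+-congʳ e) (+-assoc _ _ _))

  sop-copies : ∀ {h} → Power h → ∀ m → SumOfPowers m (m ×ᴷ h)
  sop-copies h zero    = nil refl
  sop-copies h (suc m) = cons h (sop-copies h m) refl

  module _ (p : ℕ) (p×1≈0 : suc p ×ᴷ 1# ≈ 0#) (Q∸1≤ : Q ℕ.∸ 1 ≤ ∑ η * ∑ η) (2≤h : 2 ≤ ∑ η) where

    private
      h P : ℕ
      h = ∑ η
      P = ∑ α * h

      -- Adjoining 0 to H adds h ≥ 2 to h² ≥ Q - 1, which is just enough to exceed Q.
      Q<P : Q < P
      Q<P = begin-strict
        Q                <⟨ ℕₚ.n<1+n Q ⟩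
        suc Q            ≡⟨ ≡.cong suc Q≡1+[Q∸1] ⟩
        2 ℕ.+ (Q ℕ.∸ 1)  ≤⟨ ℕₚ.+-mono-≤ 2≤h Q∸1≤ ⟩
        suc h * h        ≡⟨ ≡.cong (_* h) ∑-α ⟨
        P                ∎
        where open ℕₚ.≤-Reasoning

      energy : Carrier → ℕ
      energy ξ = ∑ (λ y → incidences ξ y * incidences ξ y)

      -- The energies of all ξ together are at most Q P + P² < 2 P², so some ξ lies below the
      -- average 2 P² / Q.
      low-energy : ∃ λ ξ → Q * energy ξ < 2 * (P * P)
      low-energy = ∑-< (begin-strict
        ∑ (λ ξ → Q * energy ξ)       ≡⟨ ∑-*ˡ Q energy ⟩
        Q * ∑ energy                 ≤⟨ ℕₚ.*-monoʳ-≤ Q secondMoment ⟩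
        Q * (Q * P ℕ.+ P * P)        <⟨ ℕₚ.*-monoʳ-< Q {{Q≢0}} (ℕₚ.+-monoˡ-< (P * P) (ℕₚ.*-monoˡ-< P {{P≢0}} Q<P)) ⟩
        Q * (P * P ℕ.+ P * P)        ≡⟨ ≡.cong (λ z → Q * (P * P ℕ.+ z)) (≡.sym (ℕₚ.+-identityʳ (P * P))) ⟩
        Q * (2 * (P * P))            ≡⟨ ∑-const (2 * (P * P)) ⟨
        ∑ (λ _ → 2 * (P * P))        ∎)
        where
        open ℕₚ.≤-Reasoning
        Q≢0 : ℕ.NonZero Q
        Q≢0 = ≡.subst ℕ.NonZero (≡.sym Q≡1+[Q∸1]) _
        P≢0 : ℕ.NonZero P
        P≢0 = ℕ.>-nonZero (ℕₚ.≤-<-trans z≤n Q<P)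

    private module _ (ξ : Carrier) (low : Q * energy ξ < 2 * (P * P)) where

      N : ℕ
      N = ∑ (support (incidences ξ))

      -- Few coincidences force many values: by Cauchy-Schwarz P² ≤ energy · N, while Q · energy < 2
      -- P².
      Q<2N : Q < N ℕ.+ N
      Q<2N = ℕₚ.*-cancelʳ-< (energy ξ) _ _ (begin-strict
        Q * energy ξ                 <⟨ low ⟩
        2 * (P * P)                  ≡⟨ ≡.cong (λ z → 2 * (z * z)) (≡.sym (∑-incidences ξ)) ⟩
        2 * (S * S)                  ≤⟨ ℕₚ.*-monoʳ-≤ 2 (cauchy-schwarz (incidences ξ) (≡.subst (0 <_) (≡.sym (∑-incidences ξ)) (ℕₚ.≤-<-trans z≤n Q<P))) ⟩
        2 * (energy ξ * N)           ≡⟨ lem (energy ξ) N ⟩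
        (N ℕ.+ N) * energy ξ         ∎)
        where
        open ℕₚ.≤-Reasoning
        S : ℕ
        S = ∑ (incidences ξ)
        lem : ∀ e n → 2 * (e * n) ≡ (n ℕ.+ n) * e
        lem = solve-∀

      Represented : Carrier → Set _
      Represented y = ∃₂ λ u v → (u ≈ 0# ⊎ Power u) × Power v × y ≈ u + ξ · v

      represented : ∀ {y} → 0 < incidences ξ y → Represented y
      represented {y} 0<inc =
        let b , 0<line = ∑-positive 0<inc
            0<η , 0<α = factors (η b) _ 0<line
        in y - ξ · b , b , α-positive 0<α , η-positive 0<η , solve 2 (λ y t → y := (y :- t) :+ t) refl y (ξ · b)

      -- The represented elements and their mirror image under y ↦ t - y each fill more than half of
      -- the field, so they meet.
      two-represented : ∀ t → ∃₂ λ y z → Represented y × Represented z × t ≈ y + z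
      two-represented t =
        let y , 1<both = ∑-< {λ _ → 1} {λ y → σ y ℕ.+ σ (t - y)} (begin-strict
              ∑ (λ _ → 1)                        ≡⟨ ≡.trans (∑-const 1) (ℕₚ.*-identityʳ Q) ⟩
              Q                                  <⟨ Q<2N ⟩
              N ℕ.+ N                            ≡⟨ ≡.cong (N ℕ.+_) reflected ⟨
              N ℕ.+ ∑ (λ y → σ (t - y))          ≡⟨ ∑-+ _ _ ⟨
              ∑ (λ y → σ y ℕ.+ σ (t - y))        ∎)
            hy , hz = both (incidences ξ y) (incidences ξ (t - y)) 1<both
        in y , t - y , represented hy , represented hz , solve 2 (λ t y → t := y :+ (t :- y)) refl t y
        where
        open ℕₚ.≤-Reasoning
        σ : Carrier → ℕ
        σ = support (incidences ξ)
        reflected : ∑ (λ y → σ (t - y)) ≡ N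
        reflected = ∑-reindex (support-cong (incidences-cong refl)) (λ y → t - y) (λ y → t - y) (λ e → +-congˡ (-‿cong e)) (λ e → +-congˡ (-‿cong e))
          (λ y → solve 2 (λ t y → t :- (t :- y) := y) refl t y) (λ y → solve 2 (λ t y → t :- (t :- y) := y) refl t y)
        both : ∀ m n → 1 < 𝟙 (1 ℕ.≤? m) ℕ.+ 𝟙 (1 ℕ.≤? n) → 0 < m × 0 < n
        both (suc m) (suc n) _ = s≤s z≤n , s≤s z≤n
        both zero    n       h = ⊥-elim (ℕₚ.<⇒≱ h (𝟙≤1 (1 ℕ.≤? n)))
        both (suc m) zero    (s≤s ())

      -- More than Q pairs (a , b) compete for Q values a + ξ b. Two pairs of equal value differ in
      -- b, because the value and b determine a.
      collision : ∃₂ λ a a′ → ∃₂ λ b b′ → (a ≈ 0# ⊎ Power a) × (a′ ≈ 0# ⊎ Power a′) × Power b × Power b′ × ¬ (b ≈ b′) × a + ξ · b ≈ a′ + ξ · b′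
      collision =
        let y , 1<inc = ∑-< {λ _ → 1} {incidences ξ} (≡.subst₂ _<_ (≡.sym (≡.trans (∑-const 1) (ℕₚ.*-identityʳ Q))) (≡.sym (∑-incidences ξ)) Q<P)
            b , b′ , b≉b′ , hb , hb′ = two-distinct (λ b → bit-*≤1 (η-bit b) (α-bit _)) 1<inc
            0<η , 0<α = factors (η b) _ hb
            0<η′ , 0<α′ = factors (η b′) _ hb′
        in y - ξ · b , y - ξ · b′ , b , b′ , α-positive 0<α , α-positive 0<α′ , η-positive 0<η , η-positive 0<η′ , b≉b′
           , solve 3 (λ y t u → (y :- t) :+ t := (y :- u) :+ u) refl y (ξ · b) (ξ · b′)

    -- The characteristic is `suc p`, so p copies of h add up to -h.
    sop-neg : ∀ {h} → Power h → SumOfPowers p (- h)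
    sop-neg {h} ph = sop-resp (begin
      p ×ᴷ h                   ≈⟨ solve 2 (λ x h → x := (h :+ x) :- h) refl (p ×ᴷ h) h ⟩
      suc p ×ᴷ h - h           ≈⟨ +-congʳ (trans (×-congʳ (suc p) (sym (*-identityˡ h))) (sym (×-assoc-* (suc p) 1# h))) ⟩
      (suc p ×ᴷ 1#) · h - h    ≈⟨ +-congʳ (trans (*-congʳ p×1≈0) (zeroˡ h)) ⟩
      0# - h                   ≈⟨ +-identityˡ _ ⟩
      - h                      ∎) (sop-copies ph p)
      where
      open import Relation.Binary.Reasoning.Setoid setoid
      open import Algebra.Properties.Semiring.Mult semiring using (×-assoc-*)

    -- An exact number of summands: a vanishing product pair is written as 1 − 1.
    sop-difference : ∀ {b b′ u} → Power b → Power b′ → u ≈ 0# ⊎ Power u → SumOfPowers (suc p) (b · u - b′ · u)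
    sop-difference {b} {b′} {u} pb pb′ (inj₁ u≈0) = sop-resp (trans (-‿inverseʳ 1#) (sym (trans (+-cong (trans (*-congˡ u≈0) (zeroʳ b)) (-‿cong (trans (*-congˡ u≈0) (zeroʳ b′)))) (-‿inverseʳ 0#))))
      (cons Power-1 (sop-neg Power-1) refl)
    sop-difference pb pb′ (inj₂ pu) = cons (Power-* pb pu) (sop-neg (Power-* pb′ pu)) refl

    -- The number s depends on a alone and not on v and w, so that `all-sums` can fix the number of
    -- summands before t is known.
    sop-multiple : ∀ {a} → a ≈ 0# ⊎ Power a → ∃ λ s → s ≤ 2 × (∀ {v w} → Power v → Power w → SumOfPowers s (a · v + a · w))
    sop-multiple (inj₁ a≈0) = 0 , z≤n , λ _ _ → nil (trans (+-cong (trans (*-congʳ a≈0) (zeroˡ _)) (trans (*-congʳ a≈0) (zeroˡ _))) (+-identityˡ 0#))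
    sop-multiple (inj₂ pa)  = 2 , ℕₚ.≤-refl , λ pv pw → cons (Power-* pa pv) (cons (Power-* pa pw) (nil refl) (sym (+-identityʳ _))) refl

    sop-multiple⁻ : ∀ {a} → a ≈ 0# ⊎ Power a → ∃ λ s → s ≤ p ℕ.+ p × (∀ {v w} → Power v → Power w → SumOfPowers s (- (a · v) - a · w))
    sop-multiple⁻ (inj₁ a≈0) = 0 , z≤n , λ _ _ → nil (trans (+-cong (-‿cong (trans (*-congʳ a≈0) (zeroˡ _))) (-‿cong (trans (*-congʳ a≈0) (zeroˡ _)))) (trans (+-congʳ (sym (+-identityˡ _))) (trans (+-congʳ (-‿inverseʳ 0#)) (-‿inverseʳ 0#))))
    sop-multiple⁻ (inj₂ pa)  = p ℕ.+ p , ℕₚ.≤-refl , λ pv pw → sop-+ (sop-neg (Power-* pa pv)) (sop-neg (Power-* pa pw))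

    -- With δ = b′ - b the collision says δ ξ = a - a′, so δ (u + ξ v) = (b′ u - b u) + (a v - a′ v)
    -- is free of ξ. As δ is invertible, it is δ⁻¹ t that is split into two represented elements.
    -- The cost is two differences of p + 1 summands, at most 2 for the terms with a and at most 2 p
    -- for those with a′, together at most 4 (p + 1).
    all-sums : ∃ λ s → s ≤ 4 * suc p × (∀ t → SumOfPowers s t)
    all-sums =
      let ξ , low = low-energy
          a , a′ , b , b′ , ha , ha′ , pb , pb′ , b≉b′ , eq = collision ξ low
          s , s≤ , plus = sop-multiple ha
          s′ , s′≤ , minus = sop-multiple⁻ ha′
          d , δd≈1 = inverse (b′ - b) (λ e → b≉b′ (sym (x-y≈0⇒x≈y e)))
      in suc p ℕ.+ suc p ℕ.+ (s ℕ.+ s′)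
         , ℕₚ.≤-trans (ℕₚ.+-monoʳ-≤ (suc p ℕ.+ suc p) (ℕₚ.+-mono-≤ s≤ s′≤)) (ℕₚ.≤-reflexive (lem p))
         , λ t → let y , z , (u , v , hu , pv , y≈) , (u′ , v′ , hu′ , pv′ , z≈) , t≈ = two-represented ξ low (d · t)
                 in sop-resp (begin
                      b′ · u - b · u + (b′ · u′ - b · u′) + (a · v + a · v′ + (- (a′ · v) - a′ · v′))
                        ≈⟨ solve 8 (λ a a′ b b′ u u′ v v′ → b′ :* u :- b :* u :+ (b′ :* u′ :- b :* u′) :+ (a :* v :+ a :* v′ :+ (:- (a′ :* v) :- a′ :* v′)) := (b′ :- b) :* (u :+ u′) :+ (a :- a′) :* (v :+ v′)) refl a a′ b b′ u u′ v v′ ⟩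
                      (b′ - b) · (u + u′) + (a - a′) · (v + v′)
                        ≈⟨ +-congˡ (*-congʳ (slope a a′ b b′ ξ eq)) ⟩
                      (b′ - b) · (u + u′) + (b′ - b) · ξ · (v + v′)
                        ≈⟨ solve 6 (λ δ ξ u u′ v v′ → δ :* (u :+ u′) :+ δ :* ξ :* (v :+ v′) := δ :* ((u :+ ξ :* v) :+ (u′ :+ ξ :* v′))) refl (b′ - b) ξ u u′ v v′ ⟩
                      (b′ - b) · ((u + ξ · v) + (u′ + ξ · v′))
                        ≈⟨ *-congˡ (trans t≈ (+-cong y≈ z≈)) ⟨
                      (b′ - b) · (d · t)
                        ≈⟨ trans (sym (*-assoc _ _ _)) (trans (*-congʳ δd≈1) (*-identityˡ t)) ⟩
                      t ∎)
                    (sop-+ (sop-+ (sop-difference pb′ pb hu) (sop-difference pb′ pb hu′)) (sop-+ (plus pv pv′) (minus pv pv′)))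
      where
      open import Relation.Binary.Reasoning.Setoid setoid
      lem : ∀ p → suc p ℕ.+ suc p ℕ.+ (2 ℕ.+ (p ℕ.+ p)) ≡ 4 * suc p
      lem = solve-∀
      slope : ∀ a a′ b b′ ξ → a + ξ · b ≈ a′ + ξ · b′ → a - a′ ≈ (b′ - b) · ξ
      slope a a′ b b′ ξ eq = begin
        a - a′                                ≈⟨ solve 4 (λ a a′ b ξ → a :- a′ := (a :+ ξ :* b) :- a′ :- ξ :* b) refl a a′ b ξ ⟩
        (a + ξ · b) - a′ - ξ · b              ≈⟨ +-congʳ (+-congʳ eq) ⟩
        (a′ + ξ · b′) - a′ - ξ · b            ≈⟨ solve 4 (λ a′ b b′ ξ → (a′ :+ ξ :* b′) :- a′ :- ξ :* b := (b′ :- b) :* ξ) refl a′ b b′ ξ ⟩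
        (b′ - b) · ξ                          ∎

    sums-of-powers : ∀ s → 4 * suc p ≤ s → ∀ t → SumOfPowers s t
    sums-of-powers s 4p≤s t =
      let s₀ , s₀≤4p , sums = all-sums
          s₀≤s = ℕₚ.≤-trans s₀≤4p 4p≤s
          r = (s ℕ.∸ s₀) ×ᴷ 1#
      in ≡.subst (λ m → SumOfPowers m t) (ℕₚ.m+[n∸m]≡n s₀≤s)
           (sop-resp (solve 2 (λ t r → (t :- r) :+ r := t) refl t r) (sop-+ (sums (t - r)) (sop-copies Power-1 (s ℕ.∸ s₀))))

-- The ring of matrices; bordered matrices.

module MatrixRing {c ℓ} (F : Field c ℓ) where
  open Field F hiding (zero)
  open Matrices F public
  open RingSolver commutativeRing
  open import Algebra.Bundles using (Ring)
  open import Algebra.Properties.CommutativeSemigroup +-commutativeSemigroup using (interchange)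
  open import Relation.Binary.Reasoning.Setoid setoid

  Σᶠ-cong : ∀ {n} {f g : Fin n → Carrier} → (∀ i → f i ≈ g i) → Σᶠ f ≈ Σᶠ g
  Σᶠ-cong {zero}  h = refl
  Σᶠ-cong {suc n} h = +-cong (h zero) (Σᶠ-cong (h ∘ suc))

  Σᶠ-zero : ∀ {n} {f : Fin n → Carrier} → (∀ i → f i ≈ 0#) → Σᶠ f ≈ 0#
  Σᶠ-zero {zero}  h = refl
  Σᶠ-zero {suc n} h = trans (+-cong (h zero) (Σᶠ-zero (h ∘ suc))) (+-identityˡ 0#)

  Σᶠ-+ : ∀ {n} (f g : Fin n → Carrier) → Σᶠ (λ i → f i + g i) ≈ Σᶠ f + Σᶠ g
  Σᶠ-+ {zero}  f g = sym (+-identityˡ 0#)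
  Σᶠ-+ {suc n} f g = trans (+-congˡ (Σᶠ-+ (f ∘ suc) (g ∘ suc))) (interchange _ _ _ _)

  Σᶠ-*ˡ : ∀ {n} a (f : Fin n → Carrier) → Σᶠ (λ i → a * f i) ≈ a * Σᶠ f
  Σᶠ-*ˡ {zero}  a f = sym (zeroʳ a)
  Σᶠ-*ˡ {suc n} a f = trans (+-congˡ (Σᶠ-*ˡ a (f ∘ suc))) (sym (distribˡ _ _ _))

  Σᶠ-*ʳ : ∀ {n} a (f : Fin n → Carrier) → Σᶠ (λ i → f i * a) ≈ Σᶠ f * a
  Σᶠ-*ʳ a f = trans (Σᶠ-cong (λ i → *-comm (f i) a)) (trans (Σᶠ-*ˡ a f) (*-comm a _))

  Σᶠ-swap : ∀ {m n} (f : Fin m → Fin n → Carrier) → Σᶠ (λ i → Σᶠ (f i)) ≈ Σᶠ (λ j → Σᶠ (λ i → f i j))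
  Σᶠ-swap {zero}  {n} f = sym (Σᶠ-zero {n} (λ _ → refl))
  Σᶠ-swap {suc m} {n} f = trans (+-congˡ (Σᶠ-swap (f ∘ suc))) (sym (Σᶠ-+ {n} _ _))

  Iᴹ-suc : ∀ {n} (i j : Fin n) → Iᴹ (suc i) (suc j) ≡ Iᴹ i j
  Iᴹ-suc i j with i Fin.≟ j
  ... | yes _ = ≡.refl
  ... | no  _ = ≡.refl

  Iᴹ-sym : ∀ {n} (i j : Fin n) → Iᴹ i j ≡ Iᴹ j i
  Iᴹ-sym i j with i Fin.≟ j | j Fin.≟ i
  ... | yes _ | yes _ = ≡.refl
  ... | no  _ | no  _ = ≡.refl
  ... | yes e | no ne = ⊥-elim (ne (≡.sym e))
  ... | no ne | yes e = ⊥-elim (ne (≡.sym e))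

  Iᴹ-diagonal : ∀ {n} (i : Fin n) → Iᴹ i i ≡ 1#
  Iᴹ-diagonal i with i Fin.≟ i
  ... | yes _ = ≡.refl
  ... | no ne = ⊥-elim (ne ≡.refl)

  Iᴹ-off : ∀ {n} {i j : Fin n} → i ≢ j → Iᴹ i j ≡ 0#
  Iᴹ-off {i = i} {j} i≢j with i Fin.≟ j
  ... | yes e = ⊥-elim (i≢j e)
  ... | no _  = ≡.refl

  Σᶠ-Iˡ : ∀ {n} (i : Fin n) (v : Fin n → Carrier) → Σᶠ (λ t → Iᴹ i t * v t) ≈ v i
  Σᶠ-Iˡ {suc n} zero v = trans (+-cong (*-identityˡ _) (Σᶠ-zero {n} (λ t → zeroˡ _))) (+-identityʳ _)
  Σᶠ-Iˡ (suc i) v = trans (+-cong (zeroˡ _) (trans (Σᶠ-cong (λ t → *-congʳ (reflexive (Iᴹ-suc i t)))) (Σᶠ-Iˡ i (v ∘ suc)))) (+-identityˡ _)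

  Σᶠ-Iʳ : ∀ {n} (j : Fin n) (v : Fin n → Carrier) → Σᶠ (λ t → v t * Iᴹ t j) ≈ v j
  Σᶠ-Iʳ j v = trans (Σᶠ-cong (λ t → trans (*-comm _ _) (*-congʳ (reflexive (Iᴹ-sym t j))))) (Σᶠ-Iˡ j v)

  0ᴹ : ∀ {n} → Mat n
  0ᴹ i j = 0#

  -ᴹ_ : ∀ {n} → Mat n → Mat n
  (-ᴹ A) i j = - A i j

  *ᴹ-cong : ∀ {n} {A B C D : Mat n} → A ≈ᴹ B → C ≈ᴹ D → (A *ᴹ C) ≈ᴹ (B *ᴹ D)
  *ᴹ-cong h h′ i j = Σᶠ-cong (λ t → *-cong (h i t) (h′ t j))

  *ᴹ-assoc : ∀ {n} (A B C : Mat n) → ((A *ᴹ B) *ᴹ C) ≈ᴹ (A *ᴹ (B *ᴹ C))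
  *ᴹ-assoc {n} A B C i j = begin
    Σᶠ (λ t → Σᶠ (λ u → A i u * B u t) * C t j)     ≈⟨ Σᶠ-cong (λ t → Σᶠ-*ʳ {n} (C t j) _) ⟨
    Σᶠ (λ t → Σᶠ (λ u → A i u * B u t * C t j))     ≈⟨ Σᶠ-swap (λ t u → A i u * B u t * C t j) ⟩
    Σᶠ (λ u → Σᶠ (λ t → A i u * B u t * C t j))     ≈⟨ Σᶠ-cong {n} (λ u → Σᶠ-cong {n} (λ t → *-assoc _ _ _)) ⟩
    Σᶠ (λ u → Σᶠ (λ t → A i u * (B u t * C t j)))   ≈⟨ Σᶠ-cong {n} (λ u → Σᶠ-*ˡ {n} (A i u) _) ⟩
    Σᶠ (λ u → A i u * Σᶠ (λ t → B u t * C t j))     ∎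

  matrixRing : ℕ → Ring c ℓ
  matrixRing n = record
    { Carrier = Mat n
    ; _≈_ = _≈ᴹ_
    ; _+_ = _+ᴹ_
    ; _*_ = _*ᴹ_
    ; -_ = -ᴹ_
    ; 0# = 0ᴹ
    ; 1# = Iᴹ
    ; isRing = record
      { +-isAbelianGroup = record
        { isGroup = record
          { isMonoid = record
            { isSemigroup = record
              { isMagma = record
                { isEquivalence = record
                  { refl = λ i j → refl
                  ; sym = λ h i j → sym (h i j)
                  ; trans = λ h h′ i j → trans (h i j) (h′ i j)
                  }
                ; ∙-cong = λ h h′ i j → +-cong (h i j) (h′ i j)
                }
              ; assoc = λ A B C i j → +-assoc _ _ _
              }
            ; identity = (λ A i j → +-identityˡ _) , (λ A i j → +-identityʳ _)
            }
          ; inverse = (λ A i j → -‿inverseˡ _) , (λ A i j → -‿inverseʳ _)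
          ; ⁻¹-cong = λ h i j → -‿cong (h i j)
          }
        ; comm = λ A B i j → +-comm _ _
        }
      ; *-cong = *ᴹ-cong
      ; *-assoc = *ᴹ-assoc
      ; *-identity = (λ A i j → Σᶠ-Iˡ i (λ t → A t j)) , (λ A i j → Σᶠ-Iʳ j (A i))
      ; distrib = (λ A B C i j → trans (Σᶠ-cong {n} (λ t → distribˡ _ _ _)) (Σᶠ-+ {n} _ _))
                , (λ A B C i j → trans (Σᶠ-cong {n} (λ t → distribʳ _ _ _)) (Σᶠ-+ {n} _ _))
      }
    }

  module M {n : ℕ} = Ring (matrixRing n)

  scalar : ∀ {n} → Carrier → Mat n
  scalar a i j = a * Iᴹ i j

  scalar-*ˡ : ∀ {n} a (A : Mat n) → (scalar a *ᴹ A) ≈ᴹ (λ i j → a * A i j)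
  scalar-*ˡ {n} a A i j = trans (Σᶠ-cong {n} (λ t → *-assoc _ _ _)) (trans (Σᶠ-*ˡ {n} a _) (*-congˡ (Σᶠ-Iˡ i (λ t → A t j))))

  scalar-*ʳ : ∀ {n} a (A : Mat n) → (A *ᴹ scalar a) ≈ᴹ (λ i j → a * A i j)
  scalar-*ʳ {n} a A i j = trans (Σᶠ-cong (λ t → solve 3 (λ x a y → x :* (a :* y) := a :* (x :* y)) refl (A i t) a (Iᴹ t j))) (trans (Σᶠ-*ˡ {n} a _) (*-congˡ (Σᶠ-Iʳ j (A i))))

  scalar-central : ∀ {n} a (A : Mat n) → (scalar a *ᴹ A) ≈ᴹ (A *ᴹ scalar a)
  scalar-central a A = M.trans (scalar-*ˡ a A) (M.sym (scalar-*ʳ a A))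

  transpose : ∀ {n} → Mat n → Mat n
  transpose A i j = A j i

  transpose-* : ∀ {n} (A B : Mat n) → transpose (A *ᴹ B) ≈ᴹ (transpose B *ᴹ transpose A)
  transpose-* {n} A B i j = Σᶠ-cong {n} (λ t → *-comm _ _)

  transpose-I : ∀ {n} → transpose (Iᴹ {n}) ≈ᴹ Iᴹ
  transpose-I i j = reflexive (Iᴹ-sym j i)

  trace : ∀ {n} → Mat n → Carrier
  trace A = Σᶠ (λ i → A i i)

  trace-comm : ∀ {n} (A B : Mat n) → trace (A *ᴹ B) ≈ trace (B *ᴹ A)
  trace-comm {n} A B = trans (Σᶠ-swap {n} {n} (λ i t → A i t * B t i)) (Σᶠ-cong {n} (λ t → Σᶠ-cong {n} (λ i → *-comm _ _)))

  border : ∀ {n} → Carrier → (Fin n → Carrier) → (Fin n → Carrier) → Mat n → Mat (suc n)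
  border a r s A zero    zero    = a
  border a r s A zero    (suc j) = r j
  border a r s A (suc i) zero    = s i
  border a r s A (suc i) (suc j) = A i j

  minor : ∀ {n} → Mat (suc n) → Mat n
  minor A i j = A (suc i) (suc j)

  zeros : ∀ {n} → Fin n → Carrier
  zeros _ = 0#

  infixr 7 _·ᵛ_
  _·ᵛ_ : ∀ {m n} → (Fin m → Fin n → Carrier) → (Fin n → Carrier) → Fin m → Carrier
  (A ·ᵛ v) i = Σᶠ (λ t → A i t * v t)

  ·ᵛ-assoc : ∀ {n} (A B : Mat n) v i → ((A *ᴹ B) ·ᵛ v) i ≈ (A ·ᵛ B ·ᵛ v) i
  ·ᵛ-assoc {n} A B v i = begin
    Σᶠ (λ t → Σᶠ (λ u → A i u * B u t) * v t)     ≈⟨ Σᶠ-cong (λ t → Σᶠ-*ʳ {n} (v t) _) ⟨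
    Σᶠ (λ t → Σᶠ (λ u → A i u * B u t * v t))     ≈⟨ Σᶠ-swap (λ t u → A i u * B u t * v t) ⟩
    Σᶠ (λ u → Σᶠ (λ t → A i u * B u t * v t))     ≈⟨ Σᶠ-cong {n} (λ u → Σᶠ-cong {n} (λ t → *-assoc _ _ _)) ⟩
    Σᶠ (λ u → Σᶠ (λ t → A i u * (B u t * v t)))   ≈⟨ Σᶠ-cong {n} (λ u → Σᶠ-*ˡ {n} (A i u) _) ⟩
    Σᶠ (λ u → A i u * Σᶠ (λ t → B u t * v t))     ∎

  lower : ∀ {n} → Carrier → (Fin n → Carrier) → Mat n → Mat (suc n)
  lower a s A = border a zeros s A

  lower-* : ∀ {n} a s (A : Mat n) b t B → (lower a s A *ᴹ lower b t B) ≈ᴹ lower (a * b) (λ i → s i * b + (A ·ᵛ t) i) (A *ᴹ B)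
  lower-* {n} a s A b t B zero zero = trans (+-congˡ (Σᶠ-zero {n} (λ i → zeroˡ _))) (+-identityʳ _)
  lower-* {n} a s A b t B zero (suc j) = trans (+-cong (zeroʳ a) (Σᶠ-zero {n} (λ i → zeroˡ _))) (+-identityʳ _)
  lower-* a s A b t B (suc i) zero    = refl
  lower-* a s A b t B (suc i) (suc j) = trans (+-congʳ (zeroʳ _)) (+-identityˡ _)

  lower-cong : ∀ {n} {a b s t} {A B : Mat n} → a ≈ b → (∀ i → s i ≈ t i) → A ≈ᴹ B → lower a s A ≈ᴹ lower b t B
  lower-cong ha hs hA zero    zero    = ha
  lower-cong ha hs hA zero    (suc j) = refl
  lower-cong ha hs hA (suc i) zero    = hs i
  lower-cong ha hs hA (suc i) (suc j) = hA i j

  lower-I : ∀ {n} → lower 1# zeros (Iᴹ {n}) ≈ᴹ Iᴹ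
  lower-I zero    zero    = refl
  lower-I zero    (suc j) = refl
  lower-I (suc i) zero    = refl
  lower-I (suc i) (suc j) = reflexive (≡.sym (Iᴹ-suc i j))

-- Extracting k-th roots of bordered matrices.

module KthRoots {c ℓ} (F : Field c ℓ) (k : ℕ) where
  open Field F hiding (zero)
  open MatrixRing F
  open FieldProperties F
  open RingSolver commutativeRing

  -- The divided difference (μᵐ - αᵐ) / (μ - α) written without division, so that it also makes
  -- sense for μ = α, where it is m μ^(m - 1).
  geometric : ℕ → Carrier → Carrier → Carrier
  geometric zero    μ α = 0#
  geometric (suc m) μ α = μ ^ m + α * geometric m μ α

  -- The sum of μᵃ Rᵇ over a + b = m − 1.
  geometricᴹ : ∀ {n} → ℕ → Carrier → Mat n → Mat n
  geometricᴹ zero    μ R = 0ᴹ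
  geometricᴹ (suc m) μ R = scalar (μ ^ m) +ᴹ (R *ᴹ geometricᴹ m μ R)

  Invertible : ∀ {n} → Mat n → Set (c ⊔ ℓ)
  Invertible A = ∃ λ B → (A *ᴹ B) ≈ᴹ Iᴹ × (B *ᴹ A) ≈ᴹ Iᴹ

  Invertible-resp : ∀ {n} {A B : Mat n} → A ≈ᴹ B → Invertible A → Invertible B
  Invertible-resp h (C , e , e′) = C , M.trans (M.*-congʳ (M.sym h)) e , M.trans (M.*-congˡ (M.sym h)) e′

  geometricᴹ-comm : ∀ {n} m μ (R : Mat n) → (R *ᴹ geometricᴹ m μ R) ≈ᴹ (geometricᴹ m μ R *ᴹ R)
  geometricᴹ-comm zero    μ R = M.trans (M.zeroʳ R) (M.sym (M.zeroˡ R))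
  geometricᴹ-comm (suc m) μ R = M.trans (M.distribˡ R _ _) (M.trans (M.+-cong (M.sym (scalar-central (μ ^ m) R)) (M.trans (M.*-congˡ (geometricᴹ-comm m μ R)) (M.sym (M.*-assoc R _ R)))) (M.sym (M.distribʳ R _ _)))

  ^ᴹ-comm : ∀ {n} (A : Mat n) m → (A *ᴹ (A ^ᴹ m)) ≈ᴹ ((A ^ᴹ m) *ᴹ A)
  ^ᴹ-comm A zero    = M.trans (M.*-identityʳ A) (M.sym (M.*-identityˡ A))
  ^ᴹ-comm A (suc m) = M.trans (M.*-congˡ (^ᴹ-comm A m)) (M.sym (M.*-assoc A _ A))

  transpose-^ : ∀ {n} (A : Mat n) m → transpose (A ^ᴹ m) ≈ᴹ (transpose A ^ᴹ m)
  transpose-^ A zero    = transpose-I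
  transpose-^ A (suc m) = M.trans (transpose-* A _) (M.trans (M.*-congʳ (transpose-^ A m)) (M.sym (^ᴹ-comm (transpose A) m)))

  transpose-geometricᴹ : ∀ {n} m μ (R : Mat n) → transpose (geometricᴹ m μ R) ≈ᴹ geometricᴹ m μ (transpose R)
  transpose-geometricᴹ zero    μ R = M.refl
  transpose-geometricᴹ (suc m) μ R = M.+-cong (λ i j → *-congˡ (transpose-I i j)) (M.trans (transpose-* R _) (M.trans (M.*-congʳ (transpose-geometricᴹ m μ R)) (M.sym (geometricᴹ-comm m μ (transpose R)))))

  module Conjugation {n} (U V : Mat n) (UV≈I : (U *ᴹ V) ≈ᴹ Iᴹ) (VU≈I : (V *ᴹ U) ≈ᴹ Iᴹ) where

    conj : Mat n → Mat n
    conj A = (U *ᴹ A) *ᴹ V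

    conj-cong : ∀ {A B} → A ≈ᴹ B → conj A ≈ᴹ conj B
    conj-cong h = M.*-congʳ (M.*-congˡ h)

    conj-+ : ∀ A B → conj (A +ᴹ B) ≈ᴹ (conj A +ᴹ conj B)
    conj-+ A B = M.trans (M.*-congʳ (M.distribˡ U A B)) (M.distribʳ V _ _)

    conj-* : ∀ A B → conj (A *ᴹ B) ≈ᴹ (conj A *ᴹ conj B)
    conj-* A B = begin
      (U *ᴹ (A *ᴹ B)) *ᴹ V                  ≈⟨ M.*-congʳ (M.sym (M.*-assoc U A B)) ⟩
      ((U *ᴹ A) *ᴹ B) *ᴹ V                  ≈⟨ M.*-assoc _ B V ⟩
      (U *ᴹ A) *ᴹ (B *ᴹ V)                  ≈⟨ M.*-congˡ (M.trans (M.sym (M.*-identityˡ _)) (M.trans (M.*-congʳ (M.sym VU≈I)) (M.*-assoc V U _))) ⟩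
      (U *ᴹ A) *ᴹ (V *ᴹ (U *ᴹ (B *ᴹ V)))    ≈⟨ M.sym (M.*-assoc _ V _) ⟩
      ((U *ᴹ A) *ᴹ V) *ᴹ (U *ᴹ (B *ᴹ V))    ≈⟨ M.*-congˡ (M.sym (M.*-assoc U B V)) ⟩
      ((U *ᴹ A) *ᴹ V) *ᴹ ((U *ᴹ B) *ᴹ V)    ∎
      where open import Relation.Binary.Reasoning.Setoid (M.setoid {n})

    conj-scalar : ∀ a → conj (scalar a) ≈ᴹ scalar a
    conj-scalar a = M.trans (M.*-congʳ (M.sym (scalar-central a U))) (M.trans (M.*-assoc (scalar a) U V) (M.trans (M.*-congˡ UV≈I) (M.*-identityʳ _)))

    conj-I : conj Iᴹ ≈ᴹ Iᴹ
    conj-I = M.trans (M.*-congʳ (M.*-identityʳ U)) UV≈I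

    conj-^ : ∀ A m → conj (A ^ᴹ m) ≈ᴹ (conj A ^ᴹ m)
    conj-^ A zero    = conj-I
    conj-^ A (suc m) = M.trans (conj-* A _) (M.*-congˡ (conj-^ A m))

    conj-0 : conj 0ᴹ ≈ᴹ 0ᴹ
    conj-0 = M.trans (M.*-congʳ (M.zeroʳ U)) (M.zeroˡ V)

    conj-geometricᴹ : ∀ m μ R → conj (geometricᴹ m μ R) ≈ᴹ geometricᴹ m μ (conj R)
    conj-geometricᴹ zero    μ R = conj-0
    conj-geometricᴹ (suc m) μ R = M.trans (conj-+ _ _) (M.+-cong (conj-scalar (μ ^ m)) (M.trans (conj-* R _) (M.*-congˡ (conj-geometricᴹ m μ R))))

    conj-inverse : ∀ A → ((V *ᴹ conj A) *ᴹ U) ≈ᴹ A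
    conj-inverse A = begin
      (V *ᴹ ((U *ᴹ A) *ᴹ V)) *ᴹ U     ≈⟨ M.*-congʳ (M.sym (M.*-assoc V _ V)) ⟩
      ((V *ᴹ (U *ᴹ A)) *ᴹ V) *ᴹ U     ≈⟨ M.*-assoc _ V U ⟩
      (V *ᴹ (U *ᴹ A)) *ᴹ (V *ᴹ U)     ≈⟨ M.*-cong (M.trans (M.sym (M.*-assoc V U A)) (M.trans (M.*-congʳ VU≈I) (M.*-identityˡ A))) VU≈I ⟩
      A *ᴹ Iᴹ                         ≈⟨ M.*-identityʳ A ⟩
      A                               ∎
      where open import Relation.Binary.Reasoning.Setoid (M.setoid {n})

  module _ {Ω : Carrier → Set (c ⊔ ℓ)} (geometric≉0 : ∀ {μ α} → Ω μ → Ω α → ¬ (geometric k μ α ≈ 0#)) where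

    -- X has a k-th root R that remains extendable when X is bordered by a further
    -- eigenvalue μᵏ: the off-diagonal part of the root solves a linear system with
    -- matrix geometricᴹ k μ R.
    Rooted : ∀ {n} → Mat n → Set (c ⊔ ℓ)
    Rooted X = ∃ λ R → (R ^ᴹ k) ≈ᴹ X × (∀ {μ} → Ω μ → Invertible (geometricᴹ k μ R))

    Rooted-resp : ∀ {n} {X Y : Mat n} → X ≈ᴹ Y → Rooted X → Rooted Y
    Rooted-resp e (R , h , inv) = R , M.trans h e , inv

    Rooted-transpose : ∀ {n} {X : Mat n} → Rooted X → Rooted (transpose X)
    Rooted-transpose {X = X} (R , h , inv) = transpose R
      , M.trans (M.sym (transpose-^ R k)) (λ i j → h j i)
      , λ {μ} μ∈Ω → let B , e , e′ = inv μ∈Ω in Invertible-resp (transpose-geometricᴹ k μ R)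
          (transpose B , M.trans (M.sym (transpose-* B _)) (M.trans (λ i j → e′ j i) transpose-I)
                       , M.trans (M.sym (transpose-* _ B)) (M.trans (λ i j → e j i) transpose-I))

    Rooted-conj : ∀ {n} {X : Mat n} U V → (U *ᴹ V) ≈ᴹ Iᴹ → (V *ᴹ U) ≈ᴹ Iᴹ → Rooted X → Rooted ((U *ᴹ X) *ᴹ V)
    Rooted-conj U V UV≈I VU≈I (R , h , inv) = conj R , M.trans (M.sym (conj-^ R k)) (conj-cong h)
      , λ {μ} μ∈Ω → let B , e , e′ = inv μ∈Ω in Invertible-resp (conj-geometricᴹ k μ R)
          (conj B , M.trans (M.sym (conj-* _ B)) (M.trans (conj-cong e) conj-I) , M.trans (M.sym (conj-* B _)) (M.trans (conj-cong e′) conj-I))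
      where open Conjugation U V UV≈I VU≈I

    -- In the expanded power the column w is picked from one factor, with powers of R to its left
    -- and of α to its right; these terms add up to `geometricᴹ`.
    lower-^ : ∀ {n} α w (R : Mat n) m → (lower α w R ^ᴹ m) ≈ᴹ lower (α ^ m) (geometricᴹ m α R ·ᵛ w) (R ^ᴹ m)
    lower-^ {n} α w R zero = M.trans (M.sym lower-I) (lower-cong refl (λ i → sym (Σᶠ-zero {n} (λ t → zeroˡ _))) M.refl)
    lower-^ {n} α w R (suc m) = M.trans (M.*-congˡ {x = lower α w R} (lower-^ α w R m)) (M.trans (lower-* α w R (α ^ m) _ (R ^ᴹ m)) (lower-cong refl first-column M.refl))
      where
      open import Relation.Binary.Reasoning.Setoid setoid
      first-column : ∀ i → w i * α ^ m + (R ·ᵛ geometricᴹ m α R ·ᵛ w) i ≈ (geometricᴹ (suc m) α R ·ᵛ w) i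
      first-column i = begin
        w i * α ^ m + (R ·ᵛ geometricᴹ m α R ·ᵛ w) i
          ≈⟨ +-cong (trans (*-comm _ _) (*-congˡ (sym (Σᶠ-Iˡ i w)))) (sym (·ᵛ-assoc R (geometricᴹ m α R) w i)) ⟩
        α ^ m * Σᶠ (λ t → Iᴹ i t * w t) + ((R *ᴹ geometricᴹ m α R) ·ᵛ w) i
          ≈⟨ +-congʳ (trans (sym (Σᶠ-*ˡ {n} (α ^ m) _)) (Σᶠ-cong {n} (λ t → sym (*-assoc _ _ _)))) ⟩
        Σᶠ (λ t → scalar (α ^ m) i t * w t) + ((R *ᴹ geometricᴹ m α R) ·ᵛ w) i
          ≈⟨ trans (Σᶠ-cong {n} (λ t → distribʳ _ _ _)) (Σᶠ-+ {n} _ _) ⟨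
        (geometricᴹ (suc m) α R ·ᵛ w) i ∎

    -- The first column stays existential, since invertibility of a block triangular matrix depends
    -- on its diagonal blocks alone.
    lower-geometricᴹ : ∀ {n} α w (R : Mat n) m μ → ∃ λ x → geometricᴹ m μ (lower α w R) ≈ᴹ lower (geometric m μ α) x (geometricᴹ m μ R)
    lower-geometricᴹ α w R zero    μ = zeros , λ { zero zero → refl ; zero (suc j) → refl ; (suc i) zero → refl ; (suc i) (suc j) → refl }
    lower-geometricᴹ α w R (suc m) μ = let x , h = lower-geometricᴹ α w R m μ in
      _ , M.trans (M.+-cong M.refl (M.trans (M.*-congˡ {x = lower α w R} h) (lower-* α w R _ x _))) entries
      where
      entries : ∀ {y} → (scalar (μ ^ m) +ᴹ lower (α * geometric m μ α) y (R *ᴹ geometricᴹ m μ R)) ≈ᴹ lower (geometric (suc m) μ α) y (geometricᴹ (suc m) μ R)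
      entries zero    zero    = +-congʳ (*-identityʳ _)
      entries zero    (suc j) = trans (+-identityʳ _) (zeroʳ _)
      entries (suc i) zero    = trans (+-congʳ (zeroʳ _)) (+-identityˡ _)
      entries (suc i) (suc j) = +-congʳ (*-congˡ (reflexive (Iᴹ-suc i j)))

    lower-Invertible : ∀ {n} {a} x {A : Mat n} → ¬ (a ≈ 0#) → Invertible A → Invertible (lower a x A)
    lower-Invertible {n} {a} x {A} a≉0 (B , AB≈I , BA≈I) = let b , ab≈1 = inverse a a≉0 in
      lower b (λ i → - ((B ·ᵛ x) i * b)) B
      , M.trans (lower-* a x A b _ B) (M.trans (lower-cong ab≈1 (λ i → right b i) AB≈I) lower-I)
      , M.trans (lower-* b _ B a x A) (M.trans (lower-cong (trans (*-comm _ _) ab≈1) (λ i → left b i ab≈1) BA≈I) lower-I)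
      where
      open import Relation.Binary.Reasoning.Setoid setoid
      right : ∀ b i → x i * b + (A ·ᵛ (λ i → - ((B ·ᵛ x) i * b))) i ≈ 0#
      right b i = begin
        x i * b + Σᶠ (λ t → A i t * - ((B ·ᵛ x) t * b))   ≈⟨ +-congˡ (Σᶠ-cong (λ t → solve 3 (λ a y b → a :* :- (y :* b) := (a :* y) :* :- b) refl (A i t) ((B ·ᵛ x) t) b)) ⟩
        x i * b + Σᶠ (λ t → A i t * (B ·ᵛ x) t * - b)     ≈⟨ +-congˡ (Σᶠ-*ʳ {n} (- b) _) ⟩
        x i * b + (A ·ᵛ B ·ᵛ x) i * - b                   ≈⟨ +-congˡ (*-congʳ (trans (sym (·ᵛ-assoc A B x i)) (trans (Σᶠ-cong (λ t → *-congʳ (AB≈I i t))) (Σᶠ-Iˡ i x)))) ⟩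
        x i * b + x i * - b                               ≈⟨ solve 2 (λ x b → x :* b :+ x :* :- b := x :* (b :- b)) refl (x i) b ⟩
        x i * (b - b)                                     ≈⟨ trans (*-congˡ (-‿inverseʳ b)) (zeroʳ _) ⟩
        0#                                                ∎
      left : ∀ b i → a * b ≈ 1# → - ((B ·ᵛ x) i * b) * a + (B ·ᵛ x) i ≈ 0#
      left b i ab≈1 = begin
        - ((B ·ᵛ x) i * b) * a + (B ·ᵛ x) i      ≈⟨ +-congʳ (solve 3 (λ y b a → :- (y :* b) :* a := :- (y :* (a :* b))) refl ((B ·ᵛ x) i) b a) ⟩
        - ((B ·ᵛ x) i * (a * b)) + (B ·ᵛ x) i    ≈⟨ +-congʳ (-‿cong (trans (*-congˡ ab≈1) (*-identityʳ _))) ⟩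
        - (B ·ᵛ x) i + (B ·ᵛ x) i                ≈⟨ -‿inverseˡ _ ⟩
        0#                                       ∎

    -- By `lower-^` the new column of the root has to solve a linear system with matrix
    -- `geometricᴹ k ω R`, invertible by assumption on R. The larger root remains extendable because
    -- the new diagonal entry of its own system is `geometric k μ ω`, which is nonzero.
    Rooted-lower : ∀ {n} {a} s {X : Mat n} → (∃ λ ω → Ω ω × ω ^ k ≈ a) → Rooted X → Rooted (lower a s X)
    Rooted-lower s (ω , ω∈Ω , ω^k≈a) (R , h , inv) = let B , GB≈I , BG≈I = inv ω∈Ω in
      lower ω (B ·ᵛ s) R
      , M.trans (lower-^ ω (B ·ᵛ s) R k) (lower-cong ω^k≈a (λ i → trans (sym (·ᵛ-assoc (geometricᴹ k ω R) B s i)) (trans (Σᶠ-cong (λ t → *-congʳ (GB≈I i t))) (Σᶠ-Iˡ i s))) h)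
      , λ {μ} μ∈Ω → let x , e = lower-geometricᴹ ω (B ·ᵛ s) R k μ in
          Invertible-resp (M.sym e) (lower-Invertible x (geometric≉0 μ∈Ω ω∈Ω) (inv μ∈Ω))

    Rooted-upper : ∀ {n} {a} r {X : Mat n} → (∃ λ ω → Ω ω × ω ^ k ≈ a) → Rooted X → Rooted (border a r zeros X)
    Rooted-upper r ha hX = Rooted-resp (λ { zero zero → refl ; zero (suc j) → refl ; (suc i) zero → refl ; (suc i) (suc j) → refl })
      (Rooted-transpose (Rooted-lower r ha (Rooted-transpose hX)))

    Rooted-empty : (X : Mat 0) → Rooted X
    Rooted-empty X = (λ ()) , (λ ()) , λ _ → (λ ()) , (λ ()) , (λ ())

-- Similarity and conjugation by elementary matrices.

module Similarity {c ℓ} (F : Field c ℓ) where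
  open Field F hiding (zero)
  open MatrixRing F

  infix 4 _∼_
  record _∼_ {n} (A B : Mat n) : Set (c ⊔ ℓ) where
    field
      U V : Mat n
      UV≈I : (U *ᴹ V) ≈ᴹ Iᴹ
      VU≈I : (V *ᴹ U) ≈ᴹ Iᴹ
      conjugate : ((U *ᴹ A) *ᴹ V) ≈ᴹ B

  ∼-refl : ∀ {n} {A : Mat n} → A ∼ A
  ∼-refl {A = A} = record { U = Iᴹ ; V = Iᴹ ; UV≈I = M.*-identityˡ Iᴹ ; VU≈I = M.*-identityˡ Iᴹ ; conjugate = M.trans (M.*-identityʳ _) (M.*-identityˡ A) }

  ∼-trans : ∀ {n} {A B C : Mat n} → A ∼ B → B ∼ C → A ∼ C
  ∼-trans {n} {A} {B} {C} p q = record
    { U = Q.U *ᴹ P.U ; V = P.V *ᴹ Q.V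
    ; UV≈I = inner Q.U P.U P.V Q.V P.UV≈I Q.UV≈I
    ; VU≈I = inner P.V Q.V Q.U P.U Q.VU≈I P.VU≈I
    ; conjugate = begin
        ((Q.U *ᴹ P.U) *ᴹ A) *ᴹ (P.V *ᴹ Q.V)   ≈⟨ M.*-congʳ (M.*-assoc Q.U P.U A) ⟩
        (Q.U *ᴹ (P.U *ᴹ A)) *ᴹ (P.V *ᴹ Q.V)   ≈⟨ M.*-assoc Q.U _ _ ⟩
        Q.U *ᴹ ((P.U *ᴹ A) *ᴹ (P.V *ᴹ Q.V))   ≈⟨ M.*-congˡ (M.*-assoc _ P.V Q.V) ⟨
        Q.U *ᴹ (((P.U *ᴹ A) *ᴹ P.V) *ᴹ Q.V)   ≈⟨ M.*-congˡ (M.*-congʳ P.conjugate) ⟩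
        Q.U *ᴹ (B *ᴹ Q.V)                     ≈⟨ M.*-assoc Q.U B Q.V ⟨
        (Q.U *ᴹ B) *ᴹ Q.V                     ≈⟨ Q.conjugate ⟩
        C                                     ∎
    }
    where
    module P = _∼_ p
    module Q = _∼_ q
    open import Relation.Binary.Reasoning.Setoid (M.setoid {n})
    inner : ∀ (A B C D : Mat n) → (B *ᴹ C) ≈ᴹ Iᴹ → (A *ᴹ D) ≈ᴹ Iᴹ → ((A *ᴹ B) *ᴹ (C *ᴹ D)) ≈ᴹ Iᴹ
    inner A B C D BC AD = M.trans (M.*-assoc A B _) (M.trans (M.*-congˡ (M.trans (M.sym (M.*-assoc B C D)) (M.trans (M.*-congʳ BC) (M.*-identityˡ D)))) AD)

  trace-∼ : ∀ {n} {A B : Mat n} → A ∼ B → trace A ≈ trace B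
  trace-∼ {A = A} {B} p = trans (Σᶠ-cong (λ i → M.sym (M.trans (M.*-congʳ VU≈I) (M.*-identityˡ A)) i i))
    (trans (Σᶠ-cong (λ i → M.*-assoc V U A i i)) (trans (trace-comm V (U *ᴹ A)) (Σᶠ-cong (λ i → conjugate i i))))
    where open _∼_ p

  elementary-inverse : ∀ {n} (u v : Fin n → Carrier) → (∀ i → u i + v i ≈ 0#) → (lower 1# u Iᴹ *ᴹ lower 1# v Iᴹ) ≈ᴹ Iᴹ
  elementary-inverse u v h = M.trans (lower-* 1# u Iᴹ 1# v Iᴹ) (M.trans (lower-cong (*-identityˡ 1#) (λ i → trans (+-cong (*-identityʳ _) (Σᶠ-Iˡ i v)) (h i)) (M.*-identityˡ Iᴹ)) lower-I)

  module LowerElementary {n} (u : Fin n → Carrier) (A : Mat (suc n)) where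
    B : Mat (suc n)
    B = (lower 1# (λ i → - u i) Iᴹ *ᴹ A) *ᴹ lower 1# u Iᴹ

    similar : A ∼ B
    similar = record { U = lower 1# (λ i → - u i) Iᴹ ; V = lower 1# u Iᴹ ; UV≈I = elementary-inverse (λ i → - u i) u (λ i → -‿inverseˡ _) ; VU≈I = elementary-inverse u (λ i → - u i) (λ i → -‿inverseʳ _) ; conjugate = M.refl }

    private
      left : ∀ i j → (lower 1# (λ i → - u i) Iᴹ *ᴹ A) (suc i) j ≈ - u i * A zero j + A (suc i) j
      left i j = +-congˡ (Σᶠ-Iˡ i (λ t → A (suc t) j))

    first-column : ∀ i → B (suc i) zero ≈ (- u i * A zero zero + A (suc i) zero) + Σᶠ (λ t → (- u i * A zero (suc t) + A (suc i) (suc t)) * u t)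
    first-column i = +-cong (trans (*-identityʳ _) (left i zero)) (Σᶠ-cong (λ t → *-congʳ (left i (suc t))))

  module UpperElementary {n} (w : Fin n → Carrier) (A : Mat (suc n)) where
    private
      U V : Mat (suc n)
      U = transpose (lower 1# (λ i → - w i) Iᴹ)
      V = transpose (lower 1# w Iᴹ)

    B : Mat (suc n)
    B = (U *ᴹ A) *ᴹ V

    similar : A ∼ B
    similar = record
      { U = U ; V = V
      ; UV≈I = M.trans (M.sym (transpose-* (lower 1# w Iᴹ) (lower 1# (λ i → - w i) Iᴹ))) (M.trans (λ i j → elementary-inverse w (λ i → - w i) (λ i → -‿inverseʳ _) j i) transpose-I)
      ; VU≈I = M.trans (M.sym (transpose-* (lower 1# (λ i → - w i) Iᴹ) (lower 1# w Iᴹ))) (M.trans (λ i j → elementary-inverse (λ i → - w i) w (λ i → -‿inverseˡ _) j i) transpose-I)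
      ; conjugate = M.refl }

    private
      left : ∀ i j → (U *ᴹ A) (suc i) j ≈ A (suc i) j
      left i j = trans (+-cong (zeroˡ _) (trans (Σᶠ-cong (λ t → *-congʳ (reflexive (Iᴹ-sym t i)))) (Σᶠ-Iˡ i (λ t → A (suc t) j)))) (+-identityˡ _)

    corner : B zero zero ≈ A zero zero + Σᶠ (λ t → - w t * A (suc t) zero)
    corner = trans (+-cong (trans (*-identityʳ _) (+-congʳ (*-identityˡ _))) (Σᶠ-zero {n} (λ t → zeroʳ _))) (+-identityʳ _)

    entry : ∀ i j → B (suc i) (suc j) ≈ A (suc i) zero * w j + A (suc i) (suc j)
    entry i j = +-cong (*-congʳ (left i zero)) (trans (Σᶠ-cong (λ t → *-cong (left i (suc t)) (reflexive (Iᴹ-sym j t)))) (Σᶠ-Iʳ j (λ t → A (suc i) (suc t))))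

-- Non-scalar matrices: prescribed diagonals and triangular splittings.

module NonScalar {c ℓ} (F : Field c ℓ) (≟0 : ∀ x → Dec (Field._≈_ F x (Field.0# F)))
                 (2≉0 : ¬ (Field._≈_ F (Field._+_ F (Field.1# F) (Field.1# F)) (Field.0# F))) where
  open Field F hiding (zero)
  open MatrixRing F
  open Similarity F
  open FieldProperties F
  open RingSolver commutativeRing
  open import Relation.Binary.Reasoning.Setoid setoid

  Scalar : ∀ {n} → Mat (suc n) → Set ℓ
  Scalar A = ∀ i j → A i j ≈ scalar (A zero zero) i j

  scalar? : ∀ {n} (A : Mat (suc n)) → Dec (Scalar A)
  scalar? A = Finₚ.all? (λ i → Finₚ.all? (λ j → map′ x-y≈0⇒x≈y x≈y⇒x-y≈0 (≟0 (A i j - scalar (A zero zero) i j))))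

  private
    -- Entry (1 + i , 0) of A conjugated by the elementary matrix 1 + x e₍₁₊ⱼ,₀₎.
    shifted : ∀ {n} → Mat (suc n) → Carrier → Fin n → Fin n → Carrier
    shifted A x i j = A (suc i) zero - x * Iᴹ j i * A zero zero + x * (A (suc i) (suc j) - x * Iᴹ j i * A zero (suc j))

    shifted-column : ∀ {n} (A : Mat (suc n)) x i j → LowerElementary.B (λ t → x * Iᴹ j t) A (suc i) zero ≈ shifted A x i j
    shifted-column {n} A x i j = begin
      LowerElementary.B (λ t → x * Iᴹ j t) A (suc i) zero
        ≈⟨ LowerElementary.first-column (λ t → x * Iᴹ j t) A i ⟩
      (- δ * A zero zero + A (suc i) zero) + Σᶠ (λ t → (- δ * A zero (suc t) + A (suc i) (suc t)) * (x * Iᴹ j t))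
        ≈⟨ +-congˡ (trans (Σᶠ-cong {n} (λ t → solve 3 (λ y x i → y :* (x :* i) := x :* (i :* y)) refl (- δ * A zero (suc t) + A (suc i) (suc t)) x (Iᴹ j t))) (trans (Σᶠ-*ˡ {n} x _) (*-congˡ (Σᶠ-Iˡ j (λ t → - δ * A zero (suc t) + A (suc i) (suc t)))))) ⟩
      (- δ * A zero zero + A (suc i) zero) + x * (- δ * A zero (suc j) + A (suc i) (suc j))
        ≈⟨ solve 6 (λ δ m s x r a → (:- δ :* m :+ s) :+ x :* (:- δ :* r :+ a) := s :- δ :* m :+ x :* (a :- δ :* r)) refl δ (A zero zero) (A (suc i) zero) x (A zero (suc j)) (A (suc i) (suc j)) ⟩
      shifted A x i j ∎
      where
      δ : Carrier
      δ = x * Iᴹ j i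

    2# : Carrier
    2# = 1# + 1#

  -- The conjugated first column vanishes below the corner exactly when e₀ + x eⱼ is an eigenvector.
  -- If this held for x = 0, 1, 2 and every j, then comparing x = 1 with x = 2 would clear the first
  -- row off the corner, and A would be scalar. Cancelling the factor x = 2 uses that 2 is nonzero.
  nonzero-column : ∀ {n} (A : Mat (suc n)) → ¬ Scalar A → ∃ λ B → A ∼ B × ∃ λ i → ¬ (B (suc i) zero ≈ 0#)
  nonzero-column A ¬scalar
    with Finₚ.any? (λ i → ¬? (≟0 (A (suc i) zero)))
       | Finₚ.any? (λ i → Finₚ.any? (λ j → ¬? (≟0 (shifted A 1# i j))))
       | Finₚ.any? (λ i → Finₚ.any? (λ j → ¬? (≟0 (shifted A 2# i j))))
  ... | yes (i , ne) | _ | _ = A , ∼-refl , i , ne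
  ... | no _ | yes (i , j , ne) | _ = _ , LowerElementary.similar (λ t → 1# * Iᴹ j t) A , i , λ e → ne (trans (sym (shifted-column A 1# i j)) e)
  ... | no _ | no _ | yes (i , j , ne) = _ , LowerElementary.similar (λ t → 2# * Iᴹ j t) A , i , λ e → ne (trans (sym (shifted-column A 2# i j)) e)
  ... | no ∄₀ | no ∄₁ | no ∄₂ = ⊥-elim (¬scalar entries)
    where
    stable : ∀ {x} → ¬ ¬ (x ≈ 0#) → x ≈ 0#
    stable {x} h with ≟0 x
    ... | yes e = e
    ... | no ne = ⊥-elim (h ne)
    m : Carrier
    m = A zero zero
    column : ∀ i → A (suc i) zero ≈ 0#
    column i = stable (λ ne → ∄₀ (i , ne))
    shift₁ : ∀ i j → shifted A 1# i j ≈ 0#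
    shift₁ i j = stable (λ ne → ∄₁ (i , j , ne))
    shift₂ : ∀ i j → shifted A 2# i j ≈ 0#
    shift₂ i j = stable (λ ne → ∄₂ (i , j , ne))
    simplify : ∀ x i j → shifted A x i j ≈ x * (A (suc i) (suc j) - Iᴹ j i * (m + x * A zero (suc j)))
    simplify x i j = trans (+-congʳ (+-congʳ (column i))) (trans (+-congʳ (+-identityˡ _)) (solve 5 (λ x δ m a r → :- (x :* δ :* m) :+ x :* (a :- x :* δ :* r) := x :* (a :- δ :* (m :+ x :* r))) refl x (Iᴹ j i) m (A (suc i) (suc j)) (A zero (suc j))))
    row₁ : ∀ i j → A (suc i) (suc j) ≈ Iᴹ j i * (m + 1# * A zero (suc j))
    row₁ i j = x-y≈0⇒x≈y (xy≈0⇒y≈0 1≉0 (trans (sym (simplify 1# i j)) (shift₁ i j)))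
    row₂ : ∀ i j → A (suc i) (suc j) ≈ Iᴹ j i * (m + 2# * A zero (suc j))
    row₂ i j = x-y≈0⇒x≈y (xy≈0⇒y≈0 2≉0 (trans (sym (simplify 2# i j)) (shift₂ i j)))
    top : ∀ j → A zero (suc j) ≈ 0#
    top j = begin
      r                                ≈⟨ *-identityˡ r ⟨
      1# * r                           ≈⟨ solve 3 (λ o m r → o :* r := (m :+ (o :+ o) :* r) :- (m :+ o :* r)) refl 1# m r ⟩
      (m + 2# * r) - (m + 1# * r)      ≈⟨ +-cong (*-identityˡ _) (-‿cong (*-identityˡ _)) ⟨
      1# * (m + 2# * r) - 1# * (m + 1# * r) ≈⟨ x≈y⇒x-y≈0 (trans (*-congʳ (reflexive (≡.sym (Iᴹ-diagonal j)))) (trans (trans (sym (row₂ j j)) (row₁ j j)) (*-congʳ (reflexive (Iᴹ-diagonal j))))) ⟩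
      0#                               ∎
      where
      r : Carrier
      r = A zero (suc j)
    entries : Scalar A
    entries zero    zero    = sym (*-identityʳ _)
    entries zero    (suc j) = trans (top j) (sym (zeroʳ _))
    entries (suc i) zero    = trans (column i) (sym (zeroʳ _))
    entries (suc i) (suc j) = begin
      A (suc i) (suc j)                      ≈⟨ row₁ i j ⟩
      Iᴹ j i * (m + 1# * A zero (suc j))     ≈⟨ *-cong (reflexive (≡.trans (Iᴹ-sym j i) (≡.sym (Iᴹ-suc i j)))) (trans (+-congˡ (trans (*-congˡ (top j)) (zeroʳ _))) (+-identityʳ _)) ⟩
      Iᴹ (suc i) (suc j) * m                 ≈⟨ *-comm _ _ ⟩
      scalar m (suc i) (suc j)               ∎

  another : ∀ {n} (i : Fin (suc (suc n))) → ∃ λ j → i ≢ j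
  another zero    = suc zero , λ ()
  another (suc i) = zero , λ ()

  private
    -- Pairs to x sᵢ with the first column s, whatever y is.
    functional : ∀ {n} → Mat (suc n) → Carrier → Carrier → (i j : Fin n) → Fin n → Carrier
    functional A x y i j t = x * Iᴹ i t + y * (A (suc j) zero * Iᴹ i t - A (suc i) zero * Iᴹ j t)

    functional-corner : ∀ {n} (A : Mat (suc n)) x y i j → UpperElementary.B (functional A x y i j) A zero zero ≈ A zero zero - x * A (suc i) zero
    functional-corner {n} A x y i j = begin
      UpperElementary.B (functional A x y i j) A zero zero
        ≈⟨ UpperElementary.corner (functional A x y i j) A ⟩
      m + Σᶠ (λ t → - functional A x y i j t * s t)
        ≈⟨ +-congˡ (Σᶠ-cong (λ t → solve 7 (λ x y a b e f s → :- (x :* e :+ y :* (b :* e :- a :* f)) :* s := (:- (x :+ y :* b)) :* (e :* s) :+ (y :* a) :* (f :* s)) refl x y (s i) (s j) (Iᴹ i t) (Iᴹ j t) (s t))) ⟩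
      m + Σᶠ (λ t → - (x + y * s j) * (Iᴹ i t * s t) + y * s i * (Iᴹ j t * s t))
        ≈⟨ +-congˡ (trans (Σᶠ-+ {n} _ _) (+-cong (trans (Σᶠ-*ˡ {n} _ _) (*-congˡ (Σᶠ-Iˡ i s))) (trans (Σᶠ-*ˡ {n} _ _) (*-congˡ (Σᶠ-Iˡ j s))))) ⟩
      m + (- (x + y * s j) * s i + y * s i * s j)
        ≈⟨ solve 5 (λ m x y a b → m :+ (:- (x :+ y :* b) :* a :+ y :* a :* b) := m :- x :* a) refl m x y (s i) (s j) ⟩
      m - x * s i ∎
      where
      m : Carrier
      m = A zero zero
      s : Fin _ → Carrier
      s t = A (suc t) zero

    -- The parameter y moves this off-diagonal entry while the corner stays put, so it can destroy
    -- an accidentally scalar minor.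
    functional-entry : ∀ {n} (A : Mat (suc n)) x i j → i ≢ j →
      UpperElementary.B (functional A x 1# i j) A (suc i) (suc j) ≈ UpperElementary.B (functional A x 0# i j) A (suc i) (suc j) - A (suc i) zero * A (suc i) zero
    functional-entry A x i j i≢j = begin
      UpperElementary.B (functional A x 1# i j) A (suc i) (suc j)
        ≈⟨ UpperElementary.entry (functional A x 1# i j) A i j ⟩
      s i * (x * e + 1# * (s j * e - s i * Iᴹ j j)) + a
        ≈⟨ +-congʳ (*-congˡ (+-congˡ (trans (*-identityˡ _) (+-cong (trans (*-congˡ e≈0) (zeroʳ _)) (-‿cong (trans (*-congˡ (reflexive (Iᴹ-diagonal j))) (*-identityʳ _))))))) ⟩
      s i * (x * e + (0# - s i)) + a
        ≈⟨ solve 5 (λ s x e a z → s :* (x :* e :+ (z :- s)) :+ a := s :* (x :* e :+ z) :+ a :- s :* s) refl (s i) x e a 0# ⟩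
      s i * (x * e + 0#) + a - s i * s i
        ≈⟨ +-congʳ (+-congʳ (*-congˡ (+-congˡ (zeroˡ _)))) ⟨
      s i * (x * e + 0# * (s j * e - s i * Iᴹ j j)) + a - s i * s i
        ≈⟨ +-congʳ (UpperElementary.entry (functional A x 0# i j) A i j) ⟨
      UpperElementary.B (functional A x 0# i j) A (suc i) (suc j) - s i * s i ∎
      where
      s : Fin _ → Carrier
      s t = A (suc t) zero
      a e : Carrier
      a = A (suc i) (suc j)
      e = Iᴹ i j
      e≈0 : e ≈ 0#
      e≈0 = reflexive (Iᴹ-off i≢j)

  -- The choice x = (m - d) / sᵢ sends the corner m to d. If the minor is scalar for y = 0, it is
  -- not so for y = 1, as its (i , j) entries in the two cases differ by sᵢ² ≠ 0. A 1 × 1 minor is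
  -- always scalar, hence the alternative n = 0.
  prescribed-corner′ : ∀ {n} (A : Mat (suc (suc n))) i → ¬ (A (suc i) zero ≈ 0#) → ∀ d → ∃ λ B → A ∼ B × B zero zero ≈ d × (n ≡ 0 ⊎ ¬ Scalar (minor B))
  prescribed-corner′ {zero} A i sᵢ≉0 d = let w = functional A ((A zero zero - d) * proj₁ (inverse _ sᵢ≉0)) 0# i i in
    UpperElementary.B w A , UpperElementary.similar w A , trans (functional-corner A _ 0# i i) (corner-value (proj₂ (inverse _ sᵢ≉0))) , inj₁ ≡.refl
    where
    corner-value : ∀ {m s s⁻¹} → s * s⁻¹ ≈ 1# → m - (m - d) * s⁻¹ * s ≈ d
    corner-value {m} {s} {s⁻¹} e = trans (+-congˡ (-‿cong (trans (trans (*-assoc _ _ _) (*-congˡ (trans (*-comm _ _) e))) (*-identityʳ _)))) (solve 2 (λ m d → m :- (m :- d) := d) refl m d)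
  prescribed-corner′ {suc n} A i sᵢ≉0 d = result (scalar? (minor (B 0#)))
    where
    j : Fin (suc (suc n))
    j = proj₁ (another i)
    x : Carrier
    x = (A zero zero - d) * proj₁ (inverse _ sᵢ≉0)
    B : Carrier → Mat (suc (suc (suc n)))
    B y = UpperElementary.B (functional A x y i j) A
    corner-value : ∀ y → B y zero zero ≈ d
    corner-value y = trans (functional-corner A x y i j) (trans (+-congˡ (-‿cong (trans (trans (*-assoc _ _ _) (*-congˡ (trans (*-comm _ _) (proj₂ (inverse _ sᵢ≉0))))) (*-identityʳ _)))) (solve 2 (λ m d → m :- (m :- d) := d) refl (A zero zero) d))
    result : Dec (Scalar (minor (B 0#))) → _
    result (no ¬scalar) = B 0# , UpperElementary.similar _ A , corner-value 0# , inj₂ ¬scalar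
    result (yes scalar₀) = B 1# , UpperElementary.similar _ A , corner-value 1# , inj₂ λ scalar₁ → xy≉0 sᵢ≉0 sᵢ≉0 (begin
      sᵢ * sᵢ                                     ≈⟨ solve 2 (λ b t → t := b :- (b :- t)) refl (B 0# (suc i) (suc j)) (sᵢ * sᵢ) ⟩
      b₀ - (b₀ - sᵢ * sᵢ)                         ≈⟨ +-congˡ (-‿cong (functional-entry A x i j (proj₂ (another i)))) ⟨
      b₀ - B 1# (suc i) (suc j)                   ≈⟨ x≈y⇒x-y≈0 (trans (off-diagonal scalar₀) (sym (off-diagonal scalar₁))) ⟩
      0#                                          ∎)
      where
      sᵢ b₀ : Carrier
      sᵢ = A (suc i) zero
      b₀ = B 0# (suc i) (suc j)
      off-diagonal : ∀ {C : Mat (suc (suc n))} → Scalar C → C i j ≈ 0#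
      off-diagonal h = trans (h i j) (trans (*-congˡ (reflexive (Iᴹ-off (proj₂ (another i))))) (zeroʳ _))

  prescribed-corner : ∀ {n} (A : Mat (suc (suc n))) → ¬ Scalar A → ∀ d → ∃ λ B → A ∼ B × B zero zero ≈ d × (n ≡ 0 ⊎ ¬ Scalar (minor B))
  prescribed-corner A₀ ¬scalar d =
    let A , A₀∼A , i , sᵢ≉0 = nonzero-column A₀ ¬scalar
        B , A∼B , rest = prescribed-corner′ A i sᵢ≉0 d
    in B , ∼-trans A₀∼A A∼B , rest

  module Decomposition (k : ℕ) {Ω : Carrier → Set (c ⊔ ℓ)} (geometric≉0 : ∀ {μ α} → Ω μ → Ω α → ¬ (KthRoots.geometric F k k μ α ≈ 0#))
           {S : ℕ → Carrier → Set (c ⊔ ℓ)} (S-resp : ∀ {s t u} → t ≈ u → S s t → S s u)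
           (S-zero : ∀ {t} → S 0 t → t ≈ 0#)
           (uncons : ∀ {s t} → S (suc s) t → ∃₂ λ h u → (∃ λ ω → Ω ω × ω ^ k ≈ h) × S s u × t ≈ h + u) where
    open KthRoots F k

    Root : Carrier → Set _
    Root h = ∃ λ ω → Ω ω × ω ^ k ≈ h

    Splits : ∀ {n} → Mat n → Set (c ⊔ ℓ)
    Splits A = ∃₂ λ X Y → Rooted geometric≉0 X × Rooted geometric≉0 Y × (X +ᴹ Y) ≈ᴹ A

    uncons₂ : ∀ {s t} → S (suc (suc s)) t → ∃₂ λ a b → Root a × Root b × S s (t - (a + b))
    uncons₂ {s} {t} h =
      let a , u , a-root , h′ , t≈ = uncons h
          b , v , b-root , h″ , u≈ = uncons h′
      in a , b , a-root , b-root , S-resp (sym (trans (+-congʳ (trans t≈ (+-congˡ u≈))) (solve 3 (λ a b v → (a :+ (b :+ v)) :- (a :+ b) := v) refl a b v))) h″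

    -- One summand takes the first column with it and the other the first row, so only the corner
    -- and the minor impose conditions.
    splits-border : ∀ {n} (A : Mat (suc n)) {a b} → Root a → Root b → A zero zero ≈ a + b → Splits (minor A) → Splits A
    splits-border A a-root b-root e (X , Y , hX , hY , X+Y≈) =
      _ , _ , Rooted-lower geometric≉0 (λ i → A (suc i) zero) a-root hX , Rooted-upper geometric≉0 (λ j → A zero (suc j)) b-root hY
      , λ { zero zero → sym e ; zero (suc j) → +-identityˡ _ ; (suc i) zero → +-identityʳ _ ; (suc i) (suc j) → X+Y≈ i j }

    splits-∼ : ∀ {n} {A B : Mat n} → A ∼ B → Splits B → Splits A
    splits-∼ {A = A} {B} A∼B (X , Y , hX , hY , X+Y≈) =
      _ , _ , Rooted-conj geometric≉0 V U VU≈I UV≈I hX , Rooted-conj geometric≉0 V U VU≈I UV≈I hY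
      , M.trans (M.sym (C.conj-+ X Y)) (M.trans (C.conj-cong (M.trans X+Y≈ (M.sym conjugate))) (Conjugation.conj-inverse U V UV≈I VU≈I A))
      where
      open _∼_ A∼B
      module C = Conjugation V U VU≈I UV≈I

    -- Each minor is conjugated anew before its corner is set. Triangular shape would not survive
    -- this, but `Rooted` does. The count `suc n ℕ.* 2` computes to two successors, ready for
    -- `uncons₂`.
    splits : ∀ n (A : Mat (suc n)) → n ≡ 0 ⊎ ¬ Scalar A → S (suc n ℕ.* 2) (trace A) → Splits A
    splits zero A _ h =
      let a , b , a-root , b-root , h′ = uncons₂ h
      in splits-border A a-root b-root (x-y≈0⇒x≈y (trans (+-congʳ (sym (+-identityʳ _))) (S-zero h′)))
           ((λ ()) , (λ ()) , Rooted-empty geometric≉0 _ , Rooted-empty geometric≉0 _ , λ ())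
    splits (suc n) A (inj₁ ())
    splits (suc n) A (inj₂ ¬scalar) h =
      let a , b , a-root , b-root , h′ = uncons₂ h
          B , A∼B , corner , minor-ok = prescribed-corner A ¬scalar (a + b)
      in splits-∼ A∼B (splits-border B a-root b-root corner (splits n (minor B) minor-ok
           (S-resp (trans (+-cong (trace-∼ A∼B) (-‿cong (sym corner))) (solve 2 (λ x t → (x :+ t) :- x := t) refl (B zero zero) (trace (minor B)))) h′)))

-- Binomial coefficients and the Frobenius map.

module _ where
  open Data.Nat using (_+_; _*_)
  open import Data.Nat.Combinatorics using (_C_; nCk+nC[k+1]≡[n+1]C[k+1]; k>n⇒nCk≡0)

  absorption : ∀ n k → suc k * (suc n C suc k) ≡ suc n * (n C k)
  absorption n zero = ≡.trans (ℕₚ.*-identityˡ _) (≡.trans (C1 n) (≡.sym (ℕₚ.*-identityʳ (suc n))))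
    where
    C1 : ∀ n → suc n C 1 ≡ suc n
    C1 zero    = ≡.refl
    C1 (suc n) = ≡.trans (≡.sym (nCk+nC[k+1]≡[n+1]C[k+1] (suc n) 0)) (≡.cong suc (C1 n))
  absorption zero (suc k) = ≡.trans (≡.cong (suc (suc k) *_) (k>n⇒nCk≡0 {1} {suc (suc k)} (s≤s (s≤s z≤n)))) (ℕₚ.*-zeroʳ (suc (suc k)))
  absorption (suc n) (suc k) = begin
    suc (suc k) * (suc (suc n) C suc (suc k))                       ≡⟨ ≡.cong (suc (suc k) *_) (nCk+nC[k+1]≡[n+1]C[k+1] (suc n) (suc k)) ⟨
    suc (suc k) * (A + B)                                           ≡⟨ lem₁ k A B ⟩
    suc k * A + A + suc (suc k) * B                                 ≡⟨ ≡.cong₂ (λ u v → u + A + v) (absorption n k) (absorption n (suc k)) ⟩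
    suc n * (n C k) + A + suc n * (n C suc k)                       ≡⟨ lem₂ n (n C k) A (n C suc k) ⟩
    suc n * (n C k + n C suc k) + A                                 ≡⟨ ≡.cong (λ u → suc n * u + A) (nCk+nC[k+1]≡[n+1]C[k+1] n k) ⟩
    suc n * A + A                                                   ≡⟨ ℕₚ.+-comm (suc n * A) A ⟩
    suc (suc n) * A                                                 ∎
    where
    open ≡.≡-Reasoning
    A B : ℕ
    A = suc n C suc k
    B = suc n C suc (suc k)
    lem₁ : ∀ k a b → suc (suc k) * (a + b) ≡ suc k * a + a + suc (suc k) * b
    lem₁ = solve-∀
    lem₂ : ∀ n a b c → suc n * a + b + suc n * c ≡ suc n * (a + c) + b
    lem₂ = solve-∀

  -- By `absorption` the prime divides the product of the binomial coefficient with k + 1, which is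
  -- too small to be divisible by it.
  prime∣binomial : ∀ {n} → Prime (suc n) → ∀ k → k < n → suc n ∣ (suc n C suc k)
  prime∣binomial {n} p-prime k k<n with euclidsLemma (suc k) (suc n C suc k) p-prime (≡.subst (suc n ∣_) (≡.sym (absorption n k)) (Div.m∣m*n (n C k)))
  ... | inj₁ p∣k = ⊥-elim (ℕₚ.<⇒≱ (s≤s k<n) (Div.∣⇒≤ p∣k))
  ... | inj₂ p∣C = p∣C

module Frobenius {c ℓ} (R : CommutativeRing c ℓ) where
  open CommutativeRing R hiding (zero)
  open import Algebra.Properties.CommutativeSemiring.Exp commutativeSemiring
  open import Data.Nat.Combinatorics using (_C_; nCn≡1)
  open import Algebra.Properties.Semiring.Mult semiring using (×-congʳ; ×-assocˡ; ×-assoc-*; ×-homo-1) renaming (_×_ to _×ᴿ_)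
  import Algebra.Properties.CommutativeSemiring.Binomial commutativeSemiring as Binomial
  open import Algebra.Properties.CommutativeMonoid.Sum +-commutativeMonoid using (sum-init-last; sum-cong-≋; sum-replicate-zero) renaming (sum to sumᴿ)
  open import Relation.Binary.Reasoning.Setoid setoid

  Additive : ℕ → Set _
  Additive n = ∀ x y → (x + y) ^ n ≈ x ^ n + y ^ n

  multiple≈0 : ∀ {p} → p ×ᴿ 1# ≈ 0# → ∀ {n} x → p ∣ n → n ×ᴿ x ≈ 0#
  multiple≈0 {p} p≈0 x (divides m ≡.refl) = trans (sym (×-assocˡ x m p)) (trans (×-congʳ m (begin
    p ×ᴿ x            ≈⟨ ×-congʳ p (*-identityˡ x) ⟨
    p ×ᴿ (1# * x)     ≈⟨ ×-assoc-* p 1# x ⟨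
    (p ×ᴿ 1#) * x     ≈⟨ *-congʳ p≈0 ⟩
    0# * x            ≈⟨ zeroˡ x ⟩
    0#                ∎)) (zeros m))
    where
    zeros : ∀ m → m ×ᴿ 0# ≈ 0#
    zeros zero    = refl
    zeros (suc m) = trans (+-identityˡ _) (zeros m)

  additive-prime : ∀ {p} → Prime p → p ×ᴿ 1# ≈ 0# → Additive p
  additive-prime {zero} p-prime _ = ⊥-elim (ℕ.≢-nonZero⁻¹ 0 {{prime⇒nonZero p-prime}} ≡.refl)
  additive-prime {p@(suc n)} p-prime p≈0 x y = begin
    (x + y) ^ p                                                ≈⟨ Binomial.theorem p x y ⟩
    t zero + sumᴿ (λ i → t (suc i))                            ≈⟨ +-cong first (sum-init-last (λ i → t (suc i))) ⟩
    y ^ p + (sumᴿ (λ i → t (suc (Fin.inject₁ i))) + t (suc (Fin.fromℕ n))) ≈⟨ +-congˡ (+-cong (trans (sum-cong-≋ middle) (sum-replicate-zero n)) final) ⟩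
    y ^ p + (0# + x ^ p)                                       ≈⟨ trans (+-congˡ (+-identityˡ _)) (+-comm _ _) ⟩
    x ^ p + y ^ p                                              ∎
    where
    t : Fin (suc p) → Carrier
    t = Binomial.binomialTerm x y p
    first : t zero ≈ y ^ p
    first = trans (×-homo-1 _) (*-identityˡ _)
    middle : ∀ i → t (suc (Fin.inject₁ i)) ≈ 0#
    middle i = multiple≈0 p≈0 _ (prime∣binomial p-prime (Fin.toℕ (Fin.inject₁ i)) (≡.subst (_< n) (≡.sym (Finₚ.toℕ-inject₁ i)) (Finₚ.toℕ<n i)))
    final : t (suc (Fin.fromℕ n)) ≈ x ^ p
    final = begin
      (p C suc (Fin.toℕ (Fin.fromℕ n))) ×ᴿ (x ^ suc (Fin.toℕ (Fin.fromℕ n)) * y ^ (n ℕ.∸ Fin.toℕ (Fin.fromℕ n)))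
        ≡⟨ ≡.cong (λ j → (p C suc j) ×ᴿ (x ^ suc j * y ^ (n ℕ.∸ j))) (Finₚ.toℕ-fromℕ n) ⟩
      (p C p) ×ᴿ (x ^ p * y ^ (n ℕ.∸ n))   ≡⟨ ≡.cong₂ (λ i j → i ×ᴿ (x ^ p * y ^ j)) (nCn≡1 p) (ℕₚ.n∸n≡0 n) ⟩
      1 ×ᴿ (x ^ p * 1#)                    ≈⟨ trans (×-homo-1 _) (*-identityʳ _) ⟩
      x ^ p                                ∎

  additive-^ : ∀ {n} → Additive n → ∀ j → Additive (n ℕ.^ j)
  additive-^ add zero    x y = trans (*-identityʳ _) (sym (+-cong (*-identityʳ x) (*-identityʳ y)))
  additive-^ {n} add (suc j) x y = begin
    (x + y) ^ (n ℕ.* n ℕ.^ j)                  ≈⟨ ^-assocʳ (x + y) n (n ℕ.^ j) ⟨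
    ((x + y) ^ n) ^ (n ℕ.^ j)                  ≈⟨ ^-congˡ (n ℕ.^ j) (add x y) ⟩
    (x ^ n + y ^ n) ^ (n ℕ.^ j)                ≈⟨ additive-^ add j (x ^ n) (y ^ n) ⟩
    (x ^ n) ^ (n ℕ.^ j) + (y ^ n) ^ (n ℕ.^ j)  ≈⟨ +-cong (^-assocʳ x n (n ℕ.^ j)) (^-assocʳ y n (n ℕ.^ j)) ⟩
    x ^ (n ℕ.* n ℕ.^ j) + y ^ (n ℕ.* n ℕ.^ j)  ∎

-- Polynomials modulo the annihilator of a sequence.

-- Polynomials as coefficient lists, constant term first, acting on sequences
-- through the shift; two polynomials are identified when they act alike on s₀.
module PolynomialRing {c ℓ} (F : Field c ℓ) (s₀ : ℕ → Field.Carrier F) where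
  open Field F hiding (zero)
  open RingSolver commutativeRing
  open import Relation.Binary.Reasoning.Setoid setoid
  open import Algebra.Properties.Ring ring using (-‿distribˡ-*; -0#≈0#; -‿+-comm)
  open import Algebra.Properties.CommutativeSemigroup +-commutativeSemigroup using (interchange)

  Poly : Set c
  Poly = List Carrier

  act : Poly → (ℕ → Carrier) → ℕ → Carrier
  act []      s i = 0#
  act (a ∷ p) s i = a * s i + act p s (suc i)

  infixl 6 _+ᴾ_
  infixl 7 _*ᴾ_

  act-cong : ∀ p {s t} → (∀ i → s i ≈ t i) → ∀ i → act p s i ≈ act p t i
  act-cong []      h i = refl
  act-cong (a ∷ p) h i = +-cong (*-congˡ (h i)) (act-cong p h (suc i))

  act-shift : ∀ p s i → act (0# ∷ p) s i ≈ act p s (suc i)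
  act-shift p s i = trans (+-congʳ (zeroˡ _)) (+-identityˡ _)

  abstract
    _+ᴾ_ : Poly → Poly → Poly
    []      +ᴾ q       = q
    (a ∷ p) +ᴾ []      = a ∷ p
    (a ∷ p) +ᴾ (b ∷ q) = (a + b) ∷ (p +ᴾ q)

    scale : Carrier → Poly → Poly
    scale a = map (a *_)

    -ᴾ_ : Poly → Poly
    -ᴾ_ = map (λ a → - a)

    _*ᴾ_ : Poly → Poly → Poly
    []      *ᴾ q = []
    (a ∷ p) *ᴾ q = scale a q +ᴾ (0# ∷ (p *ᴾ q))

    act-+ : ∀ p q s i → act (p +ᴾ q) s i ≈ act p s i + act q s i
    act-+ []      q       s i = sym (+-identityˡ _)
    act-+ (a ∷ p) []      s i = sym (+-identityʳ _)
    act-+ (a ∷ p) (b ∷ q) s i = trans (+-cong (distribʳ (s i) a b) (act-+ p q s (suc i))) (interchange _ _ _ _)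

    act-scale : ∀ a p s i → act (scale a p) s i ≈ a * act p s i
    act-scale a []      s i = sym (zeroʳ a)
    act-scale a (b ∷ p) s i = trans (+-cong (*-assoc a b _) (act-scale a p s (suc i))) (sym (distribˡ a _ _))

    act-neg : ∀ p s i → act (-ᴾ p) s i ≈ - act p s i
    act-neg []      s i = sym -0#≈0#
    act-neg (b ∷ p) s i = trans (+-cong (sym (-‿distribˡ-* b _)) (act-neg p s (suc i))) (-‿+-comm _ _)

    act-* : ∀ p q s i → act (p *ᴾ q) s i ≈ act p (act q s) i
    act-* []      q s i = refl
    act-* (a ∷ p) q s i = trans (act-+ (scale a q) _ s i) (+-cong (act-scale a q s i) (trans (act-shift (p *ᴾ q) s i) (act-* p q s (suc i))))

    length-+ : ∀ {N} p q → length p ≤ N → length q ≤ N → length (p +ᴾ q) ≤ N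
    length-+ []      q       hp       hq       = hq
    length-+ (a ∷ p) []      hp       hq       = hp
    length-+ (a ∷ p) (b ∷ q) (s≤s hp) (s≤s hq) = s≤s (length-+ p q hp hq)

    length-neg : ∀ p → length (-ᴾ p) ≡ length p
    length-neg = Listₚ.length-map _

  act-suc : ∀ p s i → act p (s ∘ suc) i ≈ act p s (suc i)
  act-suc []      s i = refl
  act-suc (a ∷ p) s i = +-congˡ (act-suc p s (suc i))

  act-linear : ∀ p a s t i → act p (λ j → a * s j + t j) i ≈ a * act p s i + act p t i
  act-linear []      a s t i = sym (trans (+-congʳ (zeroʳ a)) (+-identityˡ 0#))
  act-linear (b ∷ p) a s t i = trans (+-congˡ (act-linear p a s t (suc i)))
    (solve 6 (λ a b s t x y → b :* (a :* s :+ t) :+ (a :* x :+ y) := a :* (b :* s :+ x) :+ (b :* t :+ y)) refl a b (s i) (t i) (act p s (suc i)) (act p t (suc i)))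

  act-0 : ∀ p i → act p (λ _ → 0#) i ≈ 0#
  act-0 []      i = refl
  act-0 (a ∷ p) i = trans (+-cong (zeroʳ a) (act-0 p (suc i))) (+-identityˡ 0#)

  -- Equality of polynomials speaks of `s₀` only, and in a product the left factor acts on another
  -- sequence. Swapping the factors brings it next to `s₀`, which is how products respect equality.
  act-comm : ∀ p q s i → act p (act q s) i ≈ act q (act p s) i
  act-comm []      q s i = sym (act-0 q i)
  act-comm (a ∷ p) q s i = sym (trans (act-linear q a s (λ j → act p s (suc j)) i) (+-congˡ (trans (act-suc q (act p s) i) (sym (act-comm p q s (suc i))))))

  infix 4 _≈ᴾ_
  -- A record keeps p and q visible in the type, where the bare pointwise statement would unfold
  -- `act` and hide them from inference.
  record _≈ᴾ_ (p q : Poly) : Set ℓ where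
    constructor equal
    field at : ∀ i → act p s₀ i ≈ act q s₀ i
  open _≈ᴾ_ public

  polynomialRing : CommutativeRing c ℓ
  polynomialRing = record
    { Carrier = Poly
    ; _≈_ = _≈ᴾ_
    ; _+_ = _+ᴾ_
    ; _*_ = _*ᴾ_
    ; -_ = -ᴾ_
    ; 0# = []
    ; 1# = 1# ∷ []
    ; isCommutativeRing = record
      { isRing = record
        { +-isAbelianGroup = record
          { isGroup = record
            { isMonoid = record
              { isSemigroup = record
                { isMagma = record
                  { isEquivalence = record
                    { refl = equal λ i → refl
                    ; sym = λ h → equal λ i → sym (at h i)
                    ; trans = λ h h′ → equal λ i → trans (at h i) (at h′ i)
                    }
                  ; ∙-cong = λ {p} {p′} {q} {q′} h h′ → equal λ i → trans (act-+ p q _ i) (trans (+-cong (at h i) (at h′ i)) (sym (act-+ p′ q′ _ i)))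
                  }
                ; assoc = λ p q r → equal λ i → trans (act-+ (p +ᴾ q) r _ i) (trans (+-congʳ (act-+ p q _ i)) (trans (+-assoc _ _ _) (sym (trans (act-+ p (q +ᴾ r) _ i) (+-congˡ (act-+ q r _ i))))))
                }
              ; identity = (λ p → equal λ i → trans (act-+ [] p _ i) (+-identityˡ _)) , (λ p → equal λ i → trans (act-+ p [] _ i) (+-identityʳ _))
              }
            ; inverse = (λ p → equal λ i → trans (act-+ (-ᴾ p) p _ i) (trans (+-congʳ (act-neg p _ i)) (-‿inverseˡ _)))
                      , (λ p → equal λ i → trans (act-+ p (-ᴾ p) _ i) (trans (+-congˡ (act-neg p _ i)) (-‿inverseʳ _)))
            ; ⁻¹-cong = λ {p} {q} h → equal λ i → trans (act-neg p _ i) (trans (-‿cong (at h i)) (sym (act-neg q _ i)))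
            }
          ; comm = λ p q → equal λ i → trans (act-+ p q _ i) (trans (+-comm _ _) (sym (act-+ q p _ i)))
          }
        ; *-cong = λ {p} {p′} {q} {q′} h h′ → equal λ i → trans (act-* p q _ i) (trans (act-cong p (at h′) i) (trans (act-comm p q′ _ i) (trans (act-cong q′ (at h) i) (trans (act-comm q′ p′ _ i) (sym (act-* p′ q′ _ i))))))
        ; *-assoc = λ p q r → equal λ i → trans (act-* (p *ᴾ q) r _ i) (trans (act-* p q _ i) (sym (trans (act-* p (q *ᴾ r) _ i) (act-cong p (act-* q r _) i))))
        ; *-identity = (λ p → equal λ i → trans (act-* (1# ∷ []) p _ i) (act-one (act p s₀) i)) , (λ p → equal λ i → trans (act-* p (1# ∷ []) _ i) (act-cong p (act-one _) i))
        ; distrib = (λ p q r → equal λ i → trans (act-* p (q +ᴾ r) _ i) (trans (act-comm p (q +ᴾ r) _ i) (trans (act-+ q r _ i) (trans (+-cong (act-comm q p _ i) (act-comm r p _ i)) (sym (trans (act-+ (p *ᴾ q) (p *ᴾ r) _ i) (+-cong (act-* p q _ i) (act-* p r _ i))))))))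
                  , (λ p q r → equal λ i → trans (act-* (q +ᴾ r) p _ i) (trans (act-+ q r _ i) (sym (trans (act-+ (q *ᴾ p) (r *ᴾ p) _ i) (+-cong (act-* q p _ i) (act-* r p _ i))))))
        }
      ; *-comm = λ p q → equal λ i → trans (act-* p q _ i) (trans (act-comm p q _ i) (sym (act-* q p _ i)))
      }
    }
    where
    act-one : ∀ s i → act (1# ∷ []) s i ≈ s i
    act-one s i = trans (+-identityʳ _) (*-identityˡ _)

-- Localisation at an element, and idempotents.

-- R localised at w: elements are identified when w cannot tell them apart.
module Localisation {c ℓ} (R : CommutativeRing c ℓ) (w : CommutativeRing.Carrier R) where
  open CommutativeRing R hiding (zero)
  open import Relation.Binary.Reasoning.Setoid setoid
  open import Algebra.Properties.Ring ring using (-‿distribʳ-*)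

  infix 4 _≈ʷ_
  record _≈ʷ_ (x y : Carrier) : Set ℓ where
    constructor seen
    field by : w * x ≈ w * y
  open _≈ʷ_ public

  ≈⇒≈ʷ : ∀ {x y} → x ≈ y → x ≈ʷ y
  ≈⇒≈ʷ h = seen (*-congˡ h)

  private
    *-half : ∀ {x y} z → x ≈ʷ y → w * (x * z) ≈ w * (y * z)
    *-half z h = trans (sym (*-assoc _ _ _)) (trans (*-congʳ (by h)) (*-assoc _ _ _))

  localisation : CommutativeRing c ℓ
  localisation = record
    { Carrier = Carrier
    ; _≈_ = _≈ʷ_
    ; _+_ = _+_
    ; _*_ = _*_
    ; -_ = -_
    ; 0# = 0#
    ; 1# = 1#
    ; isCommutativeRing = record
      { isRing = record
        { +-isAbelianGroup = record
          { isGroup = record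
            { isMonoid = record
              { isSemigroup = record
                { isMagma = record
                  { isEquivalence = record
                    { refl = seen refl
                    ; sym = λ h → seen (sym (by h))
                    ; trans = λ h h′ → seen (trans (by h) (by h′))
                    }
                  ; ∙-cong = λ h h′ → seen (trans (distribˡ _ _ _) (trans (+-cong (by h) (by h′)) (sym (distribˡ _ _ _))))
                  }
                ; assoc = λ x y z → ≈⇒≈ʷ (+-assoc x y z)
                }
              ; identity = (λ x → ≈⇒≈ʷ (+-identityˡ x)) , (λ x → ≈⇒≈ʷ (+-identityʳ x))
              }
            ; inverse = (λ x → ≈⇒≈ʷ (-‿inverseˡ x)) , (λ x → ≈⇒≈ʷ (-‿inverseʳ x))
            ; ⁻¹-cong = λ h → seen (trans (sym (-‿distribʳ-* _ _)) (trans (-‿cong (by h)) (-‿distribʳ-* _ _)))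
            }
          ; comm = λ x y → ≈⇒≈ʷ (+-comm x y)
          }
        ; *-cong = λ {x} {y} {u} {v} h h′ → seen (trans (*-half u h) (trans (*-congˡ (*-comm y u)) (trans (*-half y h′) (*-congˡ (*-comm v y)))))
        ; *-assoc = λ x y z → ≈⇒≈ʷ (*-assoc x y z)
        ; *-identity = (λ x → ≈⇒≈ʷ (*-identityˡ x)) , (λ x → ≈⇒≈ʷ (*-identityʳ x))
        ; distrib = (λ x y z → ≈⇒≈ʷ (distribˡ x y z)) , (λ x y z → ≈⇒≈ʷ (distribʳ x y z))
        }
      ; *-comm = λ x y → ≈⇒≈ʷ (*-comm x y)
      }
    }

-- In a ring where y^(2+n) = y throughout, each y^(1+n) is idempotent; multiplying z
-- successively by those that do not kill it makes every y either zero or invertible at w.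
module Settling {c ℓ} (R : CommutativeRing c ℓ) (n : ℕ) where
  open CommutativeRing R hiding (zero)
  open import Algebra.Properties.CommutativeSemiring.Exp commutativeSemiring
  open import Relation.Binary.Reasoning.Setoid setoid
  open RingSolver R

  Settled : Carrier → Carrier → Set _
  Settled w y = w * y ≈ 0# ⊎ w * y ^ suc n ≈ w

  Settled-resp : ∀ {w y y′} → y ≈ y′ → Settled w y → Settled w y′
  Settled-resp e (inj₁ h) = inj₁ (trans (*-congˡ (sym e)) h)
  Settled-resp e (inj₂ h) = inj₂ (trans (*-congˡ (^-congˡ (suc n) (sym e))) h)

  -- Both alternatives survive further multiplication, so the elements of a finite list can be
  -- settled one after another.
  Settled-* : ∀ {w y} v → Settled w y → Settled (w * v) y
  Settled-* {w} {y} v (inj₁ h) = inj₁ (trans (solve 3 (λ w v y → w :* v :* y := w :* y :* v) refl w v y) (trans (*-congʳ h) (zeroˡ v)))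
  Settled-* {w} {y} v (inj₂ h) = inj₂ (trans (solve 3 (λ w v y → w :* v :* y := w :* y :* v) refl w v (y ^ suc n)) (*-congʳ h))

  module _ (fixed : ∀ y → y ^ suc (suc n) ≈ y) (≈0? : ∀ x → Dec (x ≈ 0#)) where

    private
      idempotent : ∀ y → y ^ suc n * y ^ suc n ≈ y ^ suc n
      idempotent y = begin
        y ^ suc n * y ^ suc n          ≈⟨ solve 2 (λ y z → y :* z :* (y :* z) := y :* (y :* z) :* z) refl y (y ^ n) ⟩
        y ^ suc (suc n) * y ^ n        ≈⟨ *-congʳ (fixed y) ⟩
        y ^ suc n                      ∎

    settle : ∀ N (f : Fin N → Carrier) z → ¬ (z ≈ 0#) → ∃ λ v → ¬ (z * v ≈ 0#) × (∀ i → Settled (z * v) (f i))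
    settle zero    f z z≉0 = 1# , (λ e → z≉0 (trans (sym (*-identityʳ z)) e)) , λ ()
    settle (suc N) f z z≉0 with settle N (f ∘ suc) z z≉0
    ... | v , zv≉0 , settled with ≈0? (z * v * f zero)
    ... | yes e = v , zv≉0 , λ { zero → inj₁ e ; (suc i) → settled i }
    ... | no ne = v * e , zve≉0 , λ { zero → inj₂ (trans (*-assoc z (v * e) e) (*-congˡ (trans (*-assoc v e e) (*-congˡ (idempotent (f zero))))))
                                    ; (suc i) → Settled-resp′ (Settled-* e (settled i)) }
      where
      e : Carrier
      e = f zero ^ suc n
      Settled-resp′ : ∀ {y} → Settled (z * v * e) y → Settled (z * (v * e)) y
      Settled-resp′ (inj₁ h) = inj₁ (trans (*-congʳ (sym (*-assoc z v e))) h)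
      Settled-resp′ (inj₂ h) = inj₂ (trans (*-congʳ (sym (*-assoc z v e))) (trans h (*-assoc z v e)))
      zve≉0 : ¬ (z * (v * e) ≈ 0#)
      zve≉0 h = ne (begin
        z * v * f zero                  ≈⟨ *-congˡ (fixed (f zero)) ⟨
        z * v * (f zero * e)            ≈⟨ solve 4 (λ z v y e → z :* v :* (y :* e) := z :* (v :* e) :* y) refl z v (f zero) e ⟩
        z * (v * e) * f zero            ≈⟨ *-congʳ h ⟩
        0# * f zero                     ≈⟨ zeroˡ _ ⟩
        0#                              ∎)

-- The cyclic algebra F[x]/(x^L - 1) with L = qᵐ - 1.

module CyclicAlgebra {c ℓ} (F : Field c ℓ) {q : ℕ} (enum : Inverse (≡.setoid (Fin q)) (Field.setoid F))
                     {p l : ℕ} (p-prime : Prime p) (q≡pˡ : q ≡ p ℕ.^ l) (m₁ : ℕ) where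
  open Field F hiding (zero)
  open FieldProperties F using (_^_; ^-congˡ; ^-congʳ; ^-assocʳ; characteristic; ×-congˡ) renaming (_×ᴷ_ to _×ᶠ_)
  open FiniteField F enum using (elt; idx; elt-idx; _≟_)
  open FiniteFieldProperties F enum using (fermat; Q×1≈0)
  open import Relation.Binary.Reasoning.Setoid setoid

  m Q : ℕ
  m = suc m₁
  Q = q ℕ.^ m

  1<q : 1 < q
  1<q = two-elements (idx 0#) (idx 1#) (λ e → 1≉0 (trans (sym (elt-idx 1#)) (trans (reflexive (≡.cong elt (≡.sym e))) (elt-idx 0#))))
    where
    two-elements : ∀ {n} (i j : Fin n) → i ≢ j → 1 < n
    two-elements {suc zero}    zero zero i≢j = ⊥-elim (i≢j ≡.refl)
    two-elements {suc (suc n)} _    _    _   = s≤s (s≤s z≤n)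

  private
    instance
      q≢0 : ℕ.NonZero q
      q≢0 = ℕ.>-nonZero (ℕₚ.<⇒≤ 1<q)

  1<Q : 1 < Q
  1<Q = ℕₚ.<-≤-trans 1<q (ℕₚ.m≤m*n q (q ℕ.^ m₁) {{ℕₚ.m^n≢0 q m₁}})

  L : ℕ
  L = Q ℕ.∸ 1

  Q≡1+L : Q ≡ suc L
  Q≡1+L = ≡.sym (ℕₚ.m+[n∸m]≡n (ℕₚ.<⇒≤ 1<Q))

  1≤L : 1 ≤ L
  1≤L = ℕₚ.∸-monoˡ-≤ 1 1<Q

  abstract
    -- A periodic impulse: `act y s₀ i` adds up the coefficients of y at the exponents j with L
    -- dividing i + j, so y acts as zero exactly when x^L - 1 divides it.
    s₀ : ℕ → Carrier
    s₀ i with L ∣? i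
    ... | yes _ = 1#
    ... | no  _ = 0#

    s₀-multiple : ∀ {i} → L ∣ i → s₀ i ≡ 1#
    s₀-multiple {i} h with L ∣? i
    ... | yes _ = ≡.refl
    ... | no ¬h = ⊥-elim (¬h h)

    s₀-other : ∀ {i} → ¬ (L ∣ i) → s₀ i ≡ 0#
    s₀-other {i} ¬h with L ∣? i
    ... | yes h = ⊥-elim (¬h h)
    ... | no _  = ≡.refl

    s₀-period : ∀ i → s₀ (L ℕ.+ i) ≡ s₀ i
    s₀-period i with L ∣? i
    ... | yes h = s₀-multiple (Div.∣m∣n⇒∣m+n Div.∣-refl h)
    ... | no ¬h = s₀-other (λ h → ¬h (Div.∣m+n∣m⇒∣n h Div.∣-refl))

  open PolynomialRing F s₀ public
  module R = CommutativeRing polynomialRing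
  open import Algebra.Properties.CommutativeSemiring.Exp R.commutativeSemiring public
    using () renaming (_^_ to _^ᴾ_; ^-congˡ to ^ᴾ-congˡ; ^-congʳ to ^ᴾ-congʳ; ^-homo-* to ^ᴾ-homo-*; ^-assocʳ to ^ᴾ-assocʳ; ^-distrib-* to ^ᴾ-distrib-*)
  open import Algebra.Properties.Semiring.Mult R.semiring using () renaming (_×_ to _×ᴾ_)
  open Frobenius polynomialRing using (Additive; additive-prime; additive-^)

  ι : Carrier → Poly
  ι a = a ∷ []

  X : Poly
  X = 0# ∷ 1# ∷ []

  act-ι : ∀ a s i → act (ι a) s i ≈ a * s i
  act-ι a s i = +-identityʳ _

  act-X : ∀ s i → act X s i ≈ s (suc i)
  act-X s i = trans (act-shift (1# ∷ []) s i) (trans (act-ι 1# s (suc i)) (*-identityˡ _))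

  act-X^ : ∀ j s i → act (X ^ᴾ j) s i ≈ s (j ℕ.+ i)
  act-X^ zero    s i = trans (act-ι 1# s i) (*-identityˡ _)
  act-X^ (suc j) s i = trans (act-* X (X ^ᴾ j) s i) (trans (act-X (act (X ^ᴾ j) s) i) (trans (act-X^ j s (suc i)) (reflexive (≡.cong s (ℕₚ.+-suc j i)))))

  ι-cong : ∀ {a b} → a ≈ b → ι a ≈ᴾ ι b
  ι-cong e = equal λ i → +-congʳ (*-congʳ e)

  ι-+ : ∀ a b → ι (a + b) ≈ᴾ ι a +ᴾ ι b
  ι-+ a b = equal λ i → trans (act-ι (a + b) s₀ i) (trans (distribʳ _ a b) (sym (trans (act-+ (ι a) (ι b) s₀ i) (+-cong (act-ι a s₀ i) (act-ι b s₀ i)))))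

  ι-* : ∀ a b → ι (a * b) ≈ᴾ ι a *ᴾ ι b
  ι-* a b = equal λ i → trans (act-ι (a * b) s₀ i) (sym (trans (act-* (ι a) (ι b) s₀ i) (trans (act-ι a (act (ι b) s₀) i) (trans (*-congˡ (act-ι b s₀ i)) (sym (*-assoc a b _))))))

  ι-^ : ∀ a n → ι (a ^ n) ≈ᴾ ι a ^ᴾ n
  ι-^ a zero    = R.refl
  ι-^ a (suc n) = R.trans (ι-* a (a ^ n)) (R.*-congˡ {ι a} (ι-^ a n))

  ι-0 : ι 0# ≈ᴾ []
  ι-0 = equal λ i → trans (act-ι 0# s₀ i) (zeroˡ _)

  ∷-split : ∀ a y → (a ∷ y) ≈ᴾ ι a +ᴾ X *ᴾ y
  ∷-split a y = equal λ i → sym (trans (act-+ (ι a) (X *ᴾ y) s₀ i) (+-cong (act-ι a s₀ i) (trans (act-* X y s₀ i) (act-X (act y s₀) i))))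

  ×-ι : ∀ n → n ×ᴾ R.1# ≈ᴾ ι (n ×ᶠ 1#)
  ×-ι zero    = R.sym ι-0
  ×-ι (suc n) = R.trans (R.+-congˡ {ι 1#} (×-ι n)) (R.sym (ι-+ 1# (n ×ᶠ 1#)))

  additive-q : Additive q
  additive-q = ≡.subst Additive (≡.sym q≡pˡ) (additive-^ (additive-prime p-prime
    (R.trans (×-ι p) (R.trans (ι-cong (characteristic p l (trans (×-congˡ (≡.sym q≡pˡ)) Q×1≈0) (λ x → x ≟ 0#))) ι-0))) l)

  X^L≈1 : X ^ᴾ L ≈ᴾ R.1#
  X^L≈1 = equal λ i → trans (act-X^ L s₀ i) (trans (reflexive (s₀-period i)) (sym (trans (act-ι 1# s₀ i) (*-identityˡ _))))

  fermat^ : ∀ j a → a ^ (q ℕ.^ j) ≈ a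
  fermat^ zero    a = *-identityʳ a
  fermat^ (suc j) a = trans (sym (^-assocʳ a q (q ℕ.^ j))) (trans (^-congˡ (q ℕ.^ j) (fermat a)) (fermat^ j a))

  -- Raising to the power Q is additive and multiplicative; it fixes the constants by Fermat and x
  -- because x^L = 1, hence every polynomial.
  fixed : ∀ y → y ^ᴾ Q ≈ᴾ y
  fixed []      = R.trans (^ᴾ-congʳ [] Q≡1+L) (R.zeroˡ ([] ^ᴾ L))
  fixed (a ∷ y) = R.trans (^ᴾ-congˡ Q (∷-split a y)) (R.trans (additive-^ {q} additive-q m (ι a) (X *ᴾ y))
    (R.trans (R.+-cong (R.trans (R.sym (ι-^ a Q)) (ι-cong (fermat^ m a))) (R.trans (^ᴾ-distrib-* X y Q) (R.*-cong X^Q≈X (fixed y)))) (R.sym (∷-split a y))))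
    where
    X^Q≈X : X ^ᴾ Q ≈ᴾ X
    X^Q≈X = R.trans (^ᴾ-congʳ X Q≡1+L) (R.trans (R.*-congˡ {X} X^L≈1) (R.*-identityʳ X))

  act-period : ∀ y t i → act y s₀ (t ℕ.* L ℕ.+ i) ≈ act y s₀ i
  act-period y zero    i = refl
  act-period y (suc t) i = begin
    act y s₀ (L ℕ.+ t ℕ.* L ℕ.+ i)          ≡⟨ ≡.cong (act y s₀) (ℕₚ.+-assoc L (t ℕ.* L) i) ⟩
    act y s₀ (L ℕ.+ (t ℕ.* L ℕ.+ i))        ≈⟨ act-X^ L (act y s₀) (t ℕ.* L ℕ.+ i) ⟨
    act (X ^ᴾ L) (act y s₀) (t ℕ.* L ℕ.+ i) ≈⟨ act-* (X ^ᴾ L) y s₀ _ ⟨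
    act (X ^ᴾ L *ᴾ y) s₀ (t ℕ.* L ℕ.+ i)    ≈⟨ at (R.trans (R.*-congʳ {y} X^L≈1) (R.*-identityˡ y)) _ ⟩
    act y s₀ (t ℕ.* L ℕ.+ i)                ≈⟨ act-period y t i ⟩
    act y s₀ i                              ∎

  infix 4 _≟ᴾ_
  -- By periodicity it is enough to compare L values.
  _≟ᴾ_ : ∀ y z → Dec (y ≈ᴾ z)
  y ≟ᴾ z = map′ (λ h → equal (everywhere h)) (λ h i → at h (Fin.toℕ i)) (Finₚ.all? {n = L} (λ i → act y s₀ (Fin.toℕ i) ≟ act z s₀ (Fin.toℕ i)))
    where
    instance
      L≢0 : ℕ.NonZero L
      L≢0 = ℕ.>-nonZero 1≤L
    everywhere : (∀ (i : Fin L) → act y s₀ (Fin.toℕ i) ≈ act z s₀ (Fin.toℕ i)) → ∀ i → act y s₀ i ≈ act z s₀ i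
    everywhere h i = begin
      act y s₀ i                              ≡⟨ ≡.cong (act y s₀) i≡ ⟩
      act y s₀ (i ℕ./ L ℕ.* L ℕ.+ i ℕ.% L)    ≈⟨ act-period y (i ℕ./ L) (i ℕ.% L) ⟩
      act y s₀ (i ℕ.% L)                      ≡⟨ ≡.cong (act y s₀) (Finₚ.toℕ-fromℕ< i%L<L) ⟨
      act y s₀ (Fin.toℕ (Fin.fromℕ< i%L<L))   ≈⟨ h (Fin.fromℕ< i%L<L) ⟩
      act z s₀ (Fin.toℕ (Fin.fromℕ< i%L<L))   ≡⟨ ≡.cong (act z s₀) (Finₚ.toℕ-fromℕ< i%L<L) ⟩
      act z s₀ (i ℕ.% L)                      ≈⟨ act-period z (i ℕ./ L) (i ℕ.% L) ⟨
      act z s₀ (i ℕ./ L ℕ.* L ℕ.+ i ℕ.% L)    ≡⟨ ≡.cong (act z s₀) i≡ ⟨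
      act z s₀ i                              ∎
      where
      i%L<L : i ℕ.% L < L
      i%L<L = DivMod.m%n<n i L
      i≡ : i ≡ i ℕ./ L ℕ.* L ℕ.+ i ℕ.% L
      i≡ = ≡.trans (DivMod.m≡m%n+[m/n]*n i L) (ℕₚ.+-comm (i ℕ.% L) _)

  Monic : ℕ → Poly → Set _
  Monic D y = ∃ λ low → length low ≤ D × (∀ s i → act y s i ≈ act low s i + s (D ℕ.+ i))

  shift : ℕ → Poly → Poly
  shift zero    y = y
  shift (suc j) y = 0# ∷ shift j y

  length-shift : ∀ j y → length (shift j y) ≡ j ℕ.+ length y
  length-shift zero    y = ≡.refl
  length-shift (suc j) y = ≡.cong suc (length-shift j y)

  act-shift^ : ∀ j y s i → act (shift j y) s i ≈ act y s (j ℕ.+ i)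
  act-shift^ zero    y s i = refl
  act-shift^ (suc j) y s i = trans (act-shift (shift j y) s i) (trans (act-shift^ j y s (suc i)) (reflexive (≡.cong (act y s) (ℕₚ.+-suc j i))))

  -- The strict bound on a keeps the term x^(D + 1), which comes from multiplying by -x, below the
  -- leading term x^(a + D).
  monic-step : ∀ {D y} a → 1 < a → Monic D y → Monic (a ℕ.+ D) ((X ^ᴾ a +ᴾ -ᴾ X) *ᴾ y)
  monic-step {D} {y} a 1<a (low , low≤D , y≈) = low′ , low′≤ , λ s i → begin
    act ((X ^ᴾ a +ᴾ -ᴾ X) *ᴾ y) s i
      ≈⟨ act-* (X ^ᴾ a +ᴾ -ᴾ X) y s i ⟩
    act (X ^ᴾ a +ᴾ -ᴾ X) (act y s) i
      ≈⟨ trans (act-+ (X ^ᴾ a) (-ᴾ X) (act y s) i) (+-cong (act-X^ a (act y s) i) (trans (act-neg X (act y s) i) (-‿cong (act-X (act y s) i)))) ⟩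
    act y s (a ℕ.+ i) - act y s (suc i)
      ≈⟨ +-cong (y≈ s (a ℕ.+ i)) (-‿cong (y≈ s (suc i))) ⟩
    (act low s (a ℕ.+ i) + s (D ℕ.+ (a ℕ.+ i))) - (act low s (suc i) + s (D ℕ.+ suc i))
      ≈⟨ solve 4 (λ u v w x → (u :+ v) :- (w :+ x) := (u :- (w :+ x)) :+ v) refl (act low s (a ℕ.+ i)) (s (D ℕ.+ (a ℕ.+ i))) (act low s (suc i)) (s (D ℕ.+ suc i)) ⟩
    (act low s (a ℕ.+ i) - (act low s (suc i) + s (D ℕ.+ suc i))) + s (D ℕ.+ (a ℕ.+ i))
      ≈⟨ +-cong (sym (act-low′ s i)) (reflexive (≡.cong s (≡.trans (≡.sym (ℕₚ.+-assoc D a i)) (≡.cong (ℕ._+ i) (ℕₚ.+-comm D a))))) ⟩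
    act low′ s i + s (a ℕ.+ D ℕ.+ i) ∎
    where
    open RingSolver commutativeRing
    low′ : Poly
    low′ = shift a low +ᴾ -ᴾ ((0# ∷ low) +ᴾ shift (suc D) (1# ∷ []))
    low′≤ : length low′ ≤ a ℕ.+ D
    low′≤ = length-+ (shift a low) _ (ℕₚ.≤-trans (ℕₚ.≤-reflexive (length-shift a low)) (ℕₚ.+-monoʳ-≤ a low≤D))
      (ℕₚ.≤-trans (ℕₚ.≤-reflexive (length-neg ((0# ∷ low) +ᴾ shift (suc D) (1# ∷ []))))
        (length-+ (0# ∷ low) (shift (suc D) (1# ∷ []))
          (ℕₚ.≤-trans (s≤s low≤D) (ℕₚ.+-monoˡ-≤ D (ℕₚ.<⇒≤ 1<a)))
          (ℕₚ.≤-trans (ℕₚ.≤-reflexive (≡.trans (length-shift (suc D) (1# ∷ [])) (ℕₚ.+-comm (suc D) 1))) (ℕₚ.+-monoˡ-≤ D 1<a))))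
    act-low′ : ∀ s i → act low′ s i ≈ act low s (a ℕ.+ i) - (act low s (suc i) + s (D ℕ.+ suc i))
    act-low′ s i = trans (act-+ (shift a low) _ s i) (+-cong (act-shift^ a low s i) (trans (act-neg ((0# ∷ low) +ᴾ shift (suc D) (1# ∷ [])) s i) (-‿cong (trans (act-+ (0# ∷ low) (shift (suc D) (1# ∷ [])) s i)
      (+-cong (act-shift low s i) (trans (act-shift^ (suc D) (1# ∷ []) s i) (trans (act-ι 1# s _) (trans (*-identityˡ _) (reflexive (≡.cong s (≡.sym (ℕₚ.+-suc D i)))))))))))) 

  -- Vanishes in a field exactly when x has degree at most j over F.
  degenerate : ℕ → Poly
  degenerate zero    = R.1#
  degenerate (suc j) = (X ^ᴾ (q ℕ.^ suc j) +ᴾ -ᴾ X) *ᴾ degenerate j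

  degree : ℕ → ℕ
  degree zero    = 0
  degree (suc j) = q ℕ.^ suc j ℕ.+ degree j

  1<q^ : ∀ j → 1 < q ℕ.^ suc j
  1<q^ j = ℕₚ.<-≤-trans 1<q (ℕₚ.m≤m*n q (q ℕ.^ j) {{ℕₚ.m^n≢0 q j}})

  monic-degenerate : ∀ j → Monic (degree j) (degenerate j)
  monic-degenerate zero    = [] , z≤n , λ s i → trans (act-ι 1# s i) (trans (*-identityˡ _) (sym (+-identityˡ _)))
  monic-degenerate (suc j) = monic-step (q ℕ.^ suc j) (1<q^ j) (monic-degenerate j)

  -- A geometric sum stays below its next term; the successor makes room for the step from Q to L =
  -- Q - 1.
  degree-bound : ∀ j → suc (degree j) < q ℕ.^ suc j
  degree-bound zero    = ≡.subst (1 <_) (≡.sym (ℕₚ.*-identityʳ q)) 1<q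
  degree-bound (suc j) = ≤R.begin-strict
    suc (q ℕ.^ suc j ℕ.+ degree j)        ≤R.≡⟨ ℕₚ.+-suc _ _ ⟨
    q ℕ.^ suc j ℕ.+ suc (degree j)        ≤R.<⟨ ℕₚ.+-monoʳ-< (q ℕ.^ suc j) (degree-bound j) ⟩
    q ℕ.^ suc j ℕ.+ q ℕ.^ suc j           ≤R.≡⟨ ≡.cong (q ℕ.^ suc j ℕ.+_) (ℕₚ.+-identityʳ _) ⟨
    2 ℕ.* q ℕ.^ suc j                     ≤R.≤⟨ ℕₚ.*-monoˡ-≤ (q ℕ.^ suc j) 1<q ⟩
    q ℕ.* q ℕ.^ suc j                     ≤R.∎
    where module ≤R = ℕₚ.≤-Reasoning

  act-vanishing : ∀ y s i → (∀ j → j < length y → s (j ℕ.+ i) ≈ 0#) → act y s i ≈ 0#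
  act-vanishing []      s i h = refl
  act-vanishing (a ∷ y) s i h = trans (+-cong (trans (*-congˡ (h 0 (s≤s z≤n))) (zeroʳ a)) (act-vanishing y s (suc i) (λ j j< → trans (reflexive (≡.cong s (ℕₚ.+-suc j i))) (h (suc j) (s≤s j<))))) (+-identityˡ 0#)

  -- At i = L - D only the leading term meets the impulse: the lower exponents j give j + i strictly
  -- between 0 and L.
  monic≉0 : ∀ {D y} → D < L → Monic D y → ¬ (y ≈ᴾ [])
  monic≉0 {D} {y} D<L (low , low≤D , y≈) y≈0 = 1≉0 (begin
    1#                                            ≡⟨ s₀-multiple (≡.subst (L ∣_) (≡.sym (ℕₚ.m+[n∸m]≡n D≤L)) Div.∣-refl) ⟨
    s₀ (D ℕ.+ i)                                  ≈⟨ +-identityˡ _ ⟨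
    0# + s₀ (D ℕ.+ i)                             ≈⟨ +-congʳ (act-vanishing low s₀ i (λ j j< → reflexive (s₀-other (not-multiple j (ℕₚ.<-≤-trans j< low≤D))))) ⟨
    act low s₀ i + s₀ (D ℕ.+ i)                   ≈⟨ y≈ s₀ i ⟨
    act y s₀ i                                    ≈⟨ at y≈0 i ⟩
    0#                                            ∎)
    where
    D≤L : D ≤ L
    D≤L = ℕₚ.<⇒≤ D<L
    i : ℕ
    i = L ℕ.∸ D
    not-multiple : ∀ j → j < D → ¬ (L ∣ j ℕ.+ i)
    not-multiple j j<D h = ℕₚ.<⇒≱ (ℕₚ.<-≤-trans (ℕₚ.+-monoˡ-< i j<D) (ℕₚ.≤-reflexive (ℕₚ.m+[n∸m]≡n D≤L)))
      (Div.∣⇒≤ {{ℕ.>-nonZero (ℕₚ.<-≤-trans (ℕₚ.m<n⇒0<n∸m D<L) (ℕₚ.m≤n+m i j))}} h)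

  degenerate≉0 : ¬ (degenerate m₁ ≈ᴾ [])
  degenerate≉0 = monic≉0 (ℕₚ.∸-monoˡ-< (degree-bound m₁) (s≤s z≤n)) (monic-degenerate m₁)

-- The field with qᵐ elements.

funToFin-cong : ∀ {m n} {f g : Fin m → Fin n} → (∀ i → f i ≡ g i) → Fin.funToFin f ≡ Fin.funToFin g
funToFin-cong {zero}  h = ≡.refl
funToFin-cong {suc m} h = ≡.cong₂ Fin.combine (h zero) (funToFin-cong (h ∘ suc))

module ExtensionField {c ℓ} (F : Field c ℓ) {q : ℕ} (enum : Inverse (≡.setoid (Fin q)) (Field.setoid F))
                      {p l : ℕ} (p-prime : Prime p) (q≡pˡ : q ≡ p ℕ.^ l) (m₁ : ℕ) where
  open Field F hiding (zero)
  open FiniteField F enum using (elt; idx; elt-idx; idx-elt; idx-cong; _≟_)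
  open FiniteFieldProperties F enum using (fermat)
  open CyclicAlgebra F enum {p} {l} p-prime q≡pˡ m₁ public
  open import Relation.Binary.Reasoning.Setoid setoid

  act-ι* : ∀ a y s i → act (ι a *ᴾ y) s i ≈ a * act y s i
  act-ι* a y s i = trans (act-* (ι a) y s i) (act-ι a (act y s) i)

  act-X* : ∀ y s i → act (X *ᴾ y) s i ≈ act y s (suc i)
  act-X* y s i = trans (act-* X y s i) (act-X (act y s) i)

  act-tabulate-cong : ∀ {n} {u v : Fin n → Carrier} → (∀ j → u j ≈ v j) → ∀ s i → act (tabulate u) s i ≈ act (tabulate v) s i
  act-tabulate-cong {zero}  h s i = refl
  act-tabulate-cong {suc n} h s i = +-cong (*-congʳ (h zero)) (act-tabulate-cong (h ∘ suc) s (suc i))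

  act-tabulate-last : ∀ {n} (v : Fin (suc n) → Carrier) s i →
    act (tabulate v) s i ≈ act (tabulate (v ∘ Fin.inject₁)) s i + v (Fin.fromℕ n) * s (n ℕ.+ i)
  act-tabulate-last {zero}  v s i = +-comm _ _
  act-tabulate-last {suc n} v s i = trans (+-congˡ (act-tabulate-last (v ∘ suc) s (suc i)))
    (trans (sym (+-assoc _ _ _)) (+-congˡ (*-congˡ (reflexive (≡.cong s (ℕₚ.+-suc n i))))))

  act-tabulate-linear : ∀ {n} a (u v : Fin n → Carrier) s i →
    act (tabulate (λ j → a * u j + v j)) s i ≈ a * act (tabulate u) s i + act (tabulate v) s i
  act-tabulate-linear {zero}  a u v s i = sym (trans (+-congʳ (zeroʳ a)) (+-identityˡ 0#))
  act-tabulate-linear {suc n} a u v s i = trans (+-congˡ (act-tabulate-linear a (u ∘ suc) (v ∘ suc) s (suc i)))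
    (solve 6 (λ a u v s x y → (a :* u :+ v) :* s :+ (a :* x :+ y) := a :* (u :* s :+ x) :+ (v :* s :+ y)) refl a (u zero) (v zero) (s i) (act (tabulate (u ∘ suc)) s (suc i)) (act (tabulate (v ∘ suc)) s (suc i)))
    where open RingSolver commutativeRing

  act-tabulate-0 : ∀ n s i → act (tabulate {n = n} (λ _ → 0#)) s i ≈ 0#
  act-tabulate-0 zero    s i = refl
  act-tabulate-0 (suc n) s i = trans (+-cong (zeroˡ _) (act-tabulate-0 n s (suc i))) (+-identityˡ 0#)

  private
    L₁ : ℕ
    L₁ = L ℕ.∸ 1

    1+L₁≡L : suc L₁ ≡ L
    1+L₁≡L = ℕₚ.m+[n∸m]≡n 1≤L

    -- Multiplication by x rotates a vector of L coefficients, the last one returning as constant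
    -- term since x^L = 1. This gives the finite list over which `settle` runs.
    cover : ∀ y → ∃ λ (v : Fin (suc L₁) → Carrier) → y ≈ᴾ tabulate v
    cover []      = (λ _ → 0#) , equal λ i → sym (act-tabulate-0 (suc L₁) s₀ i)
    cover (a ∷ y) with cover y
    ... | v , y≈v = v′ , equal λ i → begin
      a * s₀ i + act y s₀ (suc i)
        ≈⟨ +-congˡ (trans (at y≈v (suc i)) (act-tabulate-last v s₀ (suc i))) ⟩
      a * s₀ i + (act (tabulate (v ∘ Fin.inject₁)) s₀ (suc i) + v (Fin.fromℕ L₁) * s₀ (L₁ ℕ.+ suc i))
        ≈⟨ +-congˡ (+-congˡ (*-congˡ (reflexive (≡.trans (≡.cong s₀ (≡.trans (ℕₚ.+-suc L₁ i) (≡.cong (ℕ._+ i) 1+L₁≡L))) (s₀-period i))))) ⟩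
      a * s₀ i + (act (tabulate (v ∘ Fin.inject₁)) s₀ (suc i) + v (Fin.fromℕ L₁) * s₀ i)
        ≈⟨ solve 4 (λ a s x b → a :* s :+ (x :+ b :* s) := (a :+ b) :* s :+ x) refl a (s₀ i) (act (tabulate (v ∘ Fin.inject₁)) s₀ (suc i)) (v (Fin.fromℕ L₁)) ⟩
      (a + v (Fin.fromℕ L₁)) * s₀ i + act (tabulate (v ∘ Fin.inject₁)) s₀ (suc i) ∎
      where
      open RingSolver commutativeRing
      v′ : Fin (suc L₁) → Carrier
      v′ zero    = a + v (Fin.fromℕ L₁)
      v′ (suc j) = v (Fin.inject₁ j)

  element : ∀ n → Fin (q ℕ.^ n) → Poly
  element n i = tabulate (λ j → elt (Fin.finToFun {q} {n} i j))

  element-of : ∀ {n} (v : Fin n → Carrier) → tabulate v ≈ᴾ element n (Fin.funToFin (idx ∘ v))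
  element-of v = equal (act-tabulate-cong (λ j → sym (trans (reflexive (≡.cong elt (Finₚ.finToFun-funToFin (idx ∘ v) j))) (elt-idx (v j)))) s₀)

  private
    n₂ : ℕ
    n₂ = Q ℕ.∸ 2

    Q≡2+n₂ : Q ≡ suc (suc n₂)
    Q≡2+n₂ = ≡.sym (ℕₚ.m+[n∸m]≡n 1<Q)

    module S = Settling polynomialRing n₂

    fixed₂ : ∀ y → y ^ᴾ suc (suc n₂) ≈ᴾ y
    fixed₂ y = R.trans (^ᴾ-congʳ y (≡.sym Q≡2+n₂)) (fixed y)

  -- The construction passes through all q^L polynomials and must never be evaluated; only the three
  -- properties of w below are used.
  abstract
    private
      settled-at : ∃ λ v → ¬ (degenerate m₁ *ᴾ v ≈ᴾ []) × (∀ i → S.Settled (degenerate m₁ *ᴾ v) (element (suc L₁) i))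
      settled-at = S.settle fixed₂ (λ x → x ≟ᴾ []) (q ℕ.^ suc L₁) (element (suc L₁)) (degenerate m₁) degenerate≉0

    w : Poly
    w = degenerate m₁ *ᴾ proj₁ settled-at

    w≉0 : ¬ (w ≈ᴾ [])
    w≉0 = proj₁ (proj₂ settled-at)

    w-multiple : ∃ λ v → w ≈ᴾ degenerate m₁ *ᴾ v
    w-multiple = proj₁ settled-at , R.refl

    w-settled : ∀ y → w *ᴾ y ≈ᴾ [] ⊎ w *ᴾ (y ^ᴾ suc n₂) ≈ᴾ w
    w-settled y = let v , y≈v = cover y in
      S.Settled-resp (R.sym (R.trans y≈v (element-of v))) (proj₂ (proj₂ settled-at) (Fin.funToFin (idx ∘ v)))

  open Localisation polynomialRing w public

  -- A y that w does not kill satisfies w y^(Q - 1) = w, so its inverse is y^(Q - 2).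
  K : Field c ℓ
  K = record
    { commutativeRing = localisation
    ; 1≉0 = λ h → w≉0 (R.trans (R.sym (R.*-identityʳ w)) (R.trans (by h) (R.zeroʳ w)))
    ; inverse = λ y y≉0 → y ^ᴾ n₂ , invert y y≉0 (w-settled y)
    }
    where
    invert : ∀ y → ¬ (y ≈ʷ []) → w *ᴾ y ≈ᴾ [] ⊎ w *ᴾ (y ^ᴾ suc n₂) ≈ᴾ w → y *ᴾ (y ^ᴾ n₂) ≈ʷ R.1#
    invert y y≉0 (inj₁ h) = ⊥-elim (y≉0 (seen (R.trans h (R.sym (R.zeroʳ w)))))
    invert y y≉0 (inj₂ h) = seen (R.trans h (R.sym (R.*-identityʳ w)))

  module K = Field K
  module KP = FieldProperties K

  ^≡ : ∀ y n → y KP.^ n ≡ y ^ᴾ n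
  ^≡ y zero    = ≡.refl
  ^≡ y (suc n) = ≡.cong (y *ᴾ_) (^≡ y n)

  infix 4 _≟ʷ_
  _≟ʷ_ : ∀ x y → Dec (x ≈ʷ y)
  x ≟ʷ y = map′ seen by (w *ᴾ x ≟ᴾ w *ᴾ y)

  fixedᴷ : ∀ y → y KP.^ Q ≈ʷ y
  fixedᴷ y = K.trans (K.reflexive (^≡ y Q)) (≈⇒≈ʷ (fixed y))

  additiveᴷ : ∀ x y → (x +ᴾ y) KP.^ q ≈ʷ x KP.^ q +ᴾ y KP.^ q
  additiveᴷ x y = K.trans (K.reflexive (^≡ (x +ᴾ y) q)) (K.trans (≈⇒≈ʷ (additive-q x y)) (K.reflexive (≡.sym (≡.cong₂ _+ᴾ_ (^≡ x q) (^≡ y q)))))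

  ι-fixed : ∀ a → ι a KP.^ q ≈ʷ ι a
  ι-fixed a = K.trans (K.reflexive (^≡ (ι a) q)) (≈⇒≈ʷ (R.trans (R.sym (ι-^ a q)) (ι-cong (fermat a))))

  degenerate-factor : ∀ {r} j → r < j → ∃ λ u → degenerate j ≈ᴾ (X ^ᴾ (q ℕ.^ suc r) +ᴾ -ᴾ X) *ᴾ u
  degenerate-factor {r} (suc j) r<1+j with r ℕ.≟ j
  ... | yes ≡.refl = degenerate j , R.refl
  ... | no r≢j with degenerate-factor j (ℕₚ.≤∧≢⇒< (ℕₚ.≤-pred r<1+j) r≢j)
  ... | u , e = (X ^ᴾ (q ℕ.^ suc j) +ᴾ -ᴾ X) *ᴾ u , R.trans (R.*-congˡ {X ^ᴾ (q ℕ.^ suc j) +ᴾ -ᴾ X} e)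
    (solve 3 (λ a b u → a :* (b :* u) := b :* (a :* u)) R.refl (X ^ᴾ (q ℕ.^ suc j) +ᴾ -ᴾ X) (X ^ᴾ (q ℕ.^ suc r) +ᴾ -ᴾ X) u)
    where open RingSolver polynomialRing

  -- Otherwise w kills the factor T of `degenerate m₁`, and thereby every multiple of T, including w
  -- itself. But w² = 0 contradicts w^Q = w ≠ 0.
  X-moved : ∀ r → r < m₁ → ¬ (X KP.^ (q ℕ.^ suc r) ≈ʷ X)
  X-moved r r<m₁ h = w≉0 (R.trans (R.sym (fixed₂ w)) (R.trans (R.sym (R.*-assoc w w (w ^ᴾ n₂))) (R.trans (R.*-congʳ {w ^ᴾ n₂} ww≈0) (R.zeroˡ (w ^ᴾ n₂)))))
    where
    T : Poly
    T = X ^ᴾ (q ℕ.^ suc r) +ᴾ -ᴾ X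
    T≈0 : T ≈ʷ []
    T≈0 = K.trans (K.+-congʳ (K.trans (K.reflexive (≡.sym (^≡ X (q ℕ.^ suc r)))) h)) (K.-‿inverseʳ X)
    ww≈0 : w *ᴾ w ≈ᴾ []
    ww≈0 = let v , w≈ = w-multiple
               u , d≈ = degenerate-factor m₁ r<m₁
           in R.trans (R.*-congˡ {w} (R.trans w≈ (R.trans (R.*-congʳ {v} d≈) (R.*-assoc T u v))))
                (R.trans (R.sym (R.*-assoc w T (u *ᴾ v))) (R.trans (R.*-congʳ {u *ᴾ v} (R.trans (by T≈0) (R.zeroʳ w))) (R.zeroˡ (u *ᴾ v))))

  X^q^ : ℕ → Poly
  X^q^ i = X KP.^ (q ℕ.^ i)

  X^q^-+ : ∀ i j → X^q^ (i ℕ.+ j) ≈ʷ X^q^ i KP.^ (q ℕ.^ j)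
  X^q^-+ i j = K.trans (KP.^-congʳ X (ℕₚ.^-distribˡ-+-* q i j)) (K.sym (KP.^-assocʳ X (q ℕ.^ i) (q ℕ.^ j)))

  X^q^m≈X : X^q^ m ≈ʷ X
  X^q^m≈X = fixedᴷ X

  -- Raising an equality to the power q^(m - i) turns the left side into x^(q^m) = x and the right
  -- side into x^(q^(j - i)), and 0 < j - i < m is excluded by `X-moved`.
  X^q^-distinct : ∀ {i j} → i < j → j ≤ m₁ → ¬ (X^q^ i ≈ʷ X^q^ j)
  X^q^-distinct {i} {j} i<j j≤m₁ h = X-moved r (ℕₚ.≤-trans (ℕₚ.≤-trans (ℕₚ.m≤m+n (suc r) i) (ℕₚ.≤-reflexive j≡)) j≤m₁) (KR.begin
    X^q^ (suc r)                       KR.≈⟨ KP.^-congˡ (q ℕ.^ suc r) X^q^m≈X ⟨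
    X^q^ m KP.^ (q ℕ.^ suc r)          KR.≈⟨ X^q^-+ m (suc r) ⟨
    X^q^ (m ℕ.+ suc r)                 KR.≡⟨ ≡.cong X^q^ shuffle ⟩
    X^q^ (j ℕ.+ e)                     KR.≈⟨ X^q^-+ j e ⟩
    X^q^ j KP.^ (q ℕ.^ e)              KR.≈⟨ KP.^-congˡ (q ℕ.^ e) h ⟨
    X^q^ i KP.^ (q ℕ.^ e)              KR.≈⟨ X^q^-+ i e ⟨
    X^q^ (i ℕ.+ e)                     KR.≡⟨ ≡.cong X^q^ (ℕₚ.m+[n∸m]≡n i≤m) ⟩
    X^q^ m                             KR.≈⟨ X^q^m≈X ⟩
    X                                  KR.∎)
    where
    import Relation.Binary.Reasoning.Setoid K.setoid as KR
    r e : ℕ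
    r = j ℕ.∸ suc i
    e = m ℕ.∸ i
    i≤m : i ≤ m
    i≤m = ℕₚ.≤-trans (ℕₚ.<⇒≤ i<j) (ℕₚ.≤-trans j≤m₁ (ℕₚ.n≤1+n m₁))
    j≡ : suc r ℕ.+ i ≡ j
    j≡ = ≡.trans (≡.sym (ℕₚ.+-suc r i)) (ℕₚ.m∸n+n≡m i<j)
    shuffle : m ℕ.+ suc r ≡ j ℕ.+ e
    shuffle = ≡.trans (≡.cong (ℕ._+ suc r) (≡.sym (ℕₚ.m+[n∸m]≡n i≤m))) (≡.trans (lem i e (suc r)) (≡.cong (ℕ._+ e) j≡))
      where
      lem : ∀ i e r → i ℕ.+ e ℕ.+ r ≡ r ℕ.+ i ℕ.+ e
      lem = solve-∀

  -- The power q is additive and fixes the coefficients, which come from F; hence it maps roots to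
  -- roots.
  monic-frobenius : ∀ as y → KP.monic (map ι as) (y KP.^ q) ≈ʷ KP.monic (map ι as) y KP.^ q
  monic-frobenius []       y = K.sym (KP.1^n≈1 q)
  monic-frobenius (a ∷ as) y = K.sym (K.trans (additiveᴷ (ι a) _) (K.+-cong (ι-fixed a) (K.trans (KP.^-distrib-* y _ q) (K.*-congˡ (K.sym (monic-frobenius as y))))))

  monic-roots : ∀ as → KP.monic (map ι as) X ≈ʷ [] → ∀ i → KP.monic (map ι as) (X^q^ i) ≈ʷ []
  monic-roots as h zero    = K.trans (KP.monic-cong (map ι as) (K.*-identityʳ X)) h
  monic-roots as h (suc i) = K.trans (KP.monic-cong (map ι as) (K.trans (KP.^-congʳ X (ℕₚ.*-comm q (q ℕ.^ i))) (K.sym (KP.^-assocʳ X (q ℕ.^ i) q))))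
    (K.trans (monic-frobenius as (X^q^ i)) (K.trans (KP.^-congˡ q (monic-roots as h i)) 0^q≈0))
    where
    0^q≈0 : [] KP.^ q ≈ʷ []
    0^q≈0 = K.trans (KP.^-congʳ [] (≡.sym (ℕₚ.m+[n∸m]≡n (ℕₚ.<⇒≤ 1<q)))) (K.zeroˡ _)

  -- A monic relation of degree r < m would have the r + 1 distinct roots x, x^q, ..., x^(q^r).
  no-relation : ∀ as → length as ≤ m₁ → ¬ (KP.monic (map ι as) X ≈ʷ [])
  no-relation as as≤m₁ h = KP.root-bound (length as) (map ι as) (Listₚ.length-map ι as) (X^q^ ∘ Fin.toℕ) injective (monic-roots as h ∘ Fin.toℕ)
    where
    bound : ∀ (i : Fin (suc (length as))) → Fin.toℕ i ≤ m₁
    bound i = ℕₚ.≤-trans (ℕₚ.≤-pred (Finₚ.toℕ<n i)) as≤m₁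
    injective : ∀ {i j : Fin (suc (length as))} → X^q^ (Fin.toℕ i) ≈ʷ X^q^ (Fin.toℕ j) → i ≡ j
    injective {i} {j} e with ℕₚ.<-cmp (Fin.toℕ i) (Fin.toℕ j)
    ... | tri< i<j _ _ = ⊥-elim (X^q^-distinct i<j (bound j) e)
    ... | tri≈ _ i≡j _ = Finₚ.toℕ-injective i≡j
    ... | tri> _ _ j<i = ⊥-elim (X^q^-distinct j<i (bound i) (K.sym e))

  act-monic : ∀ as s i → act (KP.monic (map ι as) X) s i ≈ act as s i + s (length as ℕ.+ i)
  act-monic []       s i = trans (act-ι 1# s i) (trans (*-identityˡ _) (sym (+-identityˡ _)))
  act-monic (a ∷ as) s i = begin
    act (ι a +ᴾ X *ᴾ KP.monic (map ι as) X) s i                     ≈⟨ act-+ (ι a) _ s i ⟩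
    act (ι a) s i + act (X *ᴾ KP.monic (map ι as) X) s i            ≈⟨ +-cong (act-ι a s i) (act-X* (KP.monic (map ι as) X) s i) ⟩
    a * s i + act (KP.monic (map ι as) X) s (suc i)                 ≈⟨ +-congˡ (act-monic as s (suc i)) ⟩
    a * s i + (act as s (suc i) + s (length as ℕ.+ suc i))          ≈⟨ +-assoc _ _ _ ⟨
    a * s i + act as s (suc i) + s (length as ℕ.+ suc i)            ≡⟨ ≡.cong (λ k → a * s i + act as s (suc i) + s k) (ℕₚ.+-suc (length as) i) ⟩
    a * s i + act as s (suc i) + s (suc (length as ℕ.+ i))          ∎

  -- A vanishing last coefficient is dropped; a nonzero one is divided out, which leaves a monic
  -- relation for x.
  independent : ∀ n → n ≤ m → (v : Fin n → Carrier) → tabulate v ≈ʷ [] → ∀ i → v i ≈ 0#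
  independent (suc n) (s≤s n≤m₁) v h with v (Fin.fromℕ n) ≟ 0#
  ... | yes c≈0 = all
    where
    init≈0 : tabulate (v ∘ Fin.inject₁) ≈ʷ []
    init≈0 = K.trans (≈⇒≈ʷ (equal λ i → sym (trans (act-tabulate-last v s₀ i) (trans (+-congˡ (trans (*-congʳ c≈0) (zeroˡ _))) (+-identityʳ _))))) h
    all : ∀ i → v i ≈ 0#
    all i with Top.view i
    ... | Top.‵fromℕ     = c≈0
    ... | Top.‵inject₁ j = independent n (ℕₚ.≤-trans n≤m₁ (ℕₚ.n≤1+n m₁)) (v ∘ Fin.inject₁) init≈0 j
  ... | no c≉0 = ⊥-elim (no-relation (tabulate u) (ℕₚ.≤-trans (ℕₚ.≤-reflexive (Listₚ.length-tabulate u)) n≤m₁) (K.trans (≈⇒≈ʷ normalised) (K.trans (K.*-congˡ {ι c⁻¹} h) (K.zeroʳ _))))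
    where
    c′ c⁻¹ : Carrier
    c′ = v (Fin.fromℕ n)
    c⁻¹ = proj₁ (inverse c′ c≉0)
    -- The summand `0#` gives u the shape treated by `act-tabulate-linear`.
    u : Fin n → Carrier
    u j = c⁻¹ * v (Fin.inject₁ j) + 0#
    normalised : KP.monic (map ι (tabulate u)) X ≈ᴾ ι c⁻¹ *ᴾ tabulate v
    normalised = equal λ i → begin
      act (KP.monic (map ι (tabulate u)) X) s₀ i
        ≈⟨ act-monic (tabulate u) s₀ i ⟩
      act (tabulate u) s₀ i + s₀ (length (tabulate u) ℕ.+ i)
        ≈⟨ +-cong (trans (act-tabulate-linear c⁻¹ (v ∘ Fin.inject₁) (λ _ → 0#) s₀ i) (trans (+-congˡ (act-tabulate-0 n s₀ i)) (+-identityʳ _)))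
             (trans (reflexive (≡.cong (λ k → s₀ (k ℕ.+ i)) (Listₚ.length-tabulate u))) (trans (sym (*-identityˡ _)) (*-congʳ (sym (trans (*-comm _ _) (proj₂ (inverse c′ c≉0))))))) ⟩
      c⁻¹ * act (tabulate (v ∘ Fin.inject₁)) s₀ i + c⁻¹ * c′ * s₀ (n ℕ.+ i)
        ≈⟨ trans (+-congˡ (*-assoc _ _ _)) (sym (distribˡ _ _ _)) ⟩
      c⁻¹ * (act (tabulate (v ∘ Fin.inject₁)) s₀ i + c′ * s₀ (n ℕ.+ i))
        ≈⟨ *-congˡ (act-tabulate-last v s₀ i) ⟨
      c⁻¹ * act (tabulate v) s₀ i
        ≈⟨ act-ι* c⁻¹ (tabulate v) s₀ i ⟨
      act (ι c⁻¹ *ᴾ tabulate v) s₀ i ∎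

  tabulate-injective : ∀ {u v : Fin m → Carrier} → tabulate u ≈ʷ tabulate v → ∀ i → u i ≈ v i
  tabulate-injective {u} {v} h i = FP.x-y≈0⇒x≈y (trans (+-comm _ _) (trans (+-congʳ (trans (-‿cong (sym (*-identityˡ _))) (-‿distribˡ-* 1# (v i)))) (independent m ℕₚ.≤-refl (λ j → - 1# * v j + u j)
    (K.trans (≈⇒≈ʷ (equal λ i → trans (act-tabulate-linear (- 1#) v u s₀ i) (sym (trans (act-+ (ι (- 1#) *ᴾ tabulate v) (tabulate u) s₀ i) (+-congʳ (act-ι* (- 1#) (tabulate v) s₀ i))))))
      (K.trans (K.+-congˡ h) (≈⇒≈ʷ (equal λ i → trans (act-+ (ι (- 1#) *ᴾ tabulate v) (tabulate v) s₀ i) (trans (+-congʳ (trans (act-ι* (- 1#) (tabulate v) s₀ i) (trans (sym (-‿distribˡ-* _ _)) (-‿cong (*-identityˡ _))))) (-‿inverseˡ _)))))) i)))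
    where
    module FP = FieldProperties F
    open import Algebra.Properties.Ring ring using (-‿distribˡ-*)

  element-injective : ∀ {i j} → element m i ≈ʷ element m j → i ≡ j
  element-injective {i} {j} h = ≡.trans (≡.sym (Finₚ.funToFin-finToFin {m} {q} i)) (≡.trans (funToFin-cong digits) (Finₚ.funToFin-finToFin {m} {q} j))
    where
    digits : ∀ t → Fin.finToFun {q} {m} i t ≡ Fin.finToFun {q} {m} j t
    digits t = ≡.trans (≡.sym (idx-elt (Fin.finToFun {q} {m} i t))) (≡.trans (idx-cong (tabulate-injective {λ t → elt (Fin.finToFun {q} {m} i t)} {λ t → elt (Fin.finToFun {q} {m} j t)} h t)) (idx-elt (Fin.finToFun {q} {m} j t)))

  abstract
    -- All elements of K are roots of x^Q - x. The Q combinations of 1, x, ..., x^(m - 1) are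
    -- already Q distinct roots, so a further y would be one root too many.
    span : ∀ y → ∃ λ i → element m i ≈ʷ y
    span y with Finₚ.any? (λ i → element m i ≟ʷ y)
    ... | yes h = h
    ... | no ∄ = ⊥-elim (KP.root-bound Q coefficients length-coefficients f f-injective roots)
      where
      coefficients : List Poly
      coefficients = [] ∷ (-ᴾ R.1#) ∷ replicate n₂ []
      length-coefficients : length coefficients ≡ Q
      length-coefficients = ≡.trans (≡.cong (λ n → suc (suc n)) (Listₚ.length-replicate n₂ {[]})) (≡.sym Q≡2+n₂)
      f : Fin (suc Q) → Poly
      f zero    = y
      f (suc i) = element m i
      f-injective : ∀ {i j} → f i ≈ʷ f j → i ≡ j
      f-injective {zero}  {zero}  h = ≡.refl
      f-injective {zero}  {suc j} h = ⊥-elim (∄ (j , K.sym h))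
      f-injective {suc i} {zero}  h = ⊥-elim (∄ (i , h))
      f-injective {suc i} {suc j} h = ≡.cong suc (element-injective h)
      roots : ∀ i → KP.monic coefficients (f i) ≈ʷ []
      roots i = root (f i)
        where
        root : ∀ z → KP.monic coefficients z ≈ʷ []
        root z = K.trans (K.+-identityˡ _) (K.trans (K.distribˡ z _ _) (K.trans (K.+-congˡ (K.trans (K.*-congˡ (K.*-congˡ (KP.monic-^ n₂ z))) (K.trans (KP.^-congʳ z (≡.sym Q≡2+n₂)) (fixedᴷ z))))
          (K.trans (K.+-congʳ (K.trans (K.sym (-‿distribʳ-* z R.1#)) (K.-‿cong (K.*-identityʳ z)))) (K.-‿inverseˡ z))))
          where open import Algebra.Properties.Ring K.ring using (-‿distribʳ-*)

  enumᴷ : Inverse (≡.setoid (Fin Q)) K.setoid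
  enumᴷ = record
    { to = element m
    ; from = λ y → proj₁ (span y)
    ; to-cong = λ { ≡.refl → K.refl }
    ; from-cong = λ {x} {y} h → element-injective (K.trans (proj₂ (span x)) (K.trans h (K.sym (proj₂ (span y)))))
    ; inverse = (λ { {y} ≡.refl → proj₂ (span y) }) , (λ {i} {y} h → element-injective (K.trans (proj₂ (span y)) h))
    }

-- The regular representation of the extension field.

module Representation {c ℓ} (F : Field c ℓ) {q : ℕ} (enum : Inverse (≡.setoid (Fin q)) (Field.setoid F))
                      {p l : ℕ} (p-prime : Prime p) (q≡pˡ : q ≡ p ℕ.^ l) (m₁ : ℕ) where
  open Field F hiding (zero)
  open FiniteField F enum using (elt)
  open MatrixRing F
  open ExtensionField F enum {p} {l} p-prime q≡pˡ m₁
  open import Relation.Binary.Reasoning.Setoid setoid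

  coords : Poly → Fin m → Carrier
  coords y j = elt (Fin.finToFun {q} {m} (proj₁ (span y)) j)

  coords-unique : ∀ {y} {u : Fin m → Carrier} → tabulate u ≈ʷ y → ∀ i → coords y i ≈ u i
  coords-unique {y} {u} h = tabulate-injective {coords y} {u} (K.trans (proj₂ (span y)) (K.sym h))

  coords-cong : ∀ {y z} → y ≈ʷ z → ∀ i → coords y i ≈ coords z i
  coords-cong {y} {z} h = coords-unique (K.trans (proj₂ (span z)) (K.sym h))

  coords-linear : ∀ a y z i → coords (ι a *ᴾ y +ᴾ z) i ≈ a * coords y i + coords z i
  coords-linear a y z = coords-unique {u = λ i → a * coords y i + coords z i}
    (K.trans (≈⇒≈ʷ (equal λ i → trans (act-tabulate-linear a (coords y) (coords z) s₀ i) (sym (trans (act-+ (ι a *ᴾ tabulate (coords y)) (tabulate (coords z)) s₀ i) (+-congʳ (act-ι* a (tabulate (coords y)) s₀ i))))))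
      (K.+-cong (K.*-congˡ (proj₂ (span y))) (proj₂ (span z))))

  coords-0 : ∀ i → coords [] i ≈ 0#
  coords-0 = coords-unique {u = λ _ → 0#} (≈⇒≈ʷ (equal (act-tabulate-0 m s₀)))

  coords-+ : ∀ y z i → coords (y +ᴾ z) i ≈ coords y i + coords z i
  coords-+ y z i = trans (coords-cong (K.+-congʳ (K.sym (K.*-identityˡ y))) i) (trans (coords-linear 1# y z i) (+-congʳ (*-identityˡ _)))

  coords-ι* : ∀ a y i → coords (ι a *ᴾ y) i ≈ a * coords y i
  coords-ι* a y i = trans (coords-cong (K.sym (K.+-identityʳ (ι a *ᴾ y))) i) (trans (coords-linear a y [] i) (trans (+-congˡ (coords-0 i)) (+-identityʳ _)))

  coords-* : ∀ n (u : Fin n → Carrier) y i → coords (y *ᴾ tabulate u) i ≈ Σᶠ (λ t → coords (y *ᴾ (X ^ᴾ Fin.toℕ t)) i * u t)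
  coords-* zero    u y i = trans (coords-cong (K.zeroʳ y) i) (coords-0 i)
  coords-* (suc n) u y i = begin
    coords (y *ᴾ (u zero ∷ tabulate (u ∘ suc))) i
      ≈⟨ coords-cong (K.trans (K.*-congˡ (≈⇒≈ʷ (∷-split (u zero) (tabulate (u ∘ suc))))) (solve 4 (λ y a x t → y :* (a :+ x :* t) := a :* y :+ (y :* x) :* t) K.refl y (ι (u zero)) X (tabulate (u ∘ suc)))) i ⟩
    coords (ι (u zero) *ᴾ y +ᴾ (y *ᴾ X) *ᴾ tabulate (u ∘ suc)) i
      ≈⟨ coords-linear (u zero) y _ i ⟩
    u zero * coords y i + coords ((y *ᴾ X) *ᴾ tabulate (u ∘ suc)) i
      ≈⟨ +-cong (trans (*-comm _ _) (*-congʳ (coords-cong (K.sym (K.*-identityʳ y)) i)))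
           (trans (coords-* n (u ∘ suc) (y *ᴾ X) i) (Σᶠ-cong {n} (λ t → *-congʳ (coords-cong (K.*-assoc y X (X ^ᴾ Fin.toℕ t)) i)))) ⟩
    coords (y *ᴾ (X ^ᴾ 0)) i * u zero + Σᶠ (λ t → coords (y *ᴾ (X ^ᴾ Fin.toℕ (suc t))) i * u (suc t)) ∎
    where open RingSolver localisation

  -- The matrix of multiplication by y in the basis 1, x, ..., x^(m - 1) of K over F.
  ρ : Poly → Mat m
  ρ y i j = coords (y *ᴾ (X ^ᴾ Fin.toℕ j)) i

  ρ-cong : ∀ {y z} → y ≈ʷ z → ρ y ≈ᴹ ρ z
  ρ-cong h i j = coords-cong (K.*-congʳ h) i

  ρ-+ : ∀ y z → ρ (y +ᴾ z) ≈ᴹ (ρ y +ᴹ ρ z)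
  ρ-+ y z i j = trans (coords-cong (K.distribʳ (X ^ᴾ Fin.toℕ j) y z) i) (coords-+ _ _ i)

  ρ-* : ∀ y z → ρ (y *ᴾ z) ≈ᴹ (ρ y *ᴹ ρ z)
  ρ-* y z i j = trans (coords-cong (K.trans (K.*-assoc y z (X ^ᴾ Fin.toℕ j)) (K.*-congˡ (K.sym (proj₂ (span (z *ᴾ (X ^ᴾ Fin.toℕ j))))))) i)
    (coords-* m (coords (z *ᴾ (X ^ᴾ Fin.toℕ j))) y i)

  act-unit : ∀ {n} (j : Fin n) s i → act (tabulate (λ t → Iᴹ t j)) s i ≈ s (Fin.toℕ j ℕ.+ i)
  act-unit {suc n} zero    s i = trans (+-cong (*-identityˡ _) (act-tabulate-0 n s (suc i))) (+-identityʳ _)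
  act-unit {suc n} (suc j) s i = trans (+-cong (zeroˡ _) (trans (act-tabulate-cong (λ t → reflexive (Iᴹ-suc t j)) s (suc i)) (act-unit j s (suc i)))) (trans (+-identityˡ _) (reflexive (≡.cong s (ℕₚ.+-suc (Fin.toℕ j) i))))

  coords-X^ : ∀ i (j : Fin m) → coords (X ^ᴾ Fin.toℕ j) i ≈ Iᴹ i j
  coords-X^ i j = coords-unique {u = λ t → Iᴹ t j} (≈⇒≈ʷ (equal λ i → trans (act-unit j s₀ i) (sym (act-X^ (Fin.toℕ j) s₀ i)))) i

  ρ-ι : ∀ a → ρ (ι a) ≈ᴹ scalar a
  ρ-ι a i j = trans (coords-ι* a (X ^ᴾ Fin.toℕ j) i) (*-congˡ (coords-X^ i j))

  ρ-^ : ∀ y n → ρ (y KP.^ n) ≈ᴹ (ρ y ^ᴹ n)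
  ρ-^ y zero    = M.trans (ρ-ι 1#) (λ i j → *-identityˡ _)
  ρ-^ y (suc n) = M.trans (ρ-* y (y KP.^ n)) (M.*-congˡ {x = ρ y} (ρ-^ y n))

  -- Elements of F act on K as scalar matrices, so ρ carries an equation xᵏ + yᵏ = a in K over to
  -- matrices.
  scalar-sum : ∀ k → 1 ≤ k → ∀ g → g ≡ gcd k (Q ℕ.∸ 1) → g ℕ.^ 4 ℕ.+ 4 < Q → ∀ a → ¬ (a ≈ 0#) → ∃₂ λ (A B : Mat m) → ((A ^ᴹ k) +ᴹ (B ^ᴹ k)) ≈ᴹ scalar a
  scalar-sum k 1≤k g g≡ g⁴+4<Q a a≉0 =
    let x , y , x^k+y^k≈a = SumOfTwoPowers.sum-of-two-powers K enumᴷ k 1≤k (ι a) ιa≉0 g g≡ g⁴+4<Q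
    in ρ x , ρ y , represent x y x^k+y^k≈a
    where
    represent : ∀ x y → x KP.^ k +ᴾ y KP.^ k ≈ʷ ι a → ((ρ x ^ᴹ k) +ᴹ (ρ y ^ᴹ k)) ≈ᴹ scalar a
    represent x y h i j = trans (+-cong (sym (ρ-^ x k i j)) (sym (ρ-^ y k i j))) (trans (sym (ρ-+ (x KP.^ k) (y KP.^ k) i j)) (trans (ρ-cong h i j) (ρ-ι a i j)))
    ιa≉0 : ¬ (ι a ≈ʷ [])
    ιa≉0 h = let b , ab≈1 = inverse a a≉0 in
      K.1≉0 (K.trans (≈⇒≈ʷ (R.trans (ι-cong (sym ab≈1)) (ι-* a b))) (K.trans (K.*-congʳ {ι b} h) (K.zeroˡ _)))

-- Block diagonal matrices.

module BlockDiagonal {c ℓ} (F : Field c ℓ) where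
  open Field F hiding (zero)
  open MatrixRing F

  module _ {a b : ℕ} where

    blocks : Mat a → Mat b → Fin a ⊎ Fin b → Fin a ⊎ Fin b → Carrier
    blocks A B (inj₁ i) (inj₁ j) = A i j
    blocks A B (inj₁ i) (inj₂ j) = 0#
    blocks A B (inj₂ i) (inj₁ j) = 0#
    blocks A B (inj₂ i) (inj₂ j) = B i j

    infixl 6 _⊕_
    _⊕_ : Mat a → Mat b → Mat (a ℕ.+ b)
    (A ⊕ B) i j = blocks A B (Fin.splitAt a i) (Fin.splitAt a j)

    ⊕-cong : ∀ {A C B D} → A ≈ᴹ C → B ≈ᴹ D → (A ⊕ B) ≈ᴹ (C ⊕ D)
    ⊕-cong h h′ i j with Fin.splitAt a i | Fin.splitAt a j
    ... | inj₁ x | inj₁ y = h x y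
    ... | inj₁ x | inj₂ y = refl
    ... | inj₂ x | inj₁ y = refl
    ... | inj₂ x | inj₂ y = h′ x y

    ⊕-+ : ∀ A B C D → ((A ⊕ B) +ᴹ (C ⊕ D)) ≈ᴹ ((A +ᴹ C) ⊕ (B +ᴹ D))
    ⊕-+ A B C D i j with Fin.splitAt a i | Fin.splitAt a j
    ... | inj₁ x | inj₁ y = refl
    ... | inj₁ x | inj₂ y = +-identityˡ 0#
    ... | inj₂ x | inj₁ y = +-identityˡ 0#
    ... | inj₂ x | inj₂ y = refl

    private
      blocks-I : ∀ x y → blocks Iᴹ Iᴹ x y ≡ Iᴹ (Fin.join a b x) (Fin.join a b y)
      blocks-I (inj₁ x) (inj₁ y) with x Fin.≟ y
      ... | yes ≡.refl = ≡.sym (Iᴹ-diagonal (x Fin.↑ˡ b))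
      ... | no x≢y     = ≡.sym (Iᴹ-off (λ e → x≢y (Finₚ.↑ˡ-injective b x y e)))
      blocks-I (inj₁ x) (inj₂ y) = ≡.sym (Iᴹ-off (λ e → different (≡.trans (≡.sym (Finₚ.splitAt-↑ˡ a x b)) (≡.trans (≡.cong (Fin.splitAt a) e) (Finₚ.splitAt-↑ʳ a b y)))))
        where
        different : inj₁ x ≢ inj₂ y
        different ()
      blocks-I (inj₂ x) (inj₁ y) = ≡.sym (Iᴹ-off (λ e → different (≡.trans (≡.sym (Finₚ.splitAt-↑ʳ a b x)) (≡.trans (≡.cong (Fin.splitAt a) e) (Finₚ.splitAt-↑ˡ a y b)))))
        where
        different : inj₂ x ≢ inj₁ y
        different ()
      blocks-I (inj₂ x) (inj₂ y) with x Fin.≟ y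
      ... | yes ≡.refl = ≡.sym (Iᴹ-diagonal (a Fin.↑ʳ x))
      ... | no x≢y     = ≡.sym (Iᴹ-off (λ e → x≢y (Finₚ.↑ʳ-injective a x y e)))

    ⊕-I : (Iᴹ ⊕ Iᴹ) ≈ᴹ Iᴹ
    ⊕-I i j = reflexive (≡.trans (blocks-I (Fin.splitAt a i) (Fin.splitAt a j)) (≡.cong₂ Iᴹ (Finₚ.join-splitAt a b i) (Finₚ.join-splitAt a b j)))

    ⊕-scalar : ∀ x → (scalar x ⊕ scalar x) ≈ᴹ scalar x
    ⊕-scalar x i j = trans pull (*-congˡ (⊕-I i j))
      where
      pull : (scalar x ⊕ scalar x) i j ≈ x * (Iᴹ ⊕ Iᴹ) i j
      pull with Fin.splitAt a i | Fin.splitAt a j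
      ... | inj₁ _ | inj₁ _ = refl
      ... | inj₁ _ | inj₂ _ = sym (zeroʳ x)
      ... | inj₂ _ | inj₁ _ = sym (zeroʳ x)
      ... | inj₂ _ | inj₂ _ = refl

    ⊕-* : ∀ A B C D → ((A ⊕ B) *ᴹ (C ⊕ D)) ≈ᴹ ((A *ᴹ C) ⊕ (B *ᴹ D))
    ⊕-* A B C D i j = trans (Σᶠ-split a (λ t → (A ⊕ B) i t * (C ⊕ D) t j)) (trans (+-cong
        (Σᶠ-cong {a} (λ t → reflexive (≡.cong (λ z → blocks A B (Fin.splitAt a i) z * blocks C D z (Fin.splitAt a j)) (Finₚ.splitAt-↑ˡ a t b))))
        (Σᶠ-cong {b} (λ t → reflexive (≡.cong (λ z → blocks A B (Fin.splitAt a i) z * blocks C D z (Fin.splitAt a j)) (Finₚ.splitAt-↑ʳ a b t)))))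
      (product (Fin.splitAt a i) (Fin.splitAt a j)))
      where
      Σᶠ-split : ∀ a {b} (f : Fin (a ℕ.+ b) → Carrier) → Σᶠ f ≈ Σᶠ (λ i → f (i Fin.↑ˡ b)) + Σᶠ (λ j → f (a Fin.↑ʳ j))
      Σᶠ-split zero    f = sym (+-identityˡ _)
      Σᶠ-split (suc a) f = trans (+-congˡ (Σᶠ-split a (f ∘ suc))) (sym (+-assoc _ _ _))
      product : ∀ x y → Σᶠ (λ t → blocks A B x (inj₁ t) * blocks C D (inj₁ t) y) + Σᶠ (λ t → blocks A B x (inj₂ t) * blocks C D (inj₂ t) y) ≈ blocks (A *ᴹ C) (B *ᴹ D) x y
      product (inj₁ x) (inj₁ y) = trans (+-congˡ (Σᶠ-zero {b} (λ t → zeroˡ _))) (+-identityʳ _)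
      product (inj₁ x) (inj₂ y) = trans (+-cong (Σᶠ-zero {a} (λ t → zeroʳ _)) (Σᶠ-zero {b} (λ t → zeroˡ _))) (+-identityʳ _)
      product (inj₂ x) (inj₁ y) = trans (+-cong (Σᶠ-zero {a} (λ t → zeroˡ _)) (Σᶠ-zero {b} (λ t → zeroʳ _))) (+-identityʳ _)
      product (inj₂ x) (inj₂ y) = trans (+-congʳ (Σᶠ-zero {a} (λ t → zeroˡ _))) (+-identityˡ _)

    ⊕-^ : ∀ A B n → ((A ⊕ B) ^ᴹ n) ≈ᴹ ((A ^ᴹ n) ⊕ (B ^ᴹ n))
    ⊕-^ A B zero    = M.sym ⊕-I
    ⊕-^ A B (suc n) = M.trans (M.*-congˡ {x = A ⊕ B} (⊕-^ A B n)) (⊕-* A B (A ^ᴹ n) (B ^ᴹ n))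

  ScalarSum : ℕ → Carrier → ℕ → Set _
  ScalarSum k x n = ∃₂ λ (A B : Mat n) → ((A ^ᴹ k) +ᴹ (B ^ᴹ k)) ≈ᴹ scalar x

  scalarSum-+ : ∀ {k x a b} → ScalarSum k x a → ScalarSum k x b → ScalarSum k x (a ℕ.+ b)
  scalarSum-+ {k} {x} {a} {b} (A , B , h) (C , D , h′) = A ⊕ C , B ⊕ D
    , M.trans (M.+-cong (⊕-^ A C k) (⊕-^ B D k)) (M.trans (⊕-+ (A ^ᴹ k) (C ^ᴹ k) (B ^ᴹ k) (D ^ᴹ k)) (M.trans (⊕-cong h h′) (⊕-scalar {a} {b} x)))

-- Arithmetic: coprime summands, greatest common divisors and numerical bounds.

module Arithmetic where
  open Data.Nat using (_+_; _*_; _^_; _∸_)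
  open import Data.Nat.Primality using (prime⇒irreducible)
  open import Data.Nat.Coprimality using (Coprime; coprime⇒gcd≡1)
  open import Data.Nat.GCD using (gcd[m,n]∣m; gcd[m,n]∣n; gcd-greatest)

  gcd-prime : ∀ {p} m → Prime p → ¬ (p ∣ m) → gcd m p ≡ 1
  gcd-prime {p} m p-prime p∤m with prime⇒irreducible p-prime (gcd[m,n]∣n m p)
  ... | inj₁ e = e
  ... | inj₂ e = ⊥-elim (p∤m (≡.subst (_∣ m) e (gcd[m,n]∣m m p)))

  parity : ∀ n → ∃ λ t → n ≡ t + t ⊎ n ≡ suc (t + t)
  parity zero = 0 , inj₁ ≡.refl
  parity (suc n) with parity n
  ... | t , inj₁ e = t , inj₂ (≡.cong suc e)
  ... | t , inj₂ e = suc t , inj₁ (≡.trans (≡.cong suc e) (≡.cong suc (≡.sym (ℕₚ.+-suc t t))))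

  private
    divides-difference : ∀ {c m n d} → c ∣ m → c ∣ n → n ≡ m + d → c ∣ d
    divides-difference c∣m c∣n ≡.refl = Div.∣m+n∣m⇒∣n c∣n c∣m

    odd-divisor-of-4 : ∀ {c x} r → c ∣ 4 → c ∣ x → x ≡ 2 * r + 1 → c ≡ 1
    odd-divisor-of-4 {c} r c∣4 c∣x ≡.refl = Div.∣1⇒≡1 (divides-difference (Div.∣m⇒∣m*n r c∣2) c∣x ≡.refl)
      where
      lem : ∀ r → 2 * (2 * r + 1) ≡ 4 * r + 2
      lem = solve-∀
      c∣2 : c ∣ 2
      c∣2 = divides-difference (Div.∣m⇒∣m*n r c∣4) (Div.∣n⇒∣m*n 2 c∣x) (lem r)

    -- For n = 2 t + 1 the summands are t and t + 1.
    odd : ∀ t → 10 ≤ suc (t + t) → ∃₂ λ a b → 3 + a + (3 + b) ≡ suc (t + t) × Coprime (3 + a) (suc (t + t))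
    odd 0 (s≤s ())
    odd 1 (s≤s (s≤s (s≤s ())))
    odd 2 (s≤s (s≤s (s≤s (s≤s (s≤s ())))))
    odd t@(suc (suc (suc a))) _ = a , suc a , lem₀ a
      , (λ (c∣t , c∣n) → Div.∣1⇒≡1 (divides-difference (Div.∣n⇒∣m*n 2 c∣t) c∣n (lem₁ t)))
      where
      lem₀ : ∀ a → 3 + a + (4 + a) ≡ suc (3 + a + (3 + a))
      lem₀ = solve-∀
      lem₁ : ∀ t → suc (t + t) ≡ 2 * t + 1
      lem₁ = solve-∀

    -- Here 4 r = (2 r - 1) + (2 r + 1). A divisor of 4 r and 2 r - 1 divides 4 r - 2 (2 r - 1) = 2,
    -- and it is odd.
    even₀ : ∀ r → 10 ≤ r + r + (r + r) → ∃₂ λ a b → 3 + a + (3 + b) ≡ r + r + (r + r) × Coprime (3 + a) (r + r + (r + r))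
    even₀ 0 ()
    even₀ 1 (s≤s (s≤s (s≤s (s≤s ()))))
    even₀ (suc (suc r)) _ = r + r , suc (suc (r + r)) , lem₀ r
      , (λ (c∣a , c∣n) → odd-divisor-of-4 (suc r) (Div.∣n⇒∣m*n 2 (divides-difference (Div.∣n⇒∣m*n 2 c∣a) c∣n (lem₁ r))) c∣a (lem₂ r))
      where
      lem₀ : ∀ r → 3 + (r + r) + (5 + (r + r)) ≡ suc (suc r) + suc (suc r) + (suc (suc r) + suc (suc r))
      lem₀ = solve-∀
      lem₁ : ∀ r → suc (suc r) + suc (suc r) + (suc (suc r) + suc (suc r)) ≡ 2 * (3 + (r + r)) + 2
      lem₁ = solve-∀
      lem₂ : ∀ r → 3 + (r + r) ≡ 2 * suc r + 1
      lem₂ = solve-∀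

    -- Half of 4 r + 2 is odd, so its neighbours are even and the shift must be 2: the summands are
    -- 2 r - 1 and 2 r + 3. A common divisor with n divides 4 and is odd. The case r = 1 would give
    -- 1 + 5.
    even₂ : ∀ r → 10 ≤ suc (r + r) + suc (r + r) → ∃₂ λ a b → 3 + a + (3 + b) ≡ suc (r + r) + suc (r + r) × Coprime (3 + a) (suc (r + r) + suc (r + r))
    even₂ 0 (s≤s (s≤s ()))
    even₂ 1 (s≤s (s≤s (s≤s (s≤s (s≤s (s≤s ()))))))
    even₂ (suc (suc r)) _ = r + r , suc (suc (suc (suc (r + r)))) , lem₀ r
      , (λ (c∣a , c∣n) → odd-divisor-of-4 (suc r) (divides-difference (Div.∣n⇒∣m*n 2 c∣a) c∣n (lem₁ r)) c∣a (lem₂ r))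
      where
      lem₀ : ∀ r → 3 + (r + r) + (7 + (r + r)) ≡ suc (suc (suc r) + suc (suc r)) + suc (suc (suc r) + suc (suc r))
      lem₀ = solve-∀
      lem₁ : ∀ r → suc (suc (suc r) + suc (suc r)) + suc (suc (suc r) + suc (suc r)) ≡ 2 * (3 + (r + r)) + 4
      lem₁ = solve-∀
      lem₂ : ∀ r → 3 + (r + r) ≡ 2 * suc r + 1
      lem₂ = solve-∀

    halves : ∀ n → 10 ≤ n → ∃₂ λ a b → 3 + a + (3 + b) ≡ n × Coprime (3 + a) n
    halves n 10≤n with parity n
    halves .(suc (t + t)) 10≤n | t , inj₂ ≡.refl = odd t 10≤n
    halves .(t + t) 10≤n | t , inj₁ ≡.refl with parity t
    ... | r , inj₁ ≡.refl = even₀ r 10≤n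
    ... | r , inj₂ ≡.refl = even₂ r 10≤n

  -- The summands are n/2 shifted by the least amount that makes them coprime to n.
  coprime-summands : ∀ n → 10 ≤ n → ∃₂ λ a b → 3 + a + (3 + b) ≡ n × Coprime (3 + a) n × Coprime (3 + b) n
  coprime-summands n 10≤n = let a , b , a+b≡n , coprime = halves n 10≤n in
    a , b , a+b≡n , coprime , λ (c∣b , c∣n) → coprime (divides-difference c∣b c∣n (≡.trans (≡.sym a+b≡n) (ℕₚ.+-comm (3 + a) (3 + b))) , c∣n)

  module _ {q} (1≤q : 1 ≤ q) {g : ℕ} where

    private
      -- The congruence q^s ≡ 1 modulo g with its quotient recorded, which keeps subtraction out of
      -- the computations.
      Order : ℕ → Set
      Order s = ∃ λ c → q ^ s ≡ suc (c * g)

      order : ∀ s → g ∣ q ^ s ∸ 1 → Order s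
      order s (divides c e) = c , ≡.trans (≡.sym (ℕₚ.m+[n∸m]≡n (ℕₚ.m^n>0 q {{ℕ.>-nonZero 1≤q}} s))) (≡.cong suc e)

      order-* : ∀ x {s} → Order s → Order (x * s)
      order-* zero    _ = 0 , ≡.refl
      order-* (suc x) {s} o@(c , e) with order-* x o
      ... | c′ , e′ = c + c′ + c * c′ * g , ≡.trans (ℕₚ.^-distribˡ-+-* q s (x * s)) (≡.trans (≡.cong₂ _*_ e e′) (lem c c′ g))
        where
        lem : ∀ c c′ g → suc (c * g) * suc (c′ * g) ≡ suc ((c + c′ + c * c′ * g) * g)
        lem = solve-∀

      -- Consecutive exponents suffice because (q^(s + 1) - 1) - q (q^s - 1) = q - 1.
      order-1 : ∀ {s} → Order s → Order (suc s) → g ∣ q ∸ 1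
      order-1 {s} (c , e) (c′ , e′) = Div.∣m+n∣m⇒∣n (≡.subst (g ∣_) (≡.trans (≡.sym eq) (ℕₚ.+-comm (q ∸ 1) _)) (Div.n∣m*n c′)) (Div.∣n⇒∣m*n q (Div.n∣m*n c))
        where
        eq : (q ∸ 1) + q * (c * g) ≡ c′ * g
        eq = ℕₚ.suc-injective (≡.trans (≡.cong (_+ q * (c * g)) (ℕₚ.m+[n∸m]≡n 1≤q)) (≡.trans (≡.sym (ℕₚ.*-suc q (c * g))) (≡.trans (≡.cong (q *_) (≡.sym e)) e′)))

    -- By Bézout some multiples of a and n differ by one, and multiples of admissible exponents are
    -- again admissible.
    coprime-orders : ∀ a n → Coprime a n → g ∣ q ^ a ∸ 1 → g ∣ q ^ n ∸ 1 → g ∣ q ∸ 1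
    coprime-orders a n coprime ga gn with Bézout.identity (gcd-GCD a n)
    ... | Bézout.+- x y eq = order-1 {y * n} (order-* y (order n gn)) (≡.subst Order (≡.sym (≡.trans (≡.cong (_+ y * n) (≡.sym (coprime⇒gcd≡1 coprime))) eq)) (order-* x (order a ga)))
    ... | Bézout.-+ x y eq = order-1 {x * a} (order-* x (order a ga)) (≡.subst Order (≡.sym (≡.trans (≡.cong (_+ x * a) (≡.sym (coprime⇒gcd≡1 coprime))) eq)) (order-* y (order n gn)))

  gcd-shrinks : ∀ {q k a n d} → 1 ≤ q → 1 ≤ d → d ≡ gcd k (q ∸ 1) → k ∣ q ^ n ∸ 1 → Coprime a n → gcd k (q ^ a ∸ 1) ≤ d
  gcd-shrinks {q} {k} {a} {n} {d} 1≤q 1≤d d≡ k∣ coprime = Div.∣⇒≤ {{ℕ.>-nonZero 1≤d}} (≡.subst (g ∣_) (≡.sym d≡)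
    (gcd-greatest g∣k (coprime-orders 1≤q a n coprime (gcd[m,n]∣n k (q ^ a ∸ 1)) (Div.∣-trans g∣k k∣))))
    where
    g : ℕ
    g = gcd k (q ^ a ∸ 1)
    g∣k : g ∣ k
    g∣k = gcd[m,n]∣m k (q ^ a ∸ 1)

  proper-divisor : ∀ {g k} → 1 ≤ k → g ∣ k → g ≡ k ⊎ g + g ≤ k
  proper-divisor 1≤k (divides zero ≡.refl) = ⊥-elim (ℕₚ.<⇒≱ 1≤k z≤n)
  proper-divisor {g} 1≤k (divides (suc zero) e) = inj₁ (≡.sym (≡.trans e (ℕₚ.*-identityˡ g)))
  proper-divisor {g} 1≤k (divides (suc (suc t)) e) = inj₂ (ℕₚ.≤-trans (ℕₚ.+-monoʳ-≤ g (ℕₚ.m≤m+n g (t * g))) (ℕₚ.≤-reflexive (≡.sym e)))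

  -- For g ≥ 2 the bound 2 g ≤ k gives g + 1 ≤ k - 1, and (g + 1)⁴ exceeds g⁴ by far more than 4;
  -- for g = 1 the bound on Q is enough.
  small-gcd : ∀ {g k Q} → 1 ≤ g → g + g ≤ k → 5 < Q → (k ∸ 1) ^ 4 < Q → g ^ 4 + 4 < Q
  small-gcd {suc zero}    _ _    5<Q _ = 5<Q
  small-gcd {suc (suc g)} {k} {Q} _ 2g≤k _ k⁴<Q = begin-strict
    suc (suc g) ^ 4 + 4            ≤⟨ ℕₚ.m≤m+n _ _ ⟩
    suc (suc g) ^ 4 + 4 + r        ≡⟨ lem g ⟩
    suc (suc (suc g)) ^ 4          ≤⟨ ℕₚ.^-monoˡ-≤ 4 (ℕₚ.∸-monoˡ-≤ 1 (ℕₚ.≤-trans (s≤s (s≤s (ℕₚ.m≤n+m (suc (suc g)) g))) 2g≤k)) ⟩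
    (k ∸ 1) ^ 4                    <⟨ k⁴<Q ⟩
    Q                              ∎
    where
    open ℕₚ.≤-Reasoning
    r : ℕ
    r = 4 * (g * g * g) + 30 * (g * g) + 76 * g + 61
    lem : ∀ g → (suc (suc g) * (suc (suc g) * (suc (suc g) * (suc (suc g) * 1)))) + 4 + (4 * (g * g * g) + 30 * (g * g) + 76 * g + 61) ≡ suc (suc (suc g)) * (suc (suc (suc g)) * (suc (suc (suc g)) * (suc (suc (suc g)) * 1)))
    lem = solve-∀

  -- Already q³ ≥ 5 (d² + 1)² > d⁴ + 4: two factors q supply d⁴, and the third absorbs the constant.
  large-extension : ∀ {g d q} a → g ≤ d → d * d < q → 5 ≤ q → g ^ 4 + 4 < q ^ suc (suc (suc a))
  large-extension {g} {d} {q} a g≤d d²<q 5≤q = begin-strict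
    g ^ 4 + 4                                    ≤⟨ ℕₚ.+-monoˡ-≤ 4 (ℕₚ.^-monoˡ-≤ 4 g≤d) ⟩
    d ^ 4 + 4                                    <⟨ ℕₚ.m≤m+n _ (4 * d ^ 4 + 10 * (d * d)) ⟩
    suc (d ^ 4 + 4) + (4 * d ^ 4 + 10 * (d * d)) ≡⟨ lem d ⟩
    5 * (suc (d * d) * suc (d * d))              ≤⟨ ℕₚ.*-mono-≤ 5≤q (ℕₚ.*-mono-≤ d²<q d²<q) ⟩
    q * (q * q)                                  ≤⟨ ℕₚ.*-monoʳ-≤ q (ℕₚ.*-monoʳ-≤ q (ℕₚ.m≤m*n q (q ^ a) {{ℕₚ.m^n≢0 q a {{q≢0}}}})) ⟩
    q ^ suc (suc (suc a))                        ∎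
    where
    open ℕₚ.≤-Reasoning
    q≢0 : ℕ.NonZero q
    q≢0 = ℕ.>-nonZero (ℕₚ.≤-trans (s≤s z≤n) 5≤q)
    lem : ∀ d → suc (d * (d * (d * (d * 1))) + 4) + (4 * (d * (d * (d * (d * 1)))) + 10 * (d * d)) ≡ 5 * (suc (d * d) * suc (d * d))
    lem = solve-∀

  dimension-bound : ∀ p n → 5 ≤ p → p * p + 9 < 2 * n + 3 * p → 4 * p ≤ n * 2
  dimension-bound p n 5≤p large with ℕₚ.m+[n∸m]≡n 5≤p
  ... | e = ℕₚ.+-cancelʳ-≤ (3 * p) _ _ (begin
    4 * p + 3 * p       ≤⟨ quadratic (p ∸ 5) e ⟩
    suc (p * p + 9)     ≤⟨ large ⟩
    2 * n + 3 * p       ≡⟨ ≡.cong (_+ 3 * p) (ℕₚ.*-comm 2 n) ⟩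
    n * 2 + 3 * p       ∎)
    where
    open ℕₚ.≤-Reasoning
    lem : ∀ r → 4 * (5 + r) + 3 * (5 + r) + (r * r + 3 * r) ≡ (5 + r) * (5 + r) + 10
    lem = solve-∀
    -- (p − 2) (p − 5) ≥ 0
    quadratic : ∀ r → 5 + r ≡ p → 4 * p + 3 * p ≤ suc (p * p + 9)
    quadratic r ≡.refl = ℕₚ.≤-trans (ℕₚ.m≤m+n _ _) (ℕₚ.≤-reflexive (≡.trans (lem r) (ℕₚ.+-suc ((5 + r) * (5 + r)) 9)))

-- Assembly: canonical roots, then the non-scalar, scalar and zero matrices.

module MainTheorem {c ℓ} (F : Field c ℓ) {q : ℕ} (enum : Inverse (≡.setoid (Fin q)) (Field.setoid F))
                   {p l : ℕ} (p-prime : Prime p) (5≤p : 5 ≤ p) (q≡pˡ : q ≡ p ℕ.^ l)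
                   (k : ℕ) (1≤k : 1 ≤ k) (p∤k : ¬ (p ∣ k))
                   (d : ℕ) (1≤d : 1 ≤ d) (d≡ : d ≡ gcd k (q ℕ.∸ 1)) (d²<q : d ℕ.* d < q) where
  open Field F hiding (zero)
  open FieldProperties F
  open FiniteField F enum using (elt; idx; elt-idx; idx-elt; idx-injective; _≟_; ∑)
  open FiniteFieldProperties F enum using (Q×1≈0; module Powers)
  open Powers k 1≤k using (Power; η; powers-bound)
  open MatrixRing F
  open Arithmetic
  open import Data.Nat.Coprimality using (Coprime)
  open import Data.Nat.GCD using (gcd[m,n]∣m; gcd[m,n]∣n)
  open RingSolver commutativeRing
  open import Relation.Binary.Reasoning.Setoid setoid
  open import Algebra.Properties.Semiring.Mult semiring using (×-comm-*; ×-assoc-*)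

  private
    p×1≈0 : p ×ᴷ 1# ≈ 0#
    p×1≈0 = characteristic p l (trans (×-congˡ (≡.sym q≡pˡ)) Q×1≈0) (λ x → x ≟ 0#)

    1≤q : 1 ≤ q
    1≤q = ℕₚ.≤-<-trans z≤n d²<q

    5≤q : 5 ≤ q
    5≤q = bound l q≡pˡ
      where
      bound : ∀ l → q ≡ p ℕ.^ l → 5 ≤ q
      -- The exponent l = 0 would mean q = 1, against 1 ≤ d² < q.
      bound zero    e = ⊥-elim (ℕₚ.<⇒≱ (ℕₚ.≤-<-trans (ℕₚ.*-mono-≤ 1≤d 1≤d) d²<q) (ℕₚ.≤-reflexive e))
      bound (suc l) e = ℕₚ.≤-trans (ℕₚ.≤-trans 5≤p (ℕₚ.m≤m*n p (p ℕ.^ l) {{ℕₚ.m^n≢0 p l {{ℕ.>-nonZero (ℕₚ.≤-trans (s≤s z≤n) 5≤p)}}}})) (ℕₚ.≤-reflexive (≡.sym e))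

    zero-multiples : ∀ {m} → m ×ᴷ 1# ≈ 0# → ∀ x → (x ℕ.* m) ×ᴷ 1# ≈ 0#
    zero-multiples {m} h x = trans (×1-homo-* x m) (trans (*-congˡ h) (zeroʳ _))

    multiple≉0 : ∀ m → ¬ (p ∣ m) → ¬ (m ×ᴷ 1# ≈ 0#)
    multiple≉0 m p∤m m≈0 with Bézout.identity (gcd-GCD m p)
    ... | Bézout.+- x y eq = 1≉0 (begin
      1#                              ≈⟨ trans (+-congˡ (zero-multiples p×1≈0 y)) (+-identityʳ 1#) ⟨
      suc (y ℕ.* p) ×ᴷ 1#             ≡⟨ ≡.cong (λ g → (g ℕ.+ y ℕ.* p) ×ᴷ 1#) (gcd-prime m p-prime p∤m) ⟨
      (gcd m p ℕ.+ y ℕ.* p) ×ᴷ 1#     ≡⟨ ≡.cong (_×ᴷ 1#) eq ⟩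
      (x ℕ.* m) ×ᴷ 1#                 ≈⟨ zero-multiples m≈0 x ⟩
      0#                              ∎)
    ... | Bézout.-+ x y eq = 1≉0 (begin
      1#                              ≈⟨ trans (+-congˡ (zero-multiples m≈0 x)) (+-identityʳ 1#) ⟨
      suc (x ℕ.* m) ×ᴷ 1#             ≡⟨ ≡.cong (λ g → (g ℕ.+ x ℕ.* m) ×ᴷ 1#) (gcd-prime m p-prime p∤m) ⟨
      (gcd m p ℕ.+ x ℕ.* m) ×ᴷ 1#     ≡⟨ ≡.cong (_×ᴷ 1#) eq ⟩
      (y ℕ.* p) ×ᴷ 1#                 ≈⟨ zero-multiples p×1≈0 y ⟩
      0#                              ∎)

    2≉0 : ¬ (1# + 1# ≈ 0#)
    2≉0 h = multiple≉0 2 (λ p∣2 → ℕₚ.<⇒≱ (ℕₚ.≤-trans (s≤s (s≤s (s≤s z≤n))) 5≤p) (Div.∣⇒≤ p∣2)) (trans (+-congˡ (+-identityʳ 1#)) h)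

    -- One k-th root of each power, so that distinct chosen roots have distinct powers.
    Canonical : Carrier → Set (c ⊔ ℓ)
    Canonical y = ¬ (y ≈ 0#) × (∀ z → z ^ k ≈ y ^ k → idx y Fin.≤ idx z)

    least : ∀ {n a} {P : Fin n → Set a} → (∀ i → Dec (P i)) → ∃ P → ∃ λ i → P i × (∀ j → P j → i Fin.≤ j)
    least {suc n} P? (i , h) with P? zero
    ... | yes h₀ = zero , h₀ , λ _ _ → z≤n
    ... | no ¬h₀ with i
    ... | zero   = ⊥-elim (¬h₀ h)
    ... | suc i₁ = let j , hj , min = least (P? ∘ suc) (i₁ , h) in
      suc j , hj , λ { zero h₀ → ⊥-elim (¬h₀ h₀) ; (suc j′) h′ → s≤s (min j′ h′) }

    canonical-root : ∀ {v} → Power v → ∃ λ ω → Canonical ω × ω ^ k ≈ v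
    canonical-root {v} (y , y≉0 , y^k≈v) =
      let i , root , min = least (λ i → elt i ^ k ≟ v) (idx y , trans (^-congˡ k (elt-idx y)) y^k≈v)
      in elt i , ((λ e → x^n≉0 k y≉0 (trans (trans y^k≈v (sym root)) (trans (^-congˡ k e) (0^k≈0 k 1≤k))))
                 , λ z h → ≡.subst (Fin._≤ idx z) (≡.sym (idx-elt i)) (min (idx z) (trans (^-congˡ k (elt-idx z)) (trans h root)))) , root
      where
      0^k≈0 : ∀ k → 1 ≤ k → 0# ^ k ≈ 0#
      0^k≈0 (suc k) _ = zeroˡ _

    canonical-unique : ∀ {μ α} → Canonical μ → Canonical α → μ ^ k ≈ α ^ k → μ ≈ α
    canonical-unique (_ , μ-min) (_ , α-min) h = idx-injective (Finₚ.≤-antisym (μ-min _ (sym h)) (α-min _ h))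

  open KthRoots F k using (geometric)

  private
    geometric-difference : ∀ m μ α → (μ - α) * geometric m μ α ≈ μ ^ m - α ^ m
    geometric-difference zero    μ α = trans (zeroʳ _) (sym (-‿inverseʳ 1#))
    geometric-difference (suc m) μ α = begin
      (μ - α) * (μ ^ m + α * geometric m μ α)                   ≈⟨ solve 4 (λ μ α x g → (μ :- α) :* (x :+ α :* g) := (μ :- α) :* x :+ α :* ((μ :- α) :* g)) refl μ α (μ ^ m) (geometric m μ α) ⟩
      (μ - α) * μ ^ m + α * ((μ - α) * geometric m μ α)         ≈⟨ +-congˡ (*-congˡ (geometric-difference m μ α)) ⟩
      (μ - α) * μ ^ m + α * (μ ^ m - α ^ m)                     ≈⟨ solve 4 (λ μ α x y → (μ :- α) :* x :+ α :* (x :- y) := μ :* x :- α :* y) refl μ α (μ ^ m) (α ^ m) ⟩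
      μ * μ ^ m - α * α ^ m                                     ∎

    geometric-equal : ∀ m {μ α} → μ ≈ α → geometric (suc m) μ α ≈ suc m ×ᴷ (μ ^ m)
    geometric-equal zero    h = +-congˡ (zeroʳ _)
    geometric-equal (suc m) {μ} {α} h = +-congˡ (trans (*-congˡ (geometric-equal m h)) (trans (×-comm-* (suc m) α (μ ^ m)) (×-congʳ (suc m) (*-congʳ (sym h)))))

    -- If the divided difference vanishes, then μᵏ = αᵏ, and canonical roots with equal powers
    -- coincide. For μ = α its value is k μ^(k - 1), nonzero because p does not divide k.
    geometric≉0 : ∀ {μ α} → Canonical μ → Canonical α → ¬ (geometric k μ α ≈ 0#)
    geometric≉0 {μ} {α} μ-can α-can g≈0 = distinct (canonical-unique μ-can α-can (x-y≈0⇒x≈y (trans (sym (geometric-difference k μ α)) (trans (*-congˡ g≈0) (zeroʳ _)))))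
      where
      distinct : ¬ (μ ≈ α)
      distinct μ≈α = equal-case k 1≤k p∤k g≈0
        where
        equal-case : ∀ k → 1 ≤ k → ¬ (p ∣ k) → ¬ (geometric k μ α ≈ 0#)
        equal-case (suc m) _ p∤ e = xy≉0 (multiple≉0 (suc m) p∤) (x^n≉0 m (proj₁ μ-can)) (begin
          (suc m ×ᴷ 1#) * μ ^ m     ≈⟨ ×-assoc-* (suc m) 1# (μ ^ m) ⟩
          suc m ×ᴷ (1# * μ ^ m)     ≈⟨ ×-congʳ (suc m) (*-identityˡ _) ⟩
          suc m ×ᴷ (μ ^ m)          ≈⟨ geometric-equal m μ≈α ⟨
          geometric (suc m) μ α     ≈⟨ e ⟩
          0#                        ∎)

    h : ℕ
    h = ∑ η

    q∸1≤hd : q ℕ.∸ 1 ≤ h ℕ.* d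
    q∸1≤hd = ≡.subst (λ g → q ℕ.∸ 1 ≤ h ℕ.* g) (≡.sym d≡) powers-bound

    -- This is where q > d² enters: d² ≤ q - 1 ≤ h d. It turns q - 1 ≤ h d into q - 1 ≤ h², the
    -- density needed for the sums of powers.
    d≤h : d ≤ h
    d≤h = ℕₚ.*-cancelʳ-≤ d h d {{ℕ.>-nonZero 1≤d}} (ℕₚ.≤-trans (ℕₚ.∸-monoˡ-≤ 1 d²<q) q∸1≤hd)

    q∸1≤h² : q ℕ.∸ 1 ≤ h ℕ.* h
    q∸1≤h² = ℕₚ.≤-trans q∸1≤hd (ℕₚ.*-monoʳ-≤ h d≤h)

    2≤h : 2 ≤ h
    2≤h = square h (ℕₚ.≤-trans (ℕₚ.∸-monoˡ-≤ 1 5≤q) q∸1≤h²)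
      where
      square : ∀ n → 4 ≤ n ℕ.* n → 2 ≤ n
      square (suc zero)    (s≤s ())
      square (suc (suc n)) _ = s≤s (s≤s z≤n)

  open NonScalar F (λ x → x ≟ 0#) 2≉0
  open SumsOfPowers F enum k 1≤k

  TwoPowers : ∀ {n} → Mat n → Set (c ⊔ ℓ)
  TwoPowers {n} A = ∃₂ λ (X Y : Mat n) → ((X ^ᴹ k) +ᴹ (Y ^ᴹ k)) ≈ᴹ A

  nonscalar-case : ∀ n (A : Mat (suc n)) → ¬ Scalar A → 4 ℕ.* p ≤ suc n ℕ.* 2 → TwoPowers A
  nonscalar-case n A ¬scalar 4p≤2n =
    let X , Y , (R , R^k≈X , _) , (S , S^k≈Y , _) , X+Y≈A = splits n A (inj₂ ¬scalar) (all-traces p 5≤p p×1≈0 4p≤2n (trace A))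
    in R , S , M.trans (M.+-cong R^k≈X S^k≈Y) X+Y≈A
    where
    uncons : ∀ {s t} → SumOfPowers (suc s) t → ∃₂ λ h u → (∃ λ ω → Canonical ω × ω ^ k ≈ h) × SumOfPowers s u × t ≈ h + u
    uncons (cons h s e) = _ , _ , canonical-root h , s , e
    S-zero : ∀ {t} → SumOfPowers 0 t → t ≈ 0#
    S-zero (nil e) = e
    -- Matching on p exhibits the characteristic as a successor, the form in which `sums-of-powers`
    -- takes it.
    all-traces : ∀ p → 5 ≤ p → p ×ᴷ 1# ≈ 0# → 4 ℕ.* p ≤ suc n ℕ.* 2 → ∀ t → SumOfPowers (suc n ℕ.* 2) t
    all-traces (suc p) _ h le = sums-of-powers p h q∸1≤h² 2≤h (suc n ℕ.* 2) le
    open Decomposition k {Canonical} geometric≉0 {SumOfPowers} sop-resp S-zero uncons using (splits)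

  open BlockDiagonal F using (ScalarSum; scalarSum-+)

  scalar-block : ∀ a n → k ∣ q ℕ.^ n ℕ.∸ 1 → Coprime (suc (suc (suc a))) n → ∀ x → ¬ (x ≈ 0#) → ScalarSum k x (suc (suc (suc a)))
  scalar-block a n k∣ coprime = block (gcd k (q ℕ.^ suc (suc (suc a)) ℕ.∸ 1)) ≡.refl (gcd-shrinks {a = suc (suc (suc a))} {n} 1≤q 1≤d d≡ k∣ coprime)
    where
    block : ∀ g → g ≡ gcd k (q ℕ.^ suc (suc (suc a)) ℕ.∸ 1) → g ≤ d → ∀ x → ¬ (x ≈ 0#) → ScalarSum k x (suc (suc (suc a)))
    block g g≡ g≤d = Representation.scalar-sum F enum {p} {l} p-prime q≡pˡ (suc (suc a)) k 1≤k g g≡ (large-extension a g≤d d²<q 5≤q)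

  scalar-case : ∀ n → 10 ≤ suc n → (k ℕ.∸ 1) ℕ.^ 4 < q ℕ.^ suc n → ∀ x → ¬ (x ≈ 0#) → ScalarSum k x (suc n)
  scalar-case n 10≤n k⁴<qⁿ x x≉0 = by-gcd (gcd k (q ℕ.^ suc n ℕ.∸ 1)) ≡.refl
      (ℕₚ.n≢0⇒n>0 (gcd[m,n]≢0 k (q ℕ.^ suc n ℕ.∸ 1) (inj₁ (ℕₚ.>⇒≢ 1≤k)))) (gcd[m,n]∣m k (q ℕ.^ suc n ℕ.∸ 1)) (gcd[m,n]∣n k (q ℕ.^ suc n ℕ.∸ 1))
    where
    5<qⁿ : 5 < q ℕ.^ suc n
    5<qⁿ = ℕₚ.<-≤-trans (s≤s 5≤q) (power n (ℕₚ.≤-pred 10≤n))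
      where
      power : ∀ n → 9 ≤ n → suc q ≤ q ℕ.^ suc n
      power (suc n) _ = ℕₚ.≤-trans (ℕₚ.≤-trans (ℕₚ.+-monoˡ-≤ q 1≤q) (ℕₚ.≤-trans (ℕₚ.≤-reflexive (≡.cong (q ℕ.+_) (≡.sym (ℕₚ.+-identityʳ q)))) (ℕₚ.*-monoˡ-≤ q (ℕₚ.≤-trans (s≤s (s≤s z≤n)) 5≤q))))
        (ℕₚ.*-monoʳ-≤ q (ℕₚ.m≤m*n q (q ℕ.^ n) {{ℕₚ.m^n≢0 q n {{ℕ.>-nonZero 1≤q}}}}))
    by-gcd : ∀ g → g ≡ gcd k (q ℕ.^ suc n ℕ.∸ 1) → 1 ≤ g → g ∣ k → g ∣ q ℕ.^ suc n ℕ.∸ 1 → ScalarSum k x (suc n)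
    by-gcd g g≡ 1≤g g∣k g∣ with proper-divisor 1≤k g∣k
    ... | inj₂ 2g≤k = Representation.scalar-sum F enum {p} {l} p-prime q≡pˡ n k 1≤k g g≡ (small-gcd 1≤g 2g≤k 5<qⁿ k⁴<qⁿ) x x≉0
    ... | inj₁ g≡k =
      let a , b , a+b≡n , a-coprime , b-coprime = coprime-summands (suc n) 10≤n
          k∣ = ≡.subst (_∣ q ℕ.^ suc n ℕ.∸ 1) g≡k g∣
      in ≡.subst (ScalarSum k x) a+b≡n (scalarSum-+ {k} {x} (scalar-block a (suc n) k∣ a-coprime x x≉0) (scalar-block b (suc n) k∣ b-coprime x x≉0))

  zero-case : ∀ n → TwoPowers (0ᴹ {n})
  zero-case n = 0ᴹ , 0ᴹ , M.trans (M.+-cong (power k 1≤k) (power k 1≤k)) (M.+-identityˡ 0ᴹ)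
    where
    power : ∀ k → 1 ≤ k → (0ᴹ {n} ^ᴹ k) ≈ᴹ 0ᴹ
    power (suc k) _ = M.zeroˡ (0ᴹ ^ᴹ k)

  two-powers : ∀ n → 10 ≤ n → 4 ℕ.* p ≤ n ℕ.* 2 → (k ℕ.∸ 1) ℕ.^ 4 < q ℕ.^ n → (A : Mat n) → TwoPowers A
  two-powers (suc n) 10≤n 4p≤2n k⁴<qⁿ A with scalar? A | A zero zero ≟ 0#
  ... | no ¬scalar | _       = nonscalar-case n A ¬scalar 4p≤2n
  ... | yes scalar | no a≉0  = let X , Y , h = scalar-case n 10≤n k⁴<qⁿ (A zero zero) a≉0 in X , Y , M.trans h (M.sym scalar)
  ... | yes scalar | yes a≈0 = let X , Y , h = zero-case (suc n) in X , Y , M.trans h (λ i j → sym (trans (scalar i j) (trans (*-congʳ a≈0) (zeroˡ _))))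

open Data.Nat using (_+_; _*_; _∸_; _^_; _/_; NonZero)
open ≡ using (setoid)

-- The two bounds on n are cleared of fractions, subtraction and logarithms. For k = 1 the second
-- one reads 0 < qⁿ, in accordance with ln 0 = -∞.
theorem1p16 : ∀ {c ℓ : Level} (p l q n k d : ℕ) → Prime p → 5 ≤ p → q ≡ p ^ l
    → 2 ≤ n → 1 ≤ k → d ≡ gcd k (q ∸ 1) → .{{_ : NonZero d}}
    → d * d < q → ¬ (p ∣ k) → 2 ≤ gcd ((q ∸ 1) / d) (p ∸ 1)
    → p * p + 9 < 2 * n + 3 * p
    → (k ∸ 1) ^ 4 < q ^ n
    → (F : Field c ℓ) → Inverse (setoid (Fin q)) (Field.setoid F)
    → let open Matrices F in
    (M : Mat n) → ∃₂ λ (A B : Mat n) → ((A ^ᴹ k) +ᴹ (B ^ᴹ k)) ≈ᴹ M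
theorem1p16 p l q n k d p-prime 5≤p q≡pˡ _ 1≤k d≡ d²<q p∤k _ n-large k⁴<qⁿ F enum =
  MainTheorem.two-powers F enum {p} {l} p-prime 5≤p q≡pˡ k 1≤k p∤k d (Data.Nat.>-nonZero⁻¹ d) d≡ d²<q n 10≤n 4p≤2n k⁴<qⁿ
  where
  open Arithmetic using (dimension-bound)
  4p≤2n : 4 * p ≤ n * 2
  4p≤2n = dimension-bound p n 5≤p n-large
  -- From 20 = 4 · 5 ≤ 4 p ≤ 2 n.
  10≤n : 10 ≤ n
  10≤n = ℕₚ.*-cancelʳ-≤ 10 n 2 (ℕₚ.≤-trans (ℕₚ.*-monoʳ-≤ 4 5≤p) 4p≤2n)
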